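{- Let $G$ be a graph, let $f$ be a positive integer-valued function on $V(G)$, and let $a$ be a real number with $1\le a\le f(v)$ for all $v\in V(G)$. Suppose $G$ is $t$-iso-tough where $t(v)=\frac{1}{a}\big(f(v)+\frac{a}{2}\big)^2$, and for all $S\subseteq V(G)$ $$\omega(G\setminus S)<\sum_{v\in S}\big(f(v)-a\big)+2.$$ Then $G$ has a near $f$-factor.
   Context: Graphs are finite, have no loops, but may have multiple edges; degrees count multiplicities. For $S\subseteq V(G)$, $G\setminus S$ is the graph obtained by deleting $S$, $\omega(\cdot)$ is the number of connected components, and $I(G\setminus S)$ is the set of isolated vertices of $G\setminus S$. For a real function $t$ on $V(G)$, $G$ is $t$-iso-tough if $\sum_{v\in I(G\setminus S)}t(v)\le |S|$ for all $S\subseteq V(G)$. A near $f$-factor is a spanning subgraph $F$ with $d_F(v)=f(v)$ for all vertices $v$, except for at most one vertex $u$ with $d_F(u)=f(u)+1$. -}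

module Defs where

open import Data.Bool.Base using (if_then_else_)
open import Data.Empty using (⊥-elim)
open import Data.Fin.Base using (Fin)
import Data.Fin.Properties as Fin
open import Data.Fin.Subset using (Subset; _∉_; ∣_∣)
open import Data.Fin.Subset.Properties using (_∈?_)
open import Data.Integer.Base using (+_)
open import Data.List.Base as List using (List; []; _∷_; length; filter; deduplicate; allFin)
import Data.List.Membership.Propositional as List∈
open import Data.List.Membership.Propositional.Properties using (∈-allFin)
open import Data.List.Relation.Unary.Any using (here; there)
open import Data.Nat.Base as ℕ using (ℕ; suc; _⊔_)
import Data.Nat.Properties as ℕ
open import Data.Product.Base using (∃; _×_; _,_; proj₁; proj₂)
open import Data.Rational.Base as ℚ using (ℚ; 0ℚ; 1ℚ; ½; _/_)
import Data.Rational.Properties as ℚ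
open import Data.Rational.Solver using (module +-*-Solver)
open import Data.Sum.Base using (_⊎_; inj₁; inj₂)
open import Data.Vec.Functional using (foldr)
open import Level using (0ℓ)
open import Relation.Binary.Construct.Closure.ReflexiveTransitive using (Star; ε; _◅_; _◅◅_)
open import Relation.Binary.Core using (Rel)
open import Relation.Binary.Definitions using (Decidable)
open import Relation.Binary.PropositionalEquality
  using (_≡_; _≢_; refl; sym; trans; cong; cong₂; subst)
open import Relation.Nullary.Decidable
  using (yes; no; does; ¬?; map′; _×-dec_; _⊎-dec_; _→-dec_)
open import Relation.Unary as Unary using (Pred)

import Algebra.Properties.CommutativeMonoid.Sum as Sum

-- Reals are Cauchy sequences of rationals, not quotiented: x and y denote
-- the same real when x ≤ y and y ≤ x.

IsCauchy : (ℕ → ℚ) → Set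
IsCauchy x = ∀ e → 0ℚ ℚ.< e →
  ∃ λ N → ∀ m n → N ℕ.≤ m → N ℕ.≤ n → ℚ.∣ x m ℚ.- x n ∣ ℚ.≤ e

record ℝ : Set where
  constructor mkℝ
  field
    seq    : ℕ → ℚ
    cauchy : IsCauchy seq

open ℝ public

infix  4 _≤_ _<_
infixl 6 _+_ _-_
infixl 7 _*_

_≤_ : Rel ℝ 0ℓ
x ≤ y = ∀ e → 0ℚ ℚ.< e → ∃ λ N → ∀ n → N ℕ.≤ n → seq x n ℚ.≤ seq y n ℚ.+ e

_<_ : Rel ℝ 0ℓ
x < y = ∃ λ e → 0ℚ ℚ.< e × ∃ λ N → ∀ n → N ℕ.≤ n → seq x n ℚ.+ e ℚ.≤ seq y n

fromℚ : ℚ → ℝ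
fromℚ p = mkℝ (λ _ → p) λ e 0<e → 0 , λ _ _ _ _ →
  subst (λ q → ℚ.∣ q ∣ ℚ.≤ e) (sym (ℚ.+-inverseʳ p)) (ℚ.<⇒≤ 0<e)

fromℕ : ℕ → ℝ
fromℕ n = fromℚ (+ n / 1)

private
  open +-*-Solver

  pos-* : ∀ {p q} → 0ℚ ℚ.< p → 0ℚ ℚ.< q → 0ℚ ℚ.< p ℚ.* q
  pos-* {p} {q} 0<p 0<q =
    subst (ℚ._< p ℚ.* q) (ℚ.*-zeroʳ p) (ℚ.*-monoʳ-<-pos p {{ℚ.positive 0<p}} 0<q)

  0<½ : 0ℚ ℚ.< ½
  0<½ = ℚ.positive⁻¹ ½

  half+half : ∀ e → e ℚ.* ½ ℚ.+ e ℚ.* ½ ≡ e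
  half+half e = trans (sym (ℚ.*-distribˡ-+ e ½ ½)) (ℚ.*-identityʳ e)

  *-mono-≤ : ∀ {p q r s} → 0ℚ ℚ.≤ q → 0ℚ ℚ.≤ r →
             p ℚ.≤ q → r ℚ.≤ s → p ℚ.* r ℚ.≤ q ℚ.* s
  *-mono-≤ {p} {q} {r} {s} 0≤q 0≤r p≤q r≤s = ℚ.≤-trans
    (ℚ.*-monoʳ-≤-nonNeg r {{ℚ.nonNegative 0≤r}} p≤q)
    (ℚ.*-monoˡ-≤-nonNeg q {{ℚ.nonNegative 0≤q}} r≤s)

inv : ℚ → ℚ
inv p with p ℚ.≟ 0ℚ
... | yes _   = 0ℚ
... | no  p≢0 = ℚ.1/_ p {{ℚ.≢-nonZero p≢0}}

private
  inv-pos : ∀ {p} → 0ℚ ℚ.< p → p ℚ.* inv p ≡ 1ℚ × 0ℚ ℚ.< inv p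
  inv-pos {p} 0<p with p ℚ.≟ 0ℚ
  ... | yes refl = ⊥-elim (ℚ.<-irrefl refl 0<p)
  ... | no  p≢0  =
    ℚ.*-inverseʳ p {{ℚ.≢-nonZero p≢0}} ,
    ℚ.positive⁻¹ _ {{ℚ.1/pos⇒pos p {{ℚ.positive 0<p}}}}

  inv-anti : ∀ {d p} → 0ℚ ℚ.< d → d ℚ.≤ p → inv p ℚ.≤ inv d
  inv-anti {d} {p} 0<d d≤p = begin
    inv p                      ≡⟨ ℚ.*-identityʳ (inv p) ⟨
    inv p ℚ.* 1ℚ               ≡⟨ cong (inv p ℚ.*_) (proj₁ (inv-pos 0<d)) ⟨
    inv p ℚ.* (d ℚ.* inv d)    ≤⟨ ℚ.*-monoˡ-≤-nonNeg (inv p) {{ℚ.nonNegative (ℚ.<⇒≤ (proj₂ p⁻¹))}}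
                                   (ℚ.*-monoʳ-≤-nonNeg (inv d)
                                     {{ℚ.nonNegative (ℚ.<⇒≤ (proj₂ (inv-pos 0<d)))}} d≤p) ⟩
    inv p ℚ.* (p ℚ.* inv d)    ≡⟨ solve 3 (λ i p j → i :* (p :* j) := (p :* i) :* j) refl (inv p) p (inv d) ⟩
    (p ℚ.* inv p) ℚ.* inv d    ≡⟨ cong (ℚ._* inv d) (proj₁ p⁻¹) ⟩
    1ℚ ℚ.* inv d               ≡⟨ ℚ.*-identityˡ (inv d) ⟩
    inv d                      ∎
    where
    open ℚ.≤-Reasoning
    p⁻¹ = inv-pos (ℚ.<-≤-trans 0<d d≤p)

  inv-lipschitz : ∀ {d p q} → 0ℚ ℚ.< d → d ℚ.≤ p → d ℚ.≤ q →
    ℚ.∣ inv p ℚ.- inv q ∣ ℚ.≤ (inv d ℚ.* inv d) ℚ.* ℚ.∣ p ℚ.- q ∣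
  inv-lipschitz {d} {p} {q} 0<d d≤p d≤q = begin
    ℚ.∣ inv p ℚ.- inv q ∣
      ≡⟨ cong ℚ.∣_∣ (cong₂ (λ a b → a ℚ.- b)
           (trans (sym (ℚ.*-identityʳ (inv p))) (cong (inv p ℚ.*_) (sym (proj₁ q⁻¹))))
           (trans (sym (ℚ.*-identityʳ (inv q))) (cong (inv q ℚ.*_) (sym (proj₁ p⁻¹))))) ⟩
    ℚ.∣ inv p ℚ.* (q ℚ.* inv q) ℚ.- inv q ℚ.* (p ℚ.* inv p) ∣
      ≡⟨ cong ℚ.∣_∣ (solve 4 (λ i j p q → i :* (q :* j) :- j :* (p :* i) := :- ((i :* j) :* (p :- q)))
           refl (inv p) (inv q) p q) ⟩
    ℚ.∣ ℚ.- ((inv p ℚ.* inv q) ℚ.* (p ℚ.- q)) ∣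
      ≡⟨ ℚ.∣-p∣≡∣p∣ _ ⟩
    ℚ.∣ (inv p ℚ.* inv q) ℚ.* (p ℚ.- q) ∣
      ≡⟨ ℚ.∣p*q∣≡∣p∣*∣q∣ (inv p ℚ.* inv q) (p ℚ.- q) ⟩
    ℚ.∣ inv p ℚ.* inv q ∣ ℚ.* ℚ.∣ p ℚ.- q ∣
      ≡⟨ cong (ℚ._* ℚ.∣ p ℚ.- q ∣) (ℚ.0≤p⇒∣p∣≡p (ℚ.<⇒≤ (pos-* (proj₂ p⁻¹) (proj₂ q⁻¹)))) ⟩
    (inv p ℚ.* inv q) ℚ.* ℚ.∣ p ℚ.- q ∣
      ≤⟨ ℚ.*-monoʳ-≤-nonNeg ℚ.∣ p ℚ.- q ∣ {{ℚ.∣-∣-nonNeg (p ℚ.- q)}}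
           (*-mono-≤ (ℚ.<⇒≤ (proj₂ (inv-pos 0<d))) (ℚ.<⇒≤ (proj₂ q⁻¹))
             (inv-anti 0<d d≤p) (inv-anti 0<d d≤q)) ⟩
    (inv d ℚ.* inv d) ℚ.* ℚ.∣ p ℚ.- q ∣ ∎
    where
    open ℚ.≤-Reasoning
    p⁻¹ = inv-pos (ℚ.<-≤-trans 0<d d≤p)
    q⁻¹ = inv-pos (ℚ.<-≤-trans 0<d d≤q)

  cancel : ∀ {b} c → 0ℚ ℚ.< b → b ℚ.* (c ℚ.* inv b) ≡ c
  cancel {b} c 0<b = trans
    (solve 3 (λ b c i → b :* (c :* i) := c :* (b :* i)) refl b c (inv b))
    (trans (cong (c ℚ.*_) (proj₁ (inv-pos 0<b))) (ℚ.*-identityʳ c))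

  bound : (x : ℝ) → ∃ λ B → 0ℚ ℚ.< B × ∃ λ N → ∀ n → N ℕ.≤ n → ℚ.∣ seq x n ∣ ℚ.≤ B
  bound x with cauchy x 1ℚ (ℚ.positive⁻¹ 1ℚ)
  ... | N , close = B , 0<B , N , λ n N≤n → begin
    ℚ.∣ seq x n ∣                              ≡⟨ cong ℚ.∣_∣ (solve 2 (λ a b → a := (a :- b) :+ b) refl (seq x n) (seq x N)) ⟩
    ℚ.∣ (seq x n ℚ.- seq x N) ℚ.+ seq x N ∣    ≤⟨ ℚ.∣p+q∣≤∣p∣+∣q∣ (seq x n ℚ.- seq x N) (seq x N) ⟩
    ℚ.∣ seq x n ℚ.- seq x N ∣ ℚ.+ ℚ.∣ seq x N ∣ ≤⟨ ℚ.+-monoˡ-≤ ℚ.∣ seq x N ∣ (close n N N≤n ℕ.≤-refl) ⟩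
    B                                          ∎
    where
    open ℚ.≤-Reasoning
    B = 1ℚ ℚ.+ ℚ.∣ seq x N ∣
    0<B : 0ℚ ℚ.< B
    0<B = ℚ.+-mono-<-≤ (ℚ.positive⁻¹ 1ℚ) (ℚ.0≤∣p∣ (seq x N))

_+_ : ℝ → ℝ → ℝ
x + y = mkℝ (λ n → seq x n ℚ.+ seq y n) λ e 0<e →
  let Nx , cx = cauchy x (e ℚ.* ½) (pos-* 0<e 0<½)
      Ny , cy = cauchy y (e ℚ.* ½) (pos-* 0<e 0<½)
  in Nx ⊔ Ny , λ m n N≤m N≤n → begin
    ℚ.∣ (seq x m ℚ.+ seq y m) ℚ.- (seq x n ℚ.+ seq y n) ∣
      ≡⟨ cong ℚ.∣_∣ (solve 4 (λ a b c d → (a :+ b) :- (c :+ d) := (a :- c) :+ (b :- d))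
           refl (seq x m) (seq y m) (seq x n) (seq y n)) ⟩
    ℚ.∣ (seq x m ℚ.- seq x n) ℚ.+ (seq y m ℚ.- seq y n) ∣
      ≤⟨ ℚ.∣p+q∣≤∣p∣+∣q∣ (seq x m ℚ.- seq x n) (seq y m ℚ.- seq y n) ⟩
    ℚ.∣ seq x m ℚ.- seq x n ∣ ℚ.+ ℚ.∣ seq y m ℚ.- seq y n ∣
      ≤⟨ ℚ.+-mono-≤ (cx m n (ℕ.m⊔n≤o⇒m≤o Nx Ny N≤m) (ℕ.m⊔n≤o⇒m≤o Nx Ny N≤n))
                    (cy m n (ℕ.m⊔n≤o⇒n≤o Nx Ny N≤m) (ℕ.m⊔n≤o⇒n≤o Nx Ny N≤n)) ⟩
    e ℚ.* ½ ℚ.+ e ℚ.* ½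
      ≡⟨ half+half e ⟩
    e ∎
  where open ℚ.≤-Reasoning

-_ : ℝ → ℝ
- x = mkℝ (λ n → ℚ.- seq x n) λ e 0<e →
  let N , cx = cauchy x e 0<e
  in N , λ m n N≤m N≤n → subst (ℚ._≤ e)
    (trans (sym (ℚ.∣-p∣≡∣p∣ (seq x m ℚ.- seq x n)))
      (cong ℚ.∣_∣ (solve 2 (λ a b → :- (a :- b) := (:- a) :- (:- b)) refl (seq x m) (seq x n))))
    (cx m n N≤m N≤n)

_-_ : ℝ → ℝ → ℝ
x - y = x + (- y)

_*_ : ℝ → ℝ → ℝ
x * y = mkℝ (λ n → seq x n ℚ.* seq y n) λ e 0<e →
  let Bx , 0<Bx , Mx , bx = bound x
      By , 0<By , My , by = bound y
      h = e ℚ.* ½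
      0<h = pos-* 0<e 0<½
      Nx , cx = cauchy x (h ℚ.* inv By) (pos-* 0<h (proj₂ (inv-pos 0<By)))
      Ny , cy = cauchy y (h ℚ.* inv Bx) (pos-* 0<h (proj₂ (inv-pos 0<Bx)))
      M = Mx ⊔ My
      N = Nx ⊔ Ny
  in M ⊔ N , λ m n K≤m K≤n →
    let M≤m = ℕ.m⊔n≤o⇒m≤o M N K≤m
        M≤n = ℕ.m⊔n≤o⇒m≤o M N K≤n
        N≤m = ℕ.m⊔n≤o⇒n≤o M N K≤m
        N≤n = ℕ.m⊔n≤o⇒n≤o M N K≤n
        dx = seq x m ℚ.- seq x n
        dy = seq y m ℚ.- seq y n
    in begin
    ℚ.∣ seq x m ℚ.* seq y m ℚ.- seq x n ℚ.* seq y n ∣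
      ≡⟨ cong ℚ.∣_∣ (solve 4 (λ a b c d → a :* b :- c :* d := a :* (b :- d) :+ d :* (a :- c))
           refl (seq x m) (seq y m) (seq x n) (seq y n)) ⟩
    ℚ.∣ seq x m ℚ.* dy ℚ.+ seq y n ℚ.* dx ∣
      ≤⟨ ℚ.∣p+q∣≤∣p∣+∣q∣ (seq x m ℚ.* dy) (seq y n ℚ.* dx) ⟩
    ℚ.∣ seq x m ℚ.* dy ∣ ℚ.+ ℚ.∣ seq y n ℚ.* dx ∣
      ≡⟨ cong₂ ℚ._+_ (ℚ.∣p*q∣≡∣p∣*∣q∣ (seq x m) dy) (ℚ.∣p*q∣≡∣p∣*∣q∣ (seq y n) dx) ⟩
    ℚ.∣ seq x m ∣ ℚ.* ℚ.∣ dy ∣ ℚ.+ ℚ.∣ seq y n ∣ ℚ.* ℚ.∣ dx ∣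
      ≤⟨ ℚ.+-mono-≤
           (*-mono-≤ (ℚ.<⇒≤ 0<Bx) (ℚ.0≤∣p∣ dy) (bx m (ℕ.m⊔n≤o⇒m≤o Mx My M≤m))
             (cy m n (ℕ.m⊔n≤o⇒n≤o Nx Ny N≤m) (ℕ.m⊔n≤o⇒n≤o Nx Ny N≤n)))
           (*-mono-≤ (ℚ.<⇒≤ 0<By) (ℚ.0≤∣p∣ dx) (by n (ℕ.m⊔n≤o⇒n≤o Mx My M≤n))
             (cx m n (ℕ.m⊔n≤o⇒m≤o Nx Ny N≤m) (ℕ.m⊔n≤o⇒m≤o Nx Ny N≤n))) ⟩
    Bx ℚ.* (h ℚ.* inv Bx) ℚ.+ By ℚ.* (h ℚ.* inv By)
      ≡⟨ cong₂ ℚ._+_ (cancel h 0<Bx) (cancel h 0<By) ⟩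
    h ℚ.+ h
      ≡⟨ half+half e ⟩
    e ∎
  where open ℚ.≤-Reasoning

-- The reciprocal is taken termwise; the positivity proof only serves to
-- show that the resulting sequence is Cauchy.
1/_[_] : (x : ℝ) → fromℕ 0 < x → ℝ
1/ x [ d , 0<d , M , x≥d ] = mkℝ (λ n → inv (seq x n)) λ e 0<e →
  let N , cx = cauchy x (e ℚ.* inv D) (pos-* 0<e (proj₂ (inv-pos 0<D)))
  in M ⊔ N , λ m n K≤m K≤n → begin
    ℚ.∣ inv (seq x m) ℚ.- inv (seq x n) ∣
      ≤⟨ inv-lipschitz 0<d (lower m (ℕ.m⊔n≤o⇒m≤o M N K≤m)) (lower n (ℕ.m⊔n≤o⇒m≤o M N K≤n)) ⟩
    D ℚ.* ℚ.∣ seq x m ℚ.- seq x n ∣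
      ≤⟨ ℚ.*-monoˡ-≤-nonNeg D {{ℚ.nonNegative (ℚ.<⇒≤ 0<D)}}
           (cx m n (ℕ.m⊔n≤o⇒n≤o M N K≤m) (ℕ.m⊔n≤o⇒n≤o M N K≤n)) ⟩
    D ℚ.* (e ℚ.* inv D)
      ≡⟨ cancel e 0<D ⟩
    e ∎
  where
  open ℚ.≤-Reasoning
  D = inv d ℚ.* inv d
  0<D : 0ℚ ℚ.< D
  0<D = pos-* (proj₂ (inv-pos 0<d)) (proj₂ (inv-pos 0<d))
  lower : ∀ n → M ℕ.≤ n → d ℚ.≤ seq x n
  lower n M≤n = subst (ℚ._≤ seq x n) (ℚ.+-identityˡ d) (x≥d n M≤n)

_² : ℝ → ℝ
x ² = x * x

1≤⇒0< : ∀ x → fromℕ 1 ≤ x → fromℕ 0 < x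
1≤⇒0< x 1≤x with 1≤x ½ 0<½
... | N , le = ½ , 0<½ , N , λ n N≤n →
  subst (½ ℚ.≤_) (solve 1 (λ a → (a :+ con ½) :+ con (ℚ.- ½) := a) refl (seq x n))
    (ℚ.+-monoˡ-≤ (ℚ.- ½) (le n N≤n))

∑[_] : ∀ {n} {P : Pred (Fin n) 0ℓ} → Unary.Decidable P → (Fin n → ℝ) → ℝ
∑[ P? ] t = foldr _+_ (fromℕ 0) λ v → if does (P? v) then t v else fromℕ 0

-- mult u v is the number of edges joining u and v.
record Graph (n : ℕ) : Set where
  field
    mult     : Fin n → Fin n → ℕ
    mult-sym : ∀ u v → mult u v ≡ mult v u
    loopless : ∀ v → mult v v ≡ 0

open Graph public

private
  module ℕ-Sum = Sum ℕ.+-0-commutativeMonoid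

deg : ∀ {n} → Graph n → Fin n → ℕ
deg G v = ℕ-Sum.sum (mult G v)

-- A spanning subgraph keeps all vertices and some of the edges; up to
-- the choice among parallel edges it is given by its multiplicities.
_⊑_ : ∀ {n} → Graph n → Graph n → Set
F ⊑ G = ∀ u v → mult F u v ℕ.≤ mult G u v

module _ {n} (G : Graph n) (S : Subset n) where

  -- Adjacency in G ∖ S.
  Adj : Rel (Fin n) 0ℓ
  Adj u v = u ∉ S × v ∉ S × 0 ℕ.< mult G u v

  Isolated : Pred (Fin n) 0ℓ
  Isolated v = v ∉ S × (∀ u → u ∉ S → mult G v u ≡ 0)

  Connected : Rel (Fin n) 0ℓ
  Connected = Star Adj

  outside? : Unary.Decidable (_∉ S)
  outside? v = ¬? (v ∈? S)

  isolated? : Unary.Decidable Isolated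
  isolated? v = outside? v ×-dec Fin.all? λ u → outside? u →-dec (mult G v u ℕ.≟ 0)

  adj? : Decidable Adj
  adj? u v = outside? u ×-dec outside? v ×-dec (0 ℕ.<? mult G u v)

  -- Connectedness is decided by Warshall's algorithm: Path xs u v is a
  -- nonempty walk whose interior vertices all lie in xs.
  private
    Path : List (Fin n) → Rel (Fin n) 0ℓ
    Path []       u v = Adj u v
    Path (x ∷ xs) u v = Path xs u v ⊎ (Path xs u x × Path xs x v)

    path? : ∀ xs → Decidable (Path xs)
    path? []       u v = adj? u v
    path? (x ∷ xs) u v = path? xs u v ⊎-dec (path? xs u x ×-dec path? xs x v)

    path⇒connected : ∀ xs {u v} → Path xs u v → Connected u v
    path⇒connected []       p              = p ◅ ε
    path⇒connected (x ∷ xs) (inj₁ p)       = path⇒connected xs p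
    path⇒connected (x ∷ xs) (inj₂ (p , q)) = path⇒connected xs p ◅◅ path⇒connected xs q

    adj⇒path : ∀ xs {u v} → Adj u v → Path xs u v
    adj⇒path []       a = a
    adj⇒path (x ∷ xs) a = inj₁ (adj⇒path xs a)

    into : ∀ {x} xs {u} → Path (x ∷ xs) u x → Path xs u x
    into xs (inj₁ p)       = p
    into xs (inj₂ (p , _)) = p

    outof : ∀ {x} xs {v} → Path (x ∷ xs) x v → Path xs x v
    outof xs (inj₁ p)       = p
    outof xs (inj₂ (_ , p)) = p

    join : ∀ xs {u y v} → y List∈.∈ xs → Path xs u y → Path xs y v → Path xs u v
    join (x ∷ xs) (here refl) p              q              = inj₂ (into xs p , outof xs q)
    join (x ∷ xs) (there y∈)  (inj₁ p)       (inj₁ q)       = inj₁ (join xs y∈ p q)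
    join (x ∷ xs) (there y∈)  (inj₁ p)       (inj₂ (q , r)) = inj₂ (join xs y∈ p q , r)
    join (x ∷ xs) (there y∈)  (inj₂ (p , q)) (inj₁ r)       = inj₂ (p , join xs y∈ q r)
    join (x ∷ xs) (there y∈)  (inj₂ (p , _)) (inj₂ (_ , r)) = inj₂ (p , r)

    connected⇒path : ∀ {u v} → Connected u v → u ≡ v ⊎ Path (allFin n) u v
    connected⇒path ε        = inj₁ refl
    connected⇒path (a ◅ as) with connected⇒path as
    ... | inj₁ refl = inj₂ (adj⇒path (allFin n) a)
    ... | inj₂ p    = inj₂ (join (allFin n) (∈-allFin _) (adj⇒path (allFin n) a) p)

  connected? : Decidable Connected
  connected? u v = map′
    (λ { (inj₁ refl) → ε ; (inj₂ p) → path⇒connected (allFin n) p })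
    connected⇒path
    ((u Fin.≟ v) ⊎-dec path? (allFin n) u v)

  -- The number of components of G ∖ S: the length of a list with exactly
  -- one representative of each connectedness class of vertices outside S.
  ω : ℕ
  ω = length (deduplicate connected? (filter outside? (allFin n)))

IsoTough : ∀ {n} → (Fin n → ℝ) → Graph n → Set
IsoTough t G = ∀ S → ∑[ isolated? G S ] t ≤ fromℕ ∣ S ∣

IsNearFactor : ∀ {n} → (Fin n → ℕ) → Graph n → Graph n → Set
IsNearFactor f G F = F ⊑ G ×
  ((∀ v → deg F v ≡ f v) ⊎
   ∃ λ u → deg F u ≡ suc (f u) × (∀ v → v ≢ u → deg F v ≡ f v))

HasNearFactor : ∀ {n} → (Fin n → ℕ) → Graph n → Set
HasNearFactor f G = ∃ (IsNearFactor f G)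

{-# OPTIONS --safe #-}

-- Call a vector reachable if it is the degree vector of a subgraph of G.
-- Alternating walks give reachable vectors a two-step exchange property
-- (they form a jump system).  For an unreachable p, let D, S and T be the
-- sets of vertices v such that p + 1_v and p - 1_v are both reachable,
-- only p + 1_v is, and only p - 1_v is.  Exchanges show that no edge joins
-- D to the remaining vertices outside S ∪ T, and that a subgraph whose
-- degree vector is next to p deviates at most once, on each component of D,
-- from using all edges to T, no edge to S and having the degrees p; this is
-- the analogue of the Gallai-Edmonds theorem.  Counting edges gives the barrier
-- inequality of Tutte's f-factor theorem for p.  Moving a degree vector
-- towards f as long as possible ends in a near f-factor or in sets S, T with
--   f(S) + Σ_T d_{G∖S} + 2 ≤ f(T) + ω(G ∖ (S ∪ T)).
--
-- In the second case let X be the set of v ∈ T with d_{G∖S}(v) ≥ 2 f(v), and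
-- let Y = T ∖ X.  The hypothesis on ω for S ∪ X yields a |S| < Σ_Y (f - k),
-- where k is the degree in G[Y].  A greedy choice gives an independent
-- I ⊆ Y with 4 Σ_Y (f - k) ≤ Σ_I (f + 1)², while iso-toughness for
-- S ∪ N(I) gives Σ_I (f + a/2)² ≤ a (|S| + Σ_I (2 f - 1)); these bounds are
-- incompatible for 1 ≤ a ≤ f.

module Submission where

-- Parity is never computed. Every `p` that occurs lies one unit away from a degree vector, so its
-- coordinate sum is odd and no subgraph attains it; accordingly the descent moves two units at a
-- time. The barrier obtained at `p` has surplus 1, while the deficiency wanted for f has surplus 2.
-- The missing unit is recovered combinatorially: wherever `p` and f differ, there is a strict gap
-- on S or T or one more component. Hence, in the absence of a deficient pair, the descent can stall
-- only at p = f, and then some f + 1_w is reachable. The threshold 2 f that defines X balances two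
-- needs: a vertex with d ≥ 2 f pays for its own transfer to the deleted set, and any other vertex
-- of T can be isolated by at most 2 f - 1 further deletions. The square (f + 1)² is four times the
-- maximum of (1 + k) (f - k) over real k. The real number a is replaced by one late rational term
-- of its sequence. This costs a fixed tolerance, which a single element of I absorbs; the case of
-- empty I is therefore treated apart.

module Combinatorics where

  open import Defs using
    ( Graph; mult; mult-sym; loopless; deg; Adj; Connected; Isolated
    ; connected?; outside?; ω; HasNearFactor)
  open import Data.Bool.Base using (true; false; if_then_else_)
  open import Data.Empty using (⊥; ⊥-elim)
  open import Data.Fin.Base using (Fin; zero; suc; toℕ; fromℕ<)
  import Data.Fin.Properties as Fin
  open import Data.Fin.Subset as Subset using (Subset; _∪_)
  open import Data.Fin.Subset.Properties using (x∈p∪q⁺; x∈p∪q⁻; _∈?_)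
  open import Data.Integer.Base as ℤ using (ℤ; +_; 0ℤ; 1ℤ; _+_; _-_; _*_; -_; _≤_; _<_; ∣_∣)
  import Data.Integer.Properties as ℤ
  open import Data.Integer.Solver using (module +-*-Solver)
  open import Data.List.Base as List using (List; []; _∷_; length; filter; allFin)
  open import Data.List.Membership.Propositional using (_∈_; _∉_; lose)
  open import Data.List.Membership.Propositional.Properties using (∈-allFin; ∈-filter⁺)
  open import Data.List.Properties using (length-removeAt′)
  open import Data.List.Relation.Binary.Permutation.Propositional as Perm
    using (_↭_; prep; swap; ↭-trans; ↭-refl; ↭-sym)
  open import Data.List.Relation.Unary.All as All using (All; []; _∷_)
  open import Data.List.Relation.Unary.All.Properties using (all-filter; filter⁺)
  open import Data.List.Relation.Unary.AllPairs as AllPairs using (AllPairs; []; _∷_)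
  import Data.List.Relation.Unary.AllPairs.Properties as AllPairs
  open import Data.List.Relation.Unary.Any as Any using (Any; any?; here; there; _─_)
  import Data.List.Relation.Unary.Any.Properties as Any
  import Data.List.Relation.Unary.Unique.Propositional.Properties as Unique
  open import Data.Nat.Base as ℕ using (ℕ; zero; suc)
  import Data.Nat.Properties as ℕ
  open import Data.Product.Base using (∃; ∃₂; _×_; _,_; proj₁; proj₂)
  import Data.Product.Properties as Product
  open import Data.Sign.Base as Sign using (Sign; opposite)
  import Data.Sign.Properties as Sign
  open import Data.Sum.Base using (_⊎_; inj₁; inj₂; [_,_]′)
  import Data.Vec.Base as Vec
  open import Data.Vec.Properties using (lookup∘tabulate; []=⇒lookup; lookup⇒[]=)
  open import Function.Base using (_∘_; id)
  open import Level using (0ℓ)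
  open import Relation.Binary.Construct.Closure.ReflexiveTransitive using (ε; _◅_; _◅◅_; reverse)
  open import Relation.Binary.Definitions using (tri<; tri≈; tri>)
  open import Relation.Binary.PropositionalEquality
    using (_≡_; _≢_; refl; sym; trans; cong; cong₂; subst; subst₂; module ≡-Reasoning)
  open import Relation.Nullary using (¬_; Dec; yes; no; does; ¬?; _×-dec_; _⊎-dec_)
  open import Relation.Nullary.Decidable using (dec-true; decidable-stable; map′)
  open import Relation.Unary using (Pred; Decidable)
  import Algebra.Properties.CommutativeMonoid.Sum as MonoidSum
  import Algebra.Properties.Semiring.Sum as SemiringSum

  open +-*-Solver using (solve; _:=_; _:+_; _:*_; _:-_; :-_; con)

  -- Finite sums of integers

  module ℕ-Sum = MonoidSum ℕ.+-0-commutativeMonoid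
  module ℤ-Sum = MonoidSum ℤ.+-0-commutativeMonoid

  0≤+ : ∀ {x y} → 0ℤ ≤ x → 0ℤ ≤ y → 0ℤ ≤ x + y
  0≤+ = ℤ.+-mono-≤

  0≤* : ∀ {x y} → 0ℤ ≤ x → 0ℤ ≤ y → 0ℤ ≤ x * y
  0≤* {x} {y} 0≤x 0≤y = ℤ.*-monoʳ-≤-nonNeg y {{ℤ.nonNegative 0≤y}} 0≤x

  gap : ∀ {a b} → a ≤ b → 0ℤ ≤ b - a
  gap = ℤ.i≤j⇒0≤j-i

  fromGap : ∀ {a b c} → 0ℤ ≤ c → c ≡ b - a → a ≤ b
  fromGap 0≤c refl = ℤ.0≤i-j⇒j≤i 0≤c

  <⇒1+≤ : ∀ {a b} → a < b → 1ℤ + a ≤ b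
  <⇒1+≤ = ℤ.i<j⇒suc[i]≤j

  1+≤⇒< : ∀ {a b} → 1ℤ + a ≤ b → a < b
  1+≤⇒< = ℤ.suc[i]≤j⇒i<j

  ≰⇒1+≤ : ∀ {a b} → ¬ a ≤ b → 1ℤ + b ≤ a
  ≰⇒1+≤ ¬a≤b = <⇒1+≤ (ℤ.≰⇒> ¬a≤b)

  ≤∧≢⇒1≤gap : ∀ {a b} → a ≤ b → a ≢ b → 1ℤ ≤ b - a
  ≤∧≢⇒1≤gap {a} {b} a≤b a≢b = fromGap (gap (<⇒1+≤ (ℤ.≤∧≢⇒< a≤b a≢b)))
    (solve 2 (λ a b → b :- (con 1ℤ :+ a) := (b :- a) :- con 1ℤ) refl a b)

  <suc⇒≤ : ∀ {i k} → i < + suc k → i ≤ + k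
  <suc⇒≤ {i} {k} i<k = fromGap (gap (<⇒1+≤ i<k))
    (trans (cong (_- (1ℤ + i)) (ℤ.pos-+ 1 k)) (solve 2 (λ i k → (con 1ℤ :+ k) :- (con 1ℤ :+ i) := k :- i) refl i (+ k)))

  1≰0 : ¬ 1ℤ ≤ 0ℤ
  1≰0 (ℤ.+≤+ ())

  opaque

    ∑ : ∀ {n} → (Fin n → ℤ) → ℤ
    ∑ = ℤ-Sum.sum

    ∑-zero : (f : Fin 0 → ℤ) → ∑ f ≡ 0ℤ
    ∑-zero f = refl

    ∑-suc : ∀ {n} (f : Fin (suc n) → ℤ) → ∑ f ≡ f zero + ∑ (f ∘ suc)
    ∑-suc f = refl

    ∑-cong : ∀ {n} {f g : Fin n → ℤ} → (∀ i → f i ≡ g i) → ∑ f ≡ ∑ g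
    ∑-cong = ℤ-Sum.sum-cong-≗

    ∑-+ : ∀ {n} (f g : Fin n → ℤ) → ∑ (λ i → f i + g i) ≡ ∑ f + ∑ g
    ∑-+ = ℤ-Sum.∑-distrib-+

    ∑-* : ∀ {n} c (f : Fin n → ℤ) → ∑ (λ i → c * f i) ≡ c * ∑ f
    ∑-* c f = sym (SemiringSum.*-distribˡ-sum ℤ.+-*-semiring c f)

    ∑-0 : ∀ n → ∑ {n} (λ _ → 0ℤ) ≡ 0ℤ
    ∑-0 = ℤ-Sum.sum-replicate-zero

    ∑-mono : ∀ {n} {f g : Fin n → ℤ} → (∀ i → f i ≤ g i) → ∑ f ≤ ∑ g
    ∑-mono {zero}  f≤g = ℤ.≤-refl
    ∑-mono {suc n} f≤g = ℤ.+-mono-≤ (f≤g zero) (∑-mono (f≤g ∘ suc))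

    ∑-mono-< : ∀ {n} {f g : Fin n → ℤ} → (∀ i → f i ≤ g i) → ∀ j → f j < g j → ∑ f < ∑ g
    ∑-mono-< f≤g zero    fj<gj = ℤ.+-mono-<-≤ fj<gj (∑-mono (f≤g ∘ suc))
    ∑-mono-< f≤g (suc j) fj<gj = ℤ.+-mono-≤-< (f≤g zero) (∑-mono-< (f≤g ∘ suc) j fj<gj)

    ∑-swap : ∀ {m n} (f : Fin m → Fin n → ℤ) → ∑ (λ i → ∑ (f i)) ≡ ∑ (λ j → ∑ λ i → f i j)
    ∑-swap = ℤ-Sum.∑-comm

    ∑-pos : ∀ {n} (f : Fin n → ℕ) → + ℕ-Sum.sum f ≡ ∑ (λ i → + f i)
    ∑-pos {zero}  f = refl
    ∑-pos {suc n} f = trans (ℤ.pos-+ (f zero) _) (cong (_+_ (+ f zero)) (∑-pos (f ∘ suc)))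

  ∑-neg : ∀ {n} (f : Fin n → ℤ) → ∑ (λ i → - f i) ≡ - ∑ f
  ∑-neg f = trans (∑-cong λ i → sym (ℤ.-1*i≡-i (f i))) (trans (∑-* (- 1ℤ) f) (ℤ.-1*i≡-i (∑ f)))

  ∑-- : ∀ {n} (f g : Fin n → ℤ) → ∑ (λ i → f i - g i) ≡ ∑ f - ∑ g
  ∑-- f g = trans (∑-+ f (-_ ∘ g)) (cong (_+_ (∑ f)) (∑-neg g))

  ∑-nonneg : ∀ {n} {f : Fin n → ℤ} → (∀ i → 0ℤ ≤ f i) → 0ℤ ≤ ∑ f
  ∑-nonneg {n} 0≤f = ℤ.≤-trans (ℤ.≤-reflexive (sym (∑-0 n))) (∑-mono 0≤f)

  ∑-witness : ∀ {n} (f g : Fin n → ℤ) → ∑ f < ∑ g → ∃ λ i → f i < g i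
  ∑-witness f g f<g with Fin.any? (λ i → f i ℤ.<? g i)
  ... | yes p = p
  ... | no ¬p = ⊥-elim (ℤ.<⇒≱ f<g (∑-mono λ i → ℤ.≮⇒≥ λ lt → ¬p (i , lt)))

  𝟙 : ∀ {a} {A : Set a} → Dec A → ℤ
  𝟙 d = if does d then 1ℤ else 0ℤ

  module _ {a} {A : Set a} where

    𝟙-yes : (d : Dec A) → A → 𝟙 d ≡ 1ℤ
    𝟙-yes (yes _) _ = refl
    𝟙-yes (no ¬x) x = ⊥-elim (¬x x)

    𝟙-no : (d : Dec A) → ¬ A → 𝟙 d ≡ 0ℤ
    𝟙-no (yes x) ¬x = ⊥-elim (¬x x)
    𝟙-no (no _)  _  = refl

    0≤𝟙 : (d : Dec A) → 0ℤ ≤ 𝟙 d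
    0≤𝟙 (yes _) = ℤ.+≤+ ℕ.z≤n
    0≤𝟙 (no _)  = ℤ.≤-refl

    0≤1-𝟙 : (d : Dec A) → 0ℤ ≤ 1ℤ - 𝟙 d
    0≤1-𝟙 (yes _) = ℤ.≤-refl
    0≤1-𝟙 (no _)  = ℤ.+≤+ ℕ.z≤n

    𝟙*-nonneg : (d : Dec A) {x : ℤ} → (A → 0ℤ ≤ x) → 0ℤ ≤ 𝟙 d * x
    𝟙*-nonneg (yes a) {x} h = subst (0ℤ ≤_) (sym (ℤ.*-identityˡ x)) (h a)
    𝟙*-nonneg (no _)      h = ℤ.≤-refl

    𝟙*-mono : (d : Dec A) {x y : ℤ} → (A → x ≤ y) → 𝟙 d * x ≤ 𝟙 d * y
    𝟙*-mono (yes a) {x} {y} h = begin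
      1ℤ * x  ≡⟨ ℤ.*-identityˡ x ⟩
      x       ≤⟨ h a ⟩
      y       ≡⟨ ℤ.*-identityˡ y ⟨
      1ℤ * y  ∎
      where open ℤ.≤-Reasoning
    𝟙*-mono (no _)      h = ℤ.≤-refl

  δ : ∀ {n} → Fin n → Fin n → ℤ
  δ x w = 𝟙 (x Fin.≟ w)

  δ-refl : ∀ {n} (x : Fin n) → δ x x ≡ 1ℤ
  δ-refl x = 𝟙-yes (x Fin.≟ x) refl

  δ-≢ : ∀ {n} {x w : Fin n} → x ≢ w → δ x w ≡ 0ℤ
  δ-≢ {x = x} {w} = 𝟙-no (x Fin.≟ w)

  δ-suc : ∀ {n} (x w : Fin n) → δ (suc x) (suc w) ≡ δ x w
  δ-suc x w with x Fin.≟ w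
  ... | yes _ = refl
  ... | no _  = refl

  opaque
    unfolding ∑

    ∑-δ : ∀ {n} (x : Fin n) (f : Fin n → ℤ) → ∑ (λ w → δ x w * f w) ≡ f x
    ∑-δ {suc n} zero    f = trans (cong₂ _+_ (ℤ.*-identityˡ (f zero)) (∑-0 n)) (ℤ.+-identityʳ _)
    ∑-δ {suc n} (suc x) f = trans (ℤ.+-identityˡ _)
      (trans (∑-cong λ w → cong (_* f (suc w)) (δ-suc x w)) (∑-δ x (f ∘ suc)))

  ∑-δ₁ : ∀ {n} (x : Fin n) → ∑ (δ x) ≡ 1ℤ
  ∑-δ₁ x = trans (∑-cong λ w → sym (ℤ.*-identityʳ (δ x w))) (∑-δ x (λ _ → 1ℤ))

  term≤∑ : ∀ {n} {f : Fin n → ℤ} → (∀ i → 0ℤ ≤ f i) → ∀ j → f j ≤ ∑ f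
  term≤∑ {f = f} 0≤f j = ℤ.≤-trans (ℤ.≤-reflexive (sym (∑-δ j f)))
    (∑-mono λ i → bound i)
    where
    bound : ∀ i → δ j i * f i ≤ f i
    bound i with j Fin.≟ i
    ... | yes _ = ℤ.≤-reflexive (ℤ.*-identityˡ (f i))
    ... | no _  = 0≤f i

  -- Degree vectors and alternating walks

  -- A unit stands for the vector plus or minus 1_v, a single step of the jump system; lists of
  -- units, read through `val`, are displacements.
  Unit : ℕ → Set
  Unit n = Fin n × Sign

  sgn : Sign → ℤ
  sgn Sign.+ = 1ℤ
  sgn Sign.- = - 1ℤ

  sgn-opposite : ∀ s → sgn (opposite s) ≡ - sgn s
  sgn-opposite Sign.+ = refl
  sgn-opposite Sign.- = refl

  sgn² : ∀ s → sgn s * sgn s ≡ 1ℤ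
  sgn² Sign.+ = refl
  sgn² Sign.- = refl

  module _ {n : ℕ} where

    neg : Unit n → Unit n
    neg (x , s) = x , opposite s

    ⟦_⟧ : Unit n → Fin n → ℤ
    ⟦ x , s ⟧ w = sgn s * δ x w

    ⟦neg⟧ : ∀ u w → ⟦ neg u ⟧ w ≡ - ⟦ u ⟧ w
    ⟦neg⟧ (x , s) w = trans (cong (_* δ x w) (sgn-opposite s)) (sym (ℤ.neg-distribˡ-* (sgn s) (δ x w)))

    val : List (Unit n) → Fin n → ℤ
    val []      w = 0ℤ
    val (u ∷ L) w = ⟦ u ⟧ w + val L w

    _≟ᵤ_ : (u v : Unit n) → Dec (u ≡ v)
    _≟ᵤ_ = Product.≡-dec Fin._≟_ Sign._≟_

    -- Units at other vertices do not count at `x`, so only the excluded unit could contribute with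
    -- the wrong sign.
    val-sign : ∀ {x s} L → neg (x , s) ∉ L → 0ℤ ≤ sgn s * val L x
    val-sign {x} {s} [] _ = ℤ.≤-reflexive (sym (ℤ.*-zeroʳ (sgn s)))
    val-sign {x} {s} ((y , t) ∷ L) ∉L = subst (0ℤ ≤_)
      (sym (ℤ.*-distribˡ-+ (sgn s) (sgn t * δ y x) (val L x)))
      (0≤+ head (val-sign {x} {s} L (∉L ∘ there)))
      where
      same : ∀ s t → (x , opposite s) ≢ (x , t) → 0ℤ ≤ sgn s * (sgn t * 1ℤ)
      same Sign.+ Sign.+ _ = ℤ.+≤+ ℕ.z≤n
      same Sign.+ Sign.- ≢ = ⊥-elim (≢ refl)
      same Sign.- Sign.+ ≢ = ⊥-elim (≢ refl)
      same Sign.- Sign.- _ = ℤ.+≤+ ℕ.z≤n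
      head : 0ℤ ≤ sgn s * (sgn t * δ y x)
      head with y Fin.≟ x
      ... | yes refl = same s t (∉L ∘ here)
      ... | no _     = ℤ.≤-reflexive (solve 2 (λ s t → con 0ℤ := s :* (t :* con 0ℤ)) refl (sgn s) (sgn t))

  Mat : ℕ → Set
  Mat n = Fin n → Fin n → ℤ

  degree : ∀ {n} → Mat n → Fin n → ℤ
  degree F v = ∑ (F v)

  edge : ∀ {n} → Fin n → Fin n → Mat n
  edge x y u v = δ x u * δ y v + δ y u * δ x v

  toggle : ∀ {n} → Sign → Fin n → Fin n → Mat n → Mat n
  toggle s x y F u v = F u v + sgn s * edge x y u v

  degree-toggle : ∀ {n} s (x y : Fin n) F w → degree (toggle s x y F) w ≡ degree F w + (⟦ x , s ⟧ w + ⟦ y , s ⟧ w)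
  degree-toggle s x y F w = begin
    ∑ (λ v → F w v + sgn s * (δ x w * δ y v + δ y w * δ x v))
      ≡⟨ ∑-+ (F w) _ ⟩
    degree F w + ∑ (λ v → sgn s * (δ x w * δ y v + δ y w * δ x v))
      ≡⟨ cong (_+_ (degree F w)) (trans (∑-* (sgn s) _) (cong (sgn s *_)
           (trans (∑-+ (λ v → δ x w * δ y v) _)
             (cong₂ _+_ (trans (∑-* (δ x w) (δ y)) (cong (δ x w *_) (∑-δ₁ y)))
                        (trans (∑-* (δ y w) (δ x)) (cong (δ y w *_) (∑-δ₁ x))))))) ⟩
    degree F w + sgn s * (δ x w * 1ℤ + δ y w * 1ℤ)
      ≡⟨ solve 4 (λ d s a b → d :+ s :* (a :* con 1ℤ :+ b :* con 1ℤ) := d :+ (s :* a :+ s :* b))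
           refl (degree F w) (sgn s) (δ x w) (δ y w) ⟩
    degree F w + (⟦ x , s ⟧ w + ⟦ y , s ⟧ w) ∎
    where open ≡-Reasoning

  edge-cases : ∀ {n} {x y : Fin n} → x ≢ y → ∀ u v →
    (x ≡ u × y ≡ v × edge x y u v ≡ 1ℤ) ⊎ (y ≡ u × x ≡ v × edge x y u v ≡ 1ℤ) ⊎ edge x y u v ≡ 0ℤ
  edge-cases {x = x} {y} x≢y u v with x Fin.≟ u | y Fin.≟ v | y Fin.≟ u | x Fin.≟ v
  ... | yes refl | yes refl | yes refl | _        = ⊥-elim (x≢y refl)
  ... | yes refl | yes refl | no _     | _        = inj₁ (refl , refl , refl)
  ... | yes refl | no _     | yes refl | _        = ⊥-elim (x≢y refl)
  ... | yes refl | no _     | no _     | _        = inj₂ (inj₂ refl)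
  ... | no _     | _        | yes refl | yes refl = inj₂ (inj₁ (refl , refl , refl))
  ... | no _     | _        | yes refl | no _     = inj₂ (inj₂ refl)
  ... | no _     | _        | no _     | _        = inj₂ (inj₂ refl)

  -- The order of the endpoints is left open because an alternating walk raises some entries and
  -- lowers others.
  Between : ℤ → ℤ → ℤ → Set
  Between a b c = (a ≤ c × c ≤ b) ⊎ (b ≤ c × c ≤ a)

  between-refl : ∀ a b → Between a b a
  between-refl a b with ℤ.≤-total a b
  ... | inj₁ a≤b = inj₁ (ℤ.≤-refl , a≤b)
  ... | inj₂ b≤a = inj₂ (b≤a , ℤ.≤-refl)

  between-trans : ∀ {a b c d} → Between a b c → Between c b d → Between a b d
  between-trans (inj₁ (a≤c , c≤b)) (inj₁ (c≤d , d≤b)) = inj₁ (ℤ.≤-trans a≤c c≤d , d≤b)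
  between-trans (inj₁ (a≤c , c≤b)) (inj₂ (b≤d , d≤c)) =
    inj₁ (ℤ.≤-trans a≤c (ℤ.≤-trans c≤b b≤d) , ℤ.≤-trans d≤c c≤b)
  between-trans (inj₂ (b≤c , c≤a)) (inj₁ (c≤d , d≤b)) =
    inj₂ (ℤ.≤-trans b≤c c≤d , ℤ.≤-trans d≤b (ℤ.≤-trans b≤c c≤a))
  between-trans (inj₂ (b≤c , c≤a)) (inj₂ (b≤d , d≤c)) = inj₂ (b≤d , ℤ.≤-trans d≤c c≤a)

  between-dist : ∀ {a b c} → Between a b c → + ∣ b - c ∣ ≤ + ∣ b - a ∣
  between-dist {a} {b} {c} (inj₁ (a≤c , c≤b)) = begin
    + ∣ b - c ∣  ≡⟨ ℤ.0≤i⇒+∣i∣≡i (gap c≤b) ⟩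
    b - c        ≤⟨ ℤ.+-monoʳ-≤ b (ℤ.neg-mono-≤ a≤c) ⟩
    b - a        ≡⟨ ℤ.0≤i⇒+∣i∣≡i (gap (ℤ.≤-trans a≤c c≤b)) ⟨
    + ∣ b - a ∣  ∎
    where open ℤ.≤-Reasoning
  between-dist {a} {b} {c} (inj₂ (b≤c , c≤a)) = begin
    + ∣ b - c ∣  ≡⟨ cong +_ (ℤ.∣i-j∣≡∣j-i∣ b c) ⟩
    + ∣ c - b ∣  ≡⟨ ℤ.0≤i⇒+∣i∣≡i (gap b≤c) ⟩
    c - b        ≤⟨ ℤ.+-monoˡ-≤ (- b) c≤a ⟩
    a - b        ≡⟨ ℤ.0≤i⇒+∣i∣≡i (gap (ℤ.≤-trans b≤c c≤a)) ⟨
    + ∣ a - b ∣  ≡⟨ cong +_ (ℤ.∣i-j∣≡∣j-i∣ a b) ⟩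
    + ∣ b - a ∣  ∎
    where open ℤ.≤-Reasoning

  sgn-step : ∀ s a b → 0ℤ < sgn s * (b - a) →
    Between a b (a + sgn s * 1ℤ) × + ∣ b - (a + sgn s * 1ℤ) ∣ < + ∣ b - a ∣
  sgn-step Sign.+ a b 0<d = inj₁ (a≤a′ , a′≤b) , subst₂ _<_
      (sym (ℤ.0≤i⇒+∣i∣≡i (gap a′≤b))) (sym (ℤ.0≤i⇒+∣i∣≡i (gap (ℤ.≤-trans a≤a′ a′≤b))))
      (1+≤⇒< (ℤ.≤-reflexive (solve 2 (λ a b → con 1ℤ :+ (b :- (a :+ con 1ℤ)) := b :- a) refl a b)))
    where
    a≤a′ : a ≤ a + 1ℤ
    a≤a′ = fromGap (ℤ.+≤+ (ℕ.z≤n {1})) (solve 1 (λ a → con 1ℤ := (a :+ con 1ℤ) :- a) refl a)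
    a′≤b : a + 1ℤ ≤ b
    a′≤b = fromGap (gap (<⇒1+≤ 0<d))
      (solve 2 (λ a b → (con 1ℤ :* (b :- a)) :- con 1ℤ := b :- (a :+ con 1ℤ)) refl a b)
  sgn-step Sign.- a b 0<d = inj₂ (b≤a′ , a′≤a) , subst₂ _<_
      (sym (trans (cong +_ (ℤ.∣i-j∣≡∣j-i∣ b (a - 1ℤ))) (ℤ.0≤i⇒+∣i∣≡i (gap b≤a′))))
      (sym (trans (cong +_ (ℤ.∣i-j∣≡∣j-i∣ b a)) (ℤ.0≤i⇒+∣i∣≡i (gap (ℤ.≤-trans b≤a′ a′≤a)))))
      (1+≤⇒< (ℤ.≤-reflexive (solve 2 (λ a b → con 1ℤ :+ ((a :- con 1ℤ) :- b) := a :- b) refl a b)))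
    where
    a′≤a : a - 1ℤ ≤ a
    a′≤a = fromGap (ℤ.+≤+ (ℕ.z≤n {1})) (solve 1 (λ a → con 1ℤ := a :- (a :- con 1ℤ)) refl a)
    b≤a′ : b ≤ a - 1ℤ
    b≤a′ = fromGap (gap (<⇒1+≤ 0<d))
      (solve 2 (λ a b → ((:- con 1ℤ) :* (b :- a)) :- con 1ℤ := (a :- con 1ℤ) :- b) refl a b)

  slack : Sign → ℤ → ℤ → ℤ
  slack Sign.+ m f = m - f
  slack Sign.- m f = f

  -- Subgraphs as integer matrices, and their exchange property

  module Subgraphs {n : ℕ} (G : Graph n) where

    record Sub (F : Mat n) : Set where
      field
        symm  : ∀ u v → F u v ≡ F v u
        lower : ∀ u v → 0ℤ ≤ F u v
        upper : ∀ u v → F u v ≤ + mult G u v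

    open Sub public

    -- How often the edge xy can still be added to (s = +) or removed from
    -- (s = -) the subgraph.
    room : Sign → Mat n → Mat n
    room s F x y = slack s (+ mult G x y) (F x y)

    0≤room : ∀ s {F} → Sub F → ∀ x y → 0ℤ ≤ room s F x y
    0≤room Sign.+ subF x y = gap (upper subF x y)
    0≤room Sign.- subF x y = lower subF x y

    mult-loop : ∀ {x y} → 1ℤ ≤ + mult G x y → x ≢ y
    mult-loop {x} 1≤m refl = 1≰0 (subst (λ m → 1ℤ ≤ + m) (loopless G x) 1≤m)

    room≤mult : ∀ s {F} → Sub F → ∀ x y → room s F x y ≤ + mult G x y
    room≤mult Sign.+ {F} subF x y = fromGap (lower subF x y)
      (solve 2 (λ f m → f := m :- (m :- f)) refl (F x y) (+ mult G x y))
    room≤mult Sign.- subF x y = upper subF x y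

    room⇒≢ : ∀ s {F} → Sub F → ∀ {x y} → 1ℤ ≤ room s F x y → x ≢ y
    room⇒≢ s subF 1≤r = mult-loop (ℤ.≤-trans 1≤r (room≤mult s subF _ _))

    toggle-Sub : ∀ s {F} → Sub F → ∀ x y → 1ℤ ≤ room s F x y → Sub (toggle s x y F)
    toggle-Sub s {F} subF x y 1≤r = record
      { symm = λ u v → cong₂ _+_ (symm subF u v) (cong (sgn s *_)
          (solve 4 (λ a b c d → a :* b :+ c :* d := d :* c :+ b :* a) refl (δ x u) (δ y v) (δ y u) (δ x v)))
      ; lower = λ u v → proj₁ (bounds u v)
      ; upper = λ u v → proj₂ (bounds u v)
      }
      where
      at : ∀ s {f m} → 1ℤ ≤ slack s m f → 0ℤ ≤ f → f ≤ m → 0ℤ ≤ f + sgn s * 1ℤ × f + sgn s * 1ℤ ≤ m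
      at Sign.+ {f} {m} 1≤ 0≤f f≤m = 0≤+ 0≤f (ℤ.+≤+ ℕ.z≤n) ,
        fromGap (gap 1≤) (solve 2 (λ m f → (m :- f) :- con 1ℤ := m :- (f :+ con 1ℤ)) refl m f)
      at Sign.- {f} {m} 1≤ 0≤f f≤m = gap 1≤ ,
        ℤ.≤-trans (fromGap (ℤ.+≤+ (ℕ.z≤n {1})) (solve 1 (λ a → con 1ℤ := a :- (a :- con 1ℤ)) refl f)) f≤m
      room-sym : room s F x y ≡ room s F y x
      room-sym = cong₂ (λ m f → slack s (+ m) f) (mult-sym G x y) (symm subF x y)
      bounds : ∀ u v → 0ℤ ≤ toggle s x y F u v × toggle s x y F u v ≤ + mult G u v
      bounds u v with edge-cases (room⇒≢ s subF 1≤r) u v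
      ... | inj₁ (refl , refl , e) rewrite e = at s 1≤r (lower subF u v) (upper subF u v)
      ... | inj₂ (inj₁ (refl , refl , e)) rewrite e =
        at s (subst (1ℤ ≤_) room-sym 1≤r) (lower subF u v) (upper subF u v)
      ... | inj₂ (inj₂ e) rewrite e | ℤ.*-zeroʳ (sgn s) | ℤ.+-identityʳ (F u v) = lower subF u v , upper subF u v

    dist : Mat n → Mat n → ℤ
    dist F B = ∑ λ u → ∑ λ v → + ∣ B u v - F u v ∣

    direction⇒room : ∀ s {F B} → Sub F → Sub B → ∀ x y → 0ℤ < sgn s * (B x y - F x y) → 1ℤ ≤ room s F x y
    direction⇒room Sign.+ {F} {B} subF subB x y 0<d = ℤ.≤-trans (<⇒1+≤ 0<d)
      (fromGap (gap (upper subB x y)) (solve 3 (λ f b m → m :- b := (m :- f) :- con 1ℤ :* (b :- f)) refl (F x y) (B x y) (+ mult G x y)))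
    direction⇒room Sign.- {F} {B} subF subB x y 0<d = ℤ.≤-trans (<⇒1+≤ 0<d)
      (fromGap (lower subB x y) (solve 2 (λ f b → b := f :- (:- con 1ℤ) :* (b :- f)) refl (F x y) (B x y)))

    toggle-toward : ∀ s {F B} → Sub F → Sub B → ∀ {x y} → x ≢ y → 0ℤ < sgn s * (B x y - F x y) →
      (∀ u v → Between (F u v) (B u v) (toggle s x y F u v)) × dist (toggle s x y F) B < dist F B
    toggle-toward s {F} {B} subF subB {x} {y} x≢y 0<d =
      between , ∑-mono-< (λ u → ∑-mono λ v → between-dist (between u v)) x
                  (∑-mono-< (λ v → between-dist (between x v)) y strict)
      where
      between : ∀ u v → Between (F u v) (B u v) (toggle s x y F u v)
      between u v with edge-cases x≢y u v
      ... | inj₁ (refl , refl , e) rewrite e = proj₁ (sgn-step s (F x y) (B x y) 0<d)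
      ... | inj₂ (inj₁ (refl , refl , e)) rewrite e | symm subF u v | symm subB u v = proj₁ (sgn-step s (F x y) (B x y) 0<d)
      ... | inj₂ (inj₂ e) rewrite e | ℤ.*-zeroʳ (sgn s) | ℤ.+-identityʳ (F u v) = between-refl (F u v) (B u v)
      strict : + ∣ B x y - toggle s x y F x y ∣ < + ∣ B x y - F x y ∣
      strict with edge-cases x≢y x y
      ... | inj₁ (_ , _ , e) rewrite e = proj₂ (sgn-step s (F x y) (B x y) 0<d)
      ... | inj₂ (inj₁ (y≡x , _)) = ⊥-elim (x≢y (sym y≡x))
      ... | inj₂ (inj₂ e) = ⊥-elim (1≢0 (trans (sym e₁) e))
        where
        1≢0 : 1ℤ ≢ 0ℤ
        1≢0 ()
        e₁ : edge x y x y ≡ 1ℤ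
        e₁ rewrite δ-refl x | δ-refl y | δ-≢ x≢y | δ-≢ (x≢y ∘ sym) = refl

    -- An alternating walk from F to B, starting with the surplus u and
    -- stopped at the first vertex where it can absorb a unit of L.
    walk : ∀ k {F B} → Sub F → Sub B → dist F B ≤ + k → ∀ u L →
      (∀ w → degree B w ≡ degree F w + (⟦ u ⟧ w + val L w)) →
      ∃₂ λ u′ F′ → u′ ∈ L × Sub F′ × (∀ v w → Between (F v w) (B v w) (F′ v w)) ×
        (∀ w → degree F′ w ≡ degree F w + (⟦ u ⟧ w + ⟦ u′ ⟧ w))
    walk k {F} {B} subF subB d≤k u@(x , s) L eq with any? (neg u ≟ᵤ_) L
    ... | yes i = neg u , F , i , subF , (λ v w → between-refl (F v w) (B v w)) , λ w → sym (trans
      (cong (λ z → degree F w + (⟦ u ⟧ w + z)) (⟦neg⟧ u w))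
      (solve 2 (λ a b → a :+ (b :+ (:- b)) := a) refl (degree F w) (⟦ u ⟧ w)))
    -- No unit of `L` cancels the surplus, so row `x` of `B` exceeds that of `F` by at least 1 in
    -- direction `s`, and some entry of the row has to move that way.
    ... | no ∉L with ∑-witness (λ _ → 0ℤ) (λ y → sgn s * (B x y - F x y))
                       (subst₂ _<_ (sym (∑-0 n)) total (1+≤⇒< {0ℤ} (fromGap (val-sign {x = x} {s} L ∉L) refl′)))
      where
      total : 1ℤ + sgn s * val L x ≡ ∑ (λ y → sgn s * (B x y - F x y))
      total = sym (begin
        ∑ (λ y → sgn s * (B x y - F x y))  ≡⟨ trans (∑-* (sgn s) _) (cong (sgn s *_) (∑-- (B x) (F x))) ⟩
        sgn s * (degree B x - degree F x)            ≡⟨ cong (λ z → sgn s * (z - degree F x)) (eq x) ⟩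
        sgn s * ((degree F x + (sgn s * δ x x + val L x)) - degree F x)
          ≡⟨ cong (λ z → sgn s * ((degree F x + (sgn s * z + val L x)) - degree F x)) (δ-refl x) ⟩
        sgn s * ((degree F x + (sgn s * 1ℤ + val L x)) - degree F x)
          ≡⟨ solve 3 (λ s d l → s :* ((d :+ (s :* con 1ℤ :+ l)) :- d) := s :* s :+ s :* l) refl (sgn s) (degree F x) (val L x) ⟩
        sgn s * sgn s + sgn s * val L x    ≡⟨ cong (_+ sgn s * val L x) (sgn² s) ⟩
        1ℤ + sgn s * val L x ∎)
        where open ≡-Reasoning
      refl′ : sgn s * val L x ≡ (1ℤ + sgn s * val L x) - 1ℤ
      refl′ = solve 1 (λ a → a := (con 1ℤ :+ a) :- con 1ℤ) refl _
    ... | y , 0<d = continue k d≤k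
      where
      room₁ = direction⇒room s subF subB x y 0<d
      -- The toggle settles the surplus at `x` but moves the degree of `y` by the same sign; the
      -- opposite unit at `y` is the new surplus.
      F₁ = toggle s x y F
      subF₁ = toggle-Sub s subF x y room₁
      toward = toggle-toward s subF subB (room⇒≢ s subF room₁) 0<d
      0≤dist : 0ℤ ≤ dist F₁ B
      0≤dist = ∑-nonneg λ u → ∑-nonneg λ v → ℤ.+≤+ (ℕ.z≤n {∣ B u v - F₁ u v ∣})
      eq₁ : ∀ w → degree B w ≡ degree F₁ w + (⟦ neg (y , s) ⟧ w + val L w)
      eq₁ w rewrite eq w | degree-toggle s x y F w | ⟦neg⟧ (y , s) w =
        solve 4 (λ d a b l → d :+ (a :+ l) := (d :+ (a :+ b)) :+ ((:- b) :+ l)) refl (degree F w) (⟦ x , s ⟧ w) (⟦ y , s ⟧ w) (val L w)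
      continue : ∀ k → dist F B ≤ + k → ∃₂ λ u′ F′ → u′ ∈ L × Sub F′ × (∀ v w → Between (F v w) (B v w) (F′ v w)) ×
        (∀ w → degree F′ w ≡ degree F w + (⟦ u ⟧ w + ⟦ u′ ⟧ w))
      continue zero    d≤0 = ⊥-elim (ℤ.<⇒≱ (ℤ.<-≤-trans (proj₂ toward) d≤0) 0≤dist)
      continue (suc k) d≤k with walk k subF₁ subB (<suc⇒≤ (ℤ.<-≤-trans (proj₂ toward) d≤k)) (neg (y , s)) L eq₁
      ... | u′ , F′ , i , subF′ , btw , eq′ = u′ , F′ , i , subF′ ,
        (λ v w → between-trans (proj₁ toward v w) (btw v w)) , λ w → trans (eq′ w)
          (trans (cong₂ (λ a b → a + (b + ⟦ u′ ⟧ w)) (degree-toggle s x y F w) (⟦neg⟧ (y , s) w))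
            (solve 4 (λ d a b c → (d :+ (a :+ b)) :+ ((:- b) :+ c) := d :+ (a :+ c)) refl (degree F w) (⟦ x , s ⟧ w) (⟦ y , s ⟧ w) (⟦ u′ ⟧ w)))

    -- One walk serves both ends: its result A′ lies entrywise between `A` and `B`, so the reflected
    -- matrix A + B - A′ is a subgraph too.
    exchange : ∀ {A B} → Sub A → Sub B → ∀ u L →
      (∀ w → degree B w ≡ degree A w + (⟦ u ⟧ w + val L w)) →
      ∃ λ u′ → u′ ∈ L ×
        (∃ λ A′ → Sub A′ × ∀ w → degree A′ w ≡ degree A w + (⟦ u ⟧ w + ⟦ u′ ⟧ w)) ×
        (∃ λ B′ → Sub B′ × ∀ w → degree B′ w ≡ degree B w - (⟦ u ⟧ w + ⟦ u′ ⟧ w))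
    exchange {A} {B} subA subB u L eq
      with walk ∣ dist A B ∣ subA subB (ℤ.≤-reflexive (sym (ℤ.0≤i⇒+∣i∣≡i 0≤dist))) u L eq
      where
      0≤dist : 0ℤ ≤ dist A B
      0≤dist = ∑-nonneg λ u → ∑-nonneg λ v → ℤ.+≤+ (ℕ.z≤n {∣ B u v - A u v ∣})
    ... | u′ , A′ , i , subA′ , btw , eqA = u′ , i , (A′ , subA′ , eqA) , B′ , subB′ , eqB
      where
      B′ : Mat n
      B′ v w = (A v w + B v w) - A′ v w
      bounds : ∀ {a b c m} → Between a b c → 0ℤ ≤ a → 0ℤ ≤ b → a ≤ m → b ≤ m →
        0ℤ ≤ (a + b) - c × (a + b) - c ≤ m
      bounds {a} {b} {c} {m} (inj₁ (a≤c , c≤b)) 0≤a 0≤b a≤m b≤m =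
        subst (0ℤ ≤_) (solve 3 (λ a b c → a :+ (b :- c) := (a :+ b) :- c) refl a b c) (0≤+ 0≤a (gap c≤b)) ,
        fromGap (0≤+ (gap b≤m) (gap a≤c))
          (solve 4 (λ a b c m → (m :- b) :+ (c :- a) := m :- ((a :+ b) :- c)) refl a b c m)
      bounds {a} {b} {c} {m} (inj₂ (b≤c , c≤a)) 0≤a 0≤b a≤m b≤m =
        subst (0ℤ ≤_) (solve 3 (λ a b c → b :+ (a :- c) := (a :+ b) :- c) refl a b c) (0≤+ 0≤b (gap c≤a)) ,
        fromGap (0≤+ (gap a≤m) (gap b≤c))
          (solve 4 (λ a b c m → (m :- a) :+ (c :- b) := m :- ((a :+ b) :- c)) refl a b c m)
      bounds′ = λ v w → bounds (btw v w) (lower subA v w) (lower subB v w) (upper subA v w) (upper subB v w)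
      subB′ : Sub B′
      subB′ = record
        { symm  = λ v w → cong₂ _-_ (cong₂ _+_ (symm subA v w) (symm subB v w)) (symm subA′ v w)
        ; lower = λ v w → proj₁ (bounds′ v w)
        ; upper = λ v w → proj₂ (bounds′ v w)
        }
      eqB : ∀ w → degree B′ w ≡ degree B w - (⟦ u ⟧ w + ⟦ u′ ⟧ w)
      eqB w = begin
        ∑ (λ v → (A w v + B w v) - A′ w v)  ≡⟨ trans (∑-- _ (A′ w)) (cong (_- degree A′ w) (∑-+ (A w) (B w))) ⟩
        (degree A w + degree B w) - degree A′ w            ≡⟨ cong (_-_ (degree A w + degree B w)) (eqA w) ⟩
        (degree A w + degree B w) - (degree A w + (⟦ u ⟧ w + ⟦ u′ ⟧ w))
          ≡⟨ solve 3 (λ a b c → (a :+ b) :- (a :+ c) := b :- c) refl (degree A w) (degree B w) (⟦ u ⟧ w + ⟦ u′ ⟧ w) ⟩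
        degree B w - (⟦ u ⟧ w + ⟦ u′ ⟧ w) ∎
        where open ≡-Reasoning

  -- Reachable vectors next to p

  val-↭ : ∀ {n} {β γ : List (Unit n)} → β ↭ γ → ∀ w → val β w ≡ val γ w
  val-↭ Perm.refl          w = refl
  val-↭ (prep u β↭γ)       w = cong (_+_ (⟦ u ⟧ w)) (val-↭ β↭γ w)
  val-↭ (swap {xs = β} u v β↭γ)   w = trans
    (solve 3 (λ u v b → u :+ (v :+ b) := v :+ (u :+ b)) refl (⟦ u ⟧ w) (⟦ v ⟧ w) (val β w))
    (cong (λ z → ⟦ v ⟧ w + (⟦ u ⟧ w + z)) (val-↭ β↭γ w))
  val-↭ (Perm.trans p q)   w = trans (val-↭ p w) (val-↭ q w)

  third-first : ∀ {n} {u v w : Unit n} {β} → u ∷ v ∷ w ∷ β ↭ w ∷ u ∷ v ∷ β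
  third-first {u = u} {v} {w} = ↭-trans (prep u (swap v w ↭-refl)) (swap u w ↭-refl)

  fourth-first : ∀ {n} {u v w z : Unit n} {β} → u ∷ v ∷ w ∷ z ∷ β ↭ z ∷ u ∷ v ∷ w ∷ β
  fourth-first {u = u} {z = z} = ↭-trans (prep u third-first) (swap u z ↭-refl)

  -- Membership that also names the list left after the deletion, so that later case distinctions
  -- run over the unit given up in an exchange.
  data Select {n : ℕ} (u : Unit n) : List (Unit n) → List (Unit n) → Set where
    first : ∀ {β} → Select u (u ∷ β) β
    later : ∀ {v β γ} → Select u β γ → Select u (v ∷ β) (v ∷ γ)

  select : ∀ {n} {u : Unit n} {β} → u ∈ β → ∃ (Select u β)
  select (Any.here refl) = _ , first
  select (Any.there i)   = _ , later (proj₂ (select i))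

  val-select : ∀ {n} {u : Unit n} {β γ} → Select u β γ → ∀ w → val β w ≡ ⟦ u ⟧ w + val γ w
  val-select first w = refl
  val-select {u = u} {v ∷ β} {_ ∷ γ} (later i) w = trans (cong (_+_ (⟦ v ⟧ w)) (val-select i w))
    (solve 3 (λ a b c → a :+ (b :+ c) := b :+ (a :+ c)) refl (⟦ v ⟧ w) (⟦ u ⟧ w) (val γ w))

  module Hole {n : ℕ} (G : Graph n) (p : Fin n → ℤ) where

    open Subgraphs G

    record Realises (β : List (Unit n)) (F : Mat n) : Set where
      constructor realising
      field
        valid   : Sub F
        degrees : ∀ w → degree F w ≡ p w + val β w

    open Realises public

    record Reachable (β : List (Unit n)) : Set where
      constructor _▹_
      field
        subgraph : Mat n
        realises : Realises β subgraph

    Good : Unit n → Set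
    Good u = Reachable (u ∷ [])

    -- b moves away from p while its opposite is within reach: b = (v , +)
    -- for the vertices v of T, and b = (v , -) for those of S.
    Barred : Unit n → Set
    Barred b = ¬ Good b × Good (neg b)

    Critical Dull : Fin n → Set
    Critical x = ∀ s → Good (x , s)
    Dull x     = ∀ s → ¬ Good (x , s)

    Reachable-resp : ∀ {β γ} → (∀ w → val β w ≡ val γ w) → Reachable β → Reachable γ
    Reachable-resp eq (F ▹ realising subF dF) = F ▹ realising subF λ w → trans (dF w) (cong (_+_ (p w)) (eq w))

    Reachable-↭ : ∀ {β γ} → β ↭ γ → Reachable β → Reachable γ
    Reachable-↭ β↭γ = Reachable-resp (val-↭ β↭γ)

    cancel : ∀ {u β} → Reachable (neg u ∷ u ∷ β) → Reachable β
    cancel {u} {β} = Reachable-resp λ w → trans (cong (_+ (⟦ u ⟧ w + val β w)) (⟦neg⟧ u w))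
      (solve 2 (λ u b → (:- u) :+ (u :+ b) := b) refl (⟦ u ⟧ w) (val β w))

    cancel′ : ∀ {u β} → Reachable (u ∷ neg u ∷ β) → Reachable β
    cancel′ {u} = cancel ∘ Reachable-↭ (swap u (neg u) ↭-refl)

    opaque
      add-edge : ∀ s {β F x y} → Realises β F → 1ℤ ≤ room s F x y →
        Realises ((x , s) ∷ (y , s) ∷ β) (toggle s x y F)
      add-edge s {β} {F} {x} {y} (realising subF dF) 1≤r = realising (toggle-Sub s subF x y 1≤r) λ w → begin
        degree (toggle s x y F) w                                  ≡⟨ degree-toggle s x y F w ⟩
        degree F w + (⟦ x , s ⟧ w + ⟦ y , s ⟧ w)                   ≡⟨ cong (_+ (⟦ x , s ⟧ w + ⟦ y , s ⟧ w)) (dF w) ⟩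
        (p w + val β w) + (⟦ x , s ⟧ w + ⟦ y , s ⟧ w)
          ≡⟨ solve 4 (λ p v a b → (p :+ v) :+ (a :+ b) := p :+ (a :+ (b :+ v))) refl (p w) (val β w) (⟦ x , s ⟧ w) (⟦ y , s ⟧ w) ⟩
        p w + (⟦ x , s ⟧ w + (⟦ y , s ⟧ w + val β w)) ∎
        where open ≡-Reasoning

    opaque
      -- Exchange between p + a and p + val β with first step `neg a`. The first vector trades `a`
      -- for some u of β, so u is good; the second makes the reverse trade, and `a` takes the place
      -- of u. This is the only form in which the exchange property is used below.
      insert : ∀ {a β} → Good a → Reachable β → ∃₂ λ u γ → Select u β γ × Good u × Reachable (a ∷ γ)
      insert {a} {β} (A ▹ realising subA dA) (B ▹ realising subB dB) =
        let u , i , (A′ , subA′ , dA′) , (B′ , subB′ , dB′) = exchange subA subB (neg a) β balance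
            γ , sel = select i
        in u , γ , sel ,
          (A′ ▹ realising subA′ (λ w → trans (dA′ w) (trans (cong₂ (λ x y → x + (y + ⟦ u ⟧ w)) (dA w) (⟦neg⟧ a w))
            (move (p w) (⟦ a ⟧ w) (⟦ u ⟧ w))))) ,
          (B′ ▹ realising subB′ (λ w → trans (dB′ w)
            (trans (cong₂ (λ x y → x - (y + ⟦ u ⟧ w)) (trans (dB w) (cong (_+_ (p w)) (val-select sel w))) (⟦neg⟧ a w))
              (replace (p w) (⟦ a ⟧ w) (⟦ u ⟧ w) (val γ w)))))
        where
        move : ∀ p a u → (p + (a + 0ℤ)) + (- a + u) ≡ p + (u + 0ℤ)
        move = solve 3 (λ p a u → (p :+ (a :+ con 0ℤ)) :+ ((:- a) :+ u) := p :+ (u :+ con 0ℤ)) refl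
        replace : ∀ p a u b → (p + (u + b)) - (- a + u) ≡ p + (a + b)
        replace = solve 4 (λ p a u b → (p :+ (u :+ b)) :- ((:- a) :+ u) := p :+ (a :+ b)) refl
        start : ∀ p a b → (p + (a + 0ℤ)) + (- a + b) ≡ p + b
        start = solve 3 (λ p a b → (p :+ (a :+ con 0ℤ)) :+ ((:- a) :+ b) := p :+ b) refl
        balance : ∀ w → degree B w ≡ degree A w + (⟦ neg a ⟧ w + val β w)
        balance w = trans (dB w) (sym (trans (cong₂ (λ x y → x + (y + val β w)) (dA w) (⟦neg⟧ a w))
          (start (p w) (⟦ a ⟧ w) (val β w))))

    opaque
      -- The two rooms of an edge add up to its multiplicity.
      room-either : ∀ s {F} → Sub F → ∀ {x y} → 1ℤ ≤ + mult G x y → 1ℤ ≤ room s F x y ⊎ 1ℤ ≤ room (opposite s) F x y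
      room-either s {F} subF {x} {y} 1≤m with 1ℤ ℤ.≤? room s F x y
      ... | yes 1≤r = inj₁ 1≤r
      ... | no ¬1≤r = inj₂ (subst (1ℤ ≤_) (complement s (ℤ.≤-antisym (r≤0 s ¬1≤r) (0≤room s subF x y))) 1≤m)
        where
        r≤0 : ∀ s → ¬ 1ℤ ≤ room s F x y → room s F x y ≤ 0ℤ
        r≤0 s ¬1≤r = ℤ.≮⇒≥ (¬1≤r ∘ <⇒1+≤)
        complement : ∀ s → room s F x y ≡ 0ℤ → + mult G x y ≡ room (opposite s) F x y
        complement Sign.+ r≡0 = trans (solve 2 (λ m f → m := (m :- f) :+ f) refl (+ mult G x y) (F x y))
          (trans (cong (_+ F x y) r≡0) (ℤ.+-identityˡ (F x y)))
        complement Sign.- r≡0 = sym (trans (cong (_-_ (+ mult G x y)) r≡0) (ℤ.+-identityʳ (+ mult G x y)))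

    -- Start from a subgraph of degrees p - 1_x. If xy can be added, this yields p + 1_y. Otherwise
    -- xy can be removed, and inserting a positive unit at `x` makes the negative unit at `y` good
    -- in each case.
    dull-not-adjacent : ∀ {x y} → Critical x → 1ℤ ≤ + mult G x y → ¬ Dull y
    dull-not-adjacent {x} {y} cx 1≤m dy with cx Sign.-
    ... | F ▹ rF with room-either Sign.+ (valid rF) 1≤m
    ... | inj₁ r = dy Sign.+ (cancel′ {x , Sign.+} (Reachable-↭ (prep _ (swap _ _ ↭-refl)) (_ ▹ add-edge Sign.+ rF r)))
    ... | inj₂ r with insert (cx Sign.+) (_ ▹ add-edge Sign.- rF r)
    ... | _ , _ , first , _ , q                 = dy Sign.- (cancel′ {x , Sign.+} (Reachable-↭ (prep _ (swap _ _ ↭-refl)) q))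
    ... | _ , _ , later first , g , _         = dy Sign.- g
    ... | _ , _ , later (later first) , _ , q = dy Sign.- (cancel′ {x , Sign.+} q)

    -- Insert `neg b`: if `u` is given up, then b cancels and `c` becomes good; otherwise the unit
    -- given up, `b` or `c`, is itself good.
    barred-pair : ∀ {u b c} → Barred b → ¬ Good c → ¬ Reachable (u ∷ b ∷ c ∷ [])
    barred-pair (¬b , gb̄) ¬c r with insert gb̄ r
    ... | _ , _ , first , _ , q                 = ¬c (cancel q)
    ... | _ , _ , later first , g , _         = ¬b g
    ... | _ , _ , later (later first) , g , _ = ¬c g

    -- Configurations excluded by one or two barred units

    module _ {b : Unit n} (¬b : ¬ Good b) where

      -- Inserting the opposite unit at `x` either cancels one copy after giving up the other, which
      -- leaves `b` alone, or gives up `b`; both would make `b` good.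
      double₁ : ∀ {x s} → Critical x → ¬ Reachable ((x , s) ∷ (x , s) ∷ b ∷ [])
      double₁ {s = s} cx r with insert (cx (opposite s)) r
      ... | _ , _ , first , _ , q                 = ¬b (cancel q)
      ... | _ , _ , later first , _ , q         = ¬b (cancel q)
      ... | _ , _ , later (later first) , g , _ = ¬b g

      flip₁ : ∀ {x s v} → Critical x → Reachable ((x , s) ∷ v ∷ b ∷ []) → Reachable ((x , opposite s) ∷ v ∷ b ∷ [])
      flip₁ {s = s} cx r with insert (cx (opposite s)) r
      ... | _ , _ , first , _ , q                 = q
      ... | _ , _ , later first , _ , q         = ⊥-elim (¬b (cancel q))
      ... | _ , _ , later (later first) , g , _ = ⊥-elim (¬b g)

      orient₁ : ∀ {x s v} t → Critical x → Reachable ((x , s) ∷ v ∷ b ∷ []) → Reachable ((x , t) ∷ v ∷ b ∷ [])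
      orient₁ {s = Sign.+} Sign.+ cx r = r
      orient₁ {s = Sign.+} Sign.- cx r = flip₁ cx r
      orient₁ {s = Sign.-} Sign.+ cx r = flip₁ cx r
      orient₁ {s = Sign.-} Sign.- cx r = r

      -- Turn the unit at `y` to the sign opposite to `s`. Either toggle of the edge xy then cancels
      -- the unit at one end and doubles the unit at the other, which `double₁` excludes.
      adjacent₁ : ∀ {x y s t} → Critical x → Critical y → 1ℤ ≤ + mult G x y →
        ¬ Reachable ((x , s) ∷ (y , t) ∷ b ∷ [])
      adjacent₁ {x} {y} {s} {t} cx cy 1≤m r
        with orient₁ (opposite s) cy (Reachable-↭ (swap _ _ ↭-refl) r)
      ... | F ▹ rF with room-either s (valid rF) 1≤m
      ... | inj₁ q = double₁ cx (cancel′ {y , s} (Reachable-↭ (↭-trans (swap _ _ ↭-refl) (prep _ (swap _ _ ↭-refl))) (_ ▹ add-edge s rF q)))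
      ... | inj₂ q = double₁ cy (cancel {x , s} (Reachable-↭ (prep _ third-first) (_ ▹ add-edge (opposite s) rF q)))

    module _ {u b c : Unit n} (bb : Barred b) (bc : Barred c) where

      -- The trade of `double₁` in the presence of a further unit `u`: every cancellation leaves one
      -- unit in front of `b` and `c`, which is where `barred-pair` applies.
      double₂ : ∀ {x s} → Critical x → ¬ Reachable (u ∷ (x , s) ∷ (x , s) ∷ b ∷ c ∷ [])
      double₂ {x} {s} cx r with insert (cx (opposite s)) r
      ... | _ , _ , first , _ , q                 = barred-pair bb (proj₁ bc) (cancel q)
      ... | _ , _ , later first , _ , q         =
        barred-pair bb (proj₁ bc) (cancel {x , s} (Reachable-↭ (prep _ (swap _ _ ↭-refl)) q))
      ... | _ , _ , later (later first) , _ , q =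
        barred-pair bb (proj₁ bc) (cancel {x , s} (Reachable-↭ (prep _ (swap _ _ ↭-refl)) q))
      ... | _ , _ , later (later (later first)) , g , _ = proj₁ bb g
      ... | _ , _ , later (later (later (later first))) , g , _ = proj₁ bc g

      opposite₂ : ∀ {x s} → ¬ Reachable (u ∷ (x , s) ∷ (x , opposite s) ∷ b ∷ c ∷ [])
      opposite₂ {x} {s} r = barred-pair bb (proj₁ bc) (cancel′ {x , s} (Reachable-↭ (↭-trans (swap _ _ ↭-refl) (prep _ (swap _ _ ↭-refl))) r))

      flip₂ : ∀ {x s v} → Critical x → Reachable (u ∷ (x , s) ∷ v ∷ b ∷ c ∷ []) →
        Reachable (u ∷ (x , opposite s) ∷ v ∷ b ∷ c ∷ [])
      flip₂ {x} {s} cx r with insert (cx (opposite s)) r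
      ... | _ , _ , first , _ , q                 = ⊥-elim (barred-pair bb (proj₁ bc) (cancel {x , s} q))
      ... | _ , _ , later first , _ , q         = Reachable-↭ (swap _ _ ↭-refl) q
      ... | _ , _ , later (later first) , _ , q =
        ⊥-elim (barred-pair bb (proj₁ bc) (cancel {x , s} (Reachable-↭ (prep _ (swap _ _ ↭-refl)) q)))
      ... | _ , _ , later (later (later first)) , g , _ = ⊥-elim (proj₁ bb g)
      ... | _ , _ , later (later (later (later first))) , g , _ = ⊥-elim (proj₁ bc g)

      orient₂ : ∀ {x s v} t → Critical x → Reachable (u ∷ (x , s) ∷ v ∷ b ∷ c ∷ []) →
        Reachable (u ∷ (x , t) ∷ v ∷ b ∷ c ∷ [])
      orient₂ {s = Sign.+} Sign.+ cx r = r
      orient₂ {s = Sign.+} Sign.- cx r = flip₂ cx r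
      orient₂ {s = Sign.-} Sign.+ cx r = flip₂ cx r
      orient₂ {s = Sign.-} Sign.- cx r = r

      adjacent₂ : ∀ {x y s t} → Critical x → Critical y → 1ℤ ≤ + mult G x y →
        ¬ Reachable (u ∷ (x , s) ∷ (y , t) ∷ b ∷ c ∷ [])
      adjacent₂ {x} {y} {s} {t} cx cy 1≤m r
        with orient₂ (opposite s) cy (Reachable-↭ (prep _ (swap _ _ ↭-refl)) r)
      ... | F ▹ rF with room-either s (valid rF) 1≤m
      ... | inj₁ q = double₂ cx (cancel′ {y , s} (Reachable-↭
        (↭-trans (swap _ _ ↭-refl) (prep _ (↭-trans third-first (prep _ (swap _ _ ↭-refl)))))
        (_ ▹ add-edge s rF q)))
      ... | inj₂ q = double₂ cy (cancel {x , s} (Reachable-↭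
        (prep _ (↭-trans fourth-first (prep _ (swap _ _ ↭-refl))))
        (_ ▹ add-edge (opposite s) rF q)))

    module _ (U : Subset n) (outside : ∀ {v} → v Subset.∉ U → Critical v ⊎ Dull v) where

      step-critical : ∀ {x y} → Critical x → Adj G U x y → Critical y
      step-critical cx (_ , y∉U , 0<m) with outside y∉U
      ... | inj₁ cy = cy
      ... | inj₂ dy = ⊥-elim (dull-not-adjacent cx (ℤ.+≤+ 0<m) dy)

      connected-critical : ∀ {x y} → Critical x → Connected G U x y → Critical y
      connected-critical cx ε        = cx
      connected-critical cx (a ◅ as) = connected-critical (step-critical cx a) as

      -- Insert a unit at the next vertex z of the walk. If x is given up, the walk gets shorter; if
      -- y is given up, the adjacent vertices x and z remain; `b` cannot be given up, since it is
      -- not good.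
      connected₁ : ∀ {b} → ¬ Good b → ∀ {x y s t} → Critical x → Connected G U x y →
        ¬ Reachable ((x , s) ∷ (y , t) ∷ b ∷ [])
      connected₁ ¬b {s = Sign.+} {Sign.+} cx ε r = double₁ ¬b cx r
      connected₁ ¬b {x} {s = Sign.+} {Sign.-} cx ε r = ¬b (cancel′ {x , Sign.+} r)
      connected₁ ¬b {x} {s = Sign.-} {Sign.+} cx ε r = ¬b (cancel′ {x , Sign.-} r)
      connected₁ ¬b {s = Sign.-} {Sign.-} cx ε r = double₁ ¬b cx r
      connected₁ ¬b cx (a@(_ , _ , 0<m) ◅ as) r with step-critical cx a
      ... | cz with insert (cz Sign.+) r
      ... | _ , _ , first , _ , q                 = connected₁ ¬b cz as q
      ... | _ , _ , later first , _ , q         = adjacent₁ ¬b cx cz (ℤ.+≤+ 0<m) (Reachable-↭ (swap _ _ ↭-refl) q)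
      ... | _ , _ , later (later first) , g , _ = ¬b g

      -- This extends `connected₁` to two barred units and an arbitrary unit `u`, the situation
      -- after two marked edges at critical vertices have been toggled while the root is still
      -- present.
      connected₂ : ∀ {u b c} → Barred b → Barred c → ∀ {x y s t} → Critical x → Connected G U x y →
        ¬ Reachable (u ∷ (x , s) ∷ (y , t) ∷ b ∷ c ∷ [])
      connected₂ bb bc {s = Sign.+} {Sign.+} cx ε r = double₂ bb bc cx r
      connected₂ bb bc {s = Sign.+} {Sign.-} cx ε r = opposite₂ bb bc {s = Sign.+} r
      connected₂ bb bc {s = Sign.-} {Sign.+} cx ε r = opposite₂ bb bc {s = Sign.-} r
      connected₂ bb bc {s = Sign.-} {Sign.-} cx ε r = double₂ bb bc cx r
      connected₂ {u} {b} {c} bb bc {x} {y} {s} {t} cx (a@(_ , _ , 0<m) ◅ as) r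
        with cz ← step-critical cx a with insert (cz Sign.+) r
      ... | _ , _ , later first , _ , q = connected₂ bb bc cz as (Reachable-↭ (swap _ _ ↭-refl) q)
      ... | _ , _ , later (later first) , _ , q =
        adjacent₂ bb bc cx cz (ℤ.+≤+ 0<m) (Reachable-↭ (↭-trans (swap _ _ ↭-refl) (prep _ (swap _ _ ↭-refl))) q)
      ... | _ , _ , later (later (later first)) , g , _ = proj₁ bb g
      ... | _ , _ , later (later (later (later first))) , g , _ = proj₁ bc g
      -- The new unit has replaced `u`, so three critical units stand beside `b` and `c`. Inserting
      -- `neg b` removes one of the three and cancels `b`; two critical units and `c` remain, a case
      -- for `connected₁` or `adjacent₁`.
      ... | _ , _ , first , _ , q with insert (proj₂ bb) q
      ... | _ , _ , first , _ , r′ = connected₁ (proj₁ bc) {s = s} {t} cx (a ◅ as)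
        (cancel {b} (Reachable-↭ (prep _ third-first) r′))
      ... | _ , _ , later first , _ , r′ = connected₁ (proj₁ bc) {t = t} cz as (cancel {b} (Reachable-↭ (prep _ third-first) r′))
      ... | _ , _ , later (later first) , _ , r′ = adjacent₁ (proj₁ bc) cx cz (ℤ.+≤+ 0<m)
        (Reachable-↭ (swap _ _ ↭-refl) (cancel {b} (Reachable-↭ (prep _ third-first) r′)))
      ... | _ , _ , later (later (later first)) , g , _ = proj₁ bb g
      ... | _ , _ , later (later (later (later first))) , g , _ = proj₁ bc g

  -- The barrier at p

  module _ {n : ℕ} {P : Pred (Fin n) 0ℓ} (P? : Decidable P) where

    subset : Subset n
    subset = Vec.tabulate (does ∘ P?)

    ∈-subset⁺ : ∀ {v} → P v → v Subset.∈ subset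
    ∈-subset⁺ {v} Pv = lookup⇒[]= v subset (trans (lookup∘tabulate (does ∘ P?) v) (dec-true (P? v) Pv))

    ∈-subset⁻ : ∀ {v} → v Subset.∈ subset → P v
    ∈-subset⁻ {v} v∈ with P? v | trans (sym (lookup∘tabulate (does ∘ P?) v)) ([]=⇒lookup v∈)
    ... | yes Pv | _ = Pv
    ... | no _   | ()

  ∑-filter : ∀ {n} {A : Set} {P : Pred A 0ℓ} (P? : Decidable P) (f : Fin n → A) →
    + length (filter P? (List.tabulate f)) ≡ ∑ (λ i → 𝟙 (P? (f i)))
  ∑-filter {zero}  P? f = sym (∑-zero _)
  ∑-filter {suc n} P? f with P? (f zero) | ∑-suc (λ i → 𝟙 (P? (f i)))
  ... | yes _ | eq = trans (ℤ.pos-+ 1 (length (filter P? (List.tabulate (f ∘ suc)))))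
    (trans (cong (_+_ 1ℤ) (∑-filter P? (f ∘ suc))) (sym eq))
  ... | no _  | eq = trans (∑-filter P? (f ∘ suc)) (sym (trans eq (ℤ.+-identityˡ _)))

  allPairs-map : ∀ {A : Set} {P : Pred A 0ℓ} {R S : A → A → Set} {xs} →
    (∀ {x y} → P x → P y → R x y → S x y) → All P xs → AllPairs R xs → AllPairs S xs
  allPairs-map f [] [] = []
  allPairs-map f (px ∷ pxs) (rx ∷ rxs) =
    All.zipWith (λ (py , rxy) → f px py rxy) (pxs , rx) ∷ allPairs-map f pxs rxs

  module Barriers {n : ℕ} (G : Graph n) (p : Fin n → ℤ) where

    open Subgraphs G
    open Hole G p

    module Marks (good? : ∀ u → Dec (Good u)) where

      opaque

        barred? : ∀ b → Dec (Barred b)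
        barred? b = ¬? (good? b) ×-dec good? (neg b)

        critical? : ∀ x → Dec (Critical x)
        critical? x with good? (x , Sign.+) | good? (x , Sign.-)
        ... | yes g | yes h = yes λ { Sign.+ → g ; Sign.- → h }
        ... | no ¬g | _     = no λ c → ¬g (c Sign.+)
        ... | yes _ | no ¬h = no λ c → ¬h (c Sign.-)

      S T : Subset n
      S = subset (λ v → barred? (v , Sign.-))
      T = subset (λ v → barred? (v , Sign.+))

      trichotomy : ∀ {v} → ¬ Barred (v , Sign.+) → ¬ Barred (v , Sign.-) → Critical v ⊎ Dull v
      trichotomy {v} ¬b₊ ¬b₋ with good? (v , Sign.+) | good? (v , Sign.-)
      ... | yes g | yes h = inj₁ λ { Sign.+ → g ; Sign.- → h }
      ... | no ¬g | no ¬h = inj₂ λ { Sign.+ → ¬g ; Sign.- → ¬h }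
      ... | yes g | no ¬h = ⊥-elim (¬b₋ (¬h , g))
      ... | no ¬g | yes h = ⊥-elim (¬b₊ (¬g , h))

      outside : ∀ {v} → v Subset.∉ S ∪ T → Critical v ⊎ Dull v
      outside v∉ = trichotomy
        (v∉ ∘ x∈p∪q⁺ ∘ inj₂ ∘ ∈-subset⁺ (λ v → barred? (v , Sign.+)))
        (v∉ ∘ x∈p∪q⁺ ∘ inj₁ ∘ ∈-subset⁺ (λ v → barred? (v , Sign.-)))

      β : Sign → Fin n → ℤ
      β s v = 𝟙 (barred? (v , s))

      -- The number of ways to toggle tu in the barred direction of t: missing edges if t is in `T`,
      -- present edges if t is in `S`. Such a toggle always puts a barred unit at t into the
      -- displacement.
      marks : Mat n → Mat n
      marks F u t = β Sign.+ t * room Sign.+ F t u + β Sign.- t * room Sign.- F t u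

      0≤marks : ∀ {F} → Sub F → ∀ u t → 0ℤ ≤ marks F u t
      0≤marks subF u t = 0≤+ (𝟙*-nonneg (barred? (t , Sign.+)) λ _ → 0≤room Sign.+ subF t u)
                             (𝟙*-nonneg (barred? (t , Sign.-)) λ _ → 0≤room Sign.- subF t u)

      opaque

        marks-witness : ∀ F u → 1ℤ ≤ ∑ (marks F u) → ∃₂ λ t s → Barred (t , s) × 1ℤ ≤ room s F t u
        marks-witness F u 1≤m
          with ∑-witness (λ _ → 0ℤ) (marks F u) (1+≤⇒< (subst (λ z → 1ℤ + z ≤ ∑ (marks F u)) (sym (∑-0 n)) 1≤m))
        ... | t , 0<μ with barred? (t , Sign.+) | barred? (t , Sign.-)
        ... | yes b | yes b′ = ⊥-elim (proj₁ b (proj₂ b′))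
        ... | yes b | no _ = t , Sign.+ , b , subst (1ℤ ≤_)
          (trans (ℤ.+-identityʳ _) (ℤ.*-identityˡ _)) (<⇒1+≤ 0<μ)
        ... | no _ | yes b = t , Sign.- , b , subst (1ℤ ≤_)
          (trans (ℤ.+-identityˡ _) (ℤ.*-identityˡ _)) (<⇒1+≤ 0<μ)
        ... | no _ | no _ = ⊥-elim (ℤ.<-irrefl refl 0<μ)

      barred≢critical : ∀ {t s u} → Barred (t , s) → Critical u → t ≢ u
      barred≢critical {s = s} (¬g , _) cu refl = ¬g (cu s)

      -- Lets `defect≤1` find a second mark after the first has been toggled, even on a parallel
      -- edge.
      marks-toggle : ∀ F {t s u} → Barred (t , s) → Critical u → ∀ t′ →
        marks (toggle s t u F) u t′ ≡ marks F u t′ - δ t t′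
      marks-toggle F {t} {s} {u} b cu t′ with t Fin.≟ t′
      ... | no t≢t′ = trans (cong (λ e → β Sign.+ t′ * (+ mult G t′ u - (F t′ u + sgn s * e)) + β Sign.- t′ * (F t′ u + sgn s * e)) e≡0)
        (solve 5 (λ a b m f s → a :* (m :- (f :+ s :* con 0ℤ)) :+ b :* (f :+ s :* con 0ℤ) := (a :* (m :- f) :+ b :* f) :- con 0ℤ)
          refl (β Sign.+ t′) (β Sign.- t′) (+ mult G t′ u) (F t′ u) (sgn s))
        where
        e≡0 : 0ℤ * δ u u + δ u t′ * δ t u ≡ 0ℤ
        e≡0 rewrite δ-≢ (barred≢critical b cu) = solve 2 (λ x y → con 0ℤ :* x :+ y :* con 0ℤ := con 0ℤ) refl (δ u u) (δ u t′)
      ... | yes refl = trans (cong (λ e → β Sign.+ t * (+ mult G t u - (F t u + sgn s * e)) + β Sign.- t * (F t u + sgn s * e)) e≡1)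
        (on-diagonal s b)
        where
        e≡1 : 1ℤ * δ u u + δ u t * δ t u ≡ 1ℤ
        e≡1 rewrite δ-refl u | δ-≢ (barred≢critical b cu) | δ-≢ (barred≢critical b cu ∘ sym) = refl
        on-diagonal : ∀ s → Barred (t , s) →
          β Sign.+ t * (+ mult G t u - (F t u + sgn s * 1ℤ)) + β Sign.- t * (F t u + sgn s * 1ℤ) ≡ marks F u t - 1ℤ
        on-diagonal Sign.+ b rewrite 𝟙-yes (barred? (t , Sign.+)) b | 𝟙-no (barred? (t , Sign.-)) (λ b′ → proj₁ b (proj₂ b′)) =
          solve 2 (λ m f → con 1ℤ :* (m :- (f :+ con 1ℤ :* con 1ℤ)) :+ con 0ℤ :* (f :+ con 1ℤ :* con 1ℤ) :=
            (con 1ℤ :* (m :- f) :+ con 0ℤ :* f) :- con 1ℤ) refl (+ mult G t u) (F t u)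
        on-diagonal Sign.- b rewrite 𝟙-yes (barred? (t , Sign.-)) b | 𝟙-no (barred? (t , Sign.+)) (λ b′ → proj₁ b′ (proj₂ b)) =
          solve 2 (λ m f → con 0ℤ :* (m :- (f :+ (:- con 1ℤ) :* con 1ℤ)) :+ con 1ℤ :* (f :+ (:- con 1ℤ) :* con 1ℤ) :=
            (con 0ℤ :* (m :- f) :+ con 1ℤ :* f) :- con 1ℤ) refl (+ mult G t u) (F t u)

      room-toggle : ∀ {t s t′ s′ F u u′} → t ≢ u′ → u ≢ u′ → room s′ (toggle s t u F) t′ u′ ≡ room s′ F t′ u′
      room-toggle {t} {s} {t′} {s′} {F} {u} {u′} t≢u′ u≢u′ = cong (slack s′ (+ mult G t′ u′)) unchanged
        where
        unchanged : toggle s t u F t′ u′ ≡ F t′ u′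
        unchanged rewrite δ-≢ u≢u′ | δ-≢ t≢u′ =
          solve 4 (λ f s a b → f :+ s :* (a :* con 0ℤ :+ b :* con 0ℤ) := f) refl (F t′ u′) (sgn s) (δ t t′) (δ u t′)

      -- Deviations from the barrier, and the count of edges

      module _ {r : Fin n} {s₀ : Sign} {F : Mat n} (rF : Realises ((r , s₀) ∷ []) F) where

        U : Subset n
        U = S ∪ T

        -- The deviations of F from the barrier at u: edges of F joining u to
        -- S, edges outside F joining u to T, and the root.
        defect : Fin n → ℤ
        defect u = ∑ (marks F u) + δ r u

        -- Toggling the marked edge would leave critical units at `r` and u beside one barred unit.
        root-mark : ∀ {u t s} → Critical r → Connected G U r u → Barred (t , s) → ¬ 1ℤ ≤ room s F t u
        root-mark cr conn b 1≤r = connected₁ U outside (proj₁ b) cr conn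
          (Reachable-↭ (↭-trans third-first (prep _ (swap _ _ ↭-refl))) (_ ▹ add-edge _ rF 1≤r))

        -- Toggling both edges would leave critical units at u and u′ beside two barred units; the
        -- unit at the root is the arbitrary one in `connected₂`.
        two-marks : ∀ {u t s u′ t′ s′} → Critical u → Connected G U u u′ → Barred (t , s) → Barred (t′ , s′) →
          1ℤ ≤ room s F t u → ¬ 1ℤ ≤ room s′ (toggle s t u F) t′ u′
        two-marks {u} cu conn b b′ 1≤r 1≤r′ = connected₂ U outside b b′ cu conn
          (Reachable-↭ (↭-trans (prep _ fourth-first) (↭-trans (swap _ _ ↭-refl) (prep _ (↭-trans fourth-first (prep _ (↭-sym third-first))))))
            (_ ▹ add-edge _ (add-edge _ rF 1≤r) 1≤r′))

        defect≤1 : ∀ {u} → Critical u → defect u ≤ 1ℤ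
        defect≤1 {u} cu with r Fin.≟ u
        ... | yes refl = ℤ.≤-trans (ℤ.+-monoˡ-≤ 1ℤ {∑ (marks F u)} {0ℤ} (ℤ.≮⇒≥ λ 0<m →
                let t , s , b , 1≤r = marks-witness F u (<⇒1+≤ 0<m) in root-mark cu ε b 1≤r))
              (ℤ.≤-reflexive (ℤ.+-identityˡ 1ℤ))
        ... | no _ = ℤ.≤-trans (ℤ.≤-reflexive (ℤ.+-identityʳ _)) (ℤ.≮⇒≥ λ 1<m →
          let t , s , b , 1≤r = marks-witness F u (ℤ.<⇒≤ 1<m)
              t′ , s′ , b′ , 1≤r′ = marks-witness (toggle s t u F) u (second 1<m b)
          in two-marks cu ε b b′ 1≤r 1≤r′)
          where
          second : ∀ {t s} → 1ℤ < ∑ (marks F u) → Barred (t , s) → 1ℤ ≤ ∑ (marks (toggle s t u F) u)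
          second {t} {s} 1<m b = fromGap (gap (<⇒1+≤ 1<m)) (sym (trans (cong (_- 1ℤ)
            (trans (∑-cong (marks-toggle F b cu)) (trans (∑-- (marks F u) (δ t)) (cong (_-_ (∑ (marks F u))) (∑-δ₁ t)))))
            (solve 1 (λ m → (m :- con 1ℤ) :- con 1ℤ := m :- (con 1ℤ :+ con 1ℤ)) refl (∑ (marks F u)))))

        -- Two deviations in one component are a root and a mark or two marks, so the list `W` below
        -- contains at most one vertex of each component of critical vertices.
        defects-apart : ∀ {u u′} → Critical u × 1ℤ ≤ defect u → Critical u′ × 1ℤ ≤ defect u′ → u ≢ u′ →
          ¬ Connected G U u u′
        defects-apart {u} {u′} (cu , 1≤d) (cu′ , 1≤d′) u≢u′ conn with r Fin.≟ u | r Fin.≟ u′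
        ... | yes refl | yes refl = u≢u′ refl
        ... | yes refl | no _ =
          let t , s , b , 1≤r = marks-witness F u′ (subst (1ℤ ≤_) (ℤ.+-identityʳ _) 1≤d′)
          in root-mark cu conn b 1≤r
        ... | no _ | yes refl =
          let t , s , b , 1≤r = marks-witness F u (subst (1ℤ ≤_) (ℤ.+-identityʳ _) 1≤d)
          in connected₁ U outside (proj₁ b) cu conn (Reachable-↭ (↭-sym third-first) (_ ▹ add-edge _ rF 1≤r))
        ... | no _ | no _ =
          let t , s , b , 1≤r = marks-witness F u (subst (1ℤ ≤_) (ℤ.+-identityʳ _) 1≤d)
              t′ , s′ , b′ , 1≤r′ = marks-witness F u′ (subst (1ℤ ≤_) (ℤ.+-identityʳ _) 1≤d′)
          in two-marks cu conn b b′ 1≤r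
               (subst (1ℤ ≤_) (sym (room-toggle {s = s} {s′ = s′} {F} (barred≢critical b cu′) u≢u′)) 1≤r′)

        defective? : Decidable (λ u → Critical u × 1ℤ ≤ defect u)
        defective? u = critical? u ×-dec (1ℤ ℤ.≤? defect u)

        W : List (Fin n)
        W = filter defective? (allFin n)

        c : Fin n → ℤ
        c u = 𝟙 (critical? u)

        W-critical : All Critical W
        W-critical = All.map proj₁ (all-filter defective? (allFin n))

        W-apart : AllPairs (λ u u′ → ¬ Connected G U u u′) W
        W-apart = allPairs-map defects-apart (all-filter defective? (allFin n))
          (Unique.filter⁺ defective? (Unique.allFin⁺ n))

        root-good : Good (r , s₀)
        root-good = F ▹ rF

        opaque

          -- Under these conditions (u , s) is not good: if it were, u would be critical or barred
          -- in the opposite direction. A toggle would therefore create a configuration excluded by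
          -- `barred-pair`, with the root as the third unit.
          no-room : ∀ {t u s} → Barred (t , s) → ¬ Critical u → ¬ Barred (u , opposite s) → room s F t u ≡ 0ℤ
          no-room {t} {u} {s} b ¬c ¬b′ = ℤ.≤-antisym
            (ℤ.≮⇒≥ λ 0<r → barred-pair b (not-good s ¬b′) (Reachable-↭ third-first (_ ▹ add-edge s rF (<⇒1+≤ 0<r))))
            (0≤room s (valid rF) t u)
            where
            not-good : ∀ s → ¬ Barred (u , opposite s) → ¬ Good (u , s)
            not-good Sign.+ ¬b′ g = ¬b′ ((λ h → ¬c λ { Sign.+ → g ; Sign.- → h }) , g)
            not-good Sign.- ¬b′ g = ¬b′ ((λ h → ¬c λ { Sign.+ → h ; Sign.- → g }) , g)

          room-bound : ∀ s t u → β s t * ((1ℤ - β (opposite s) u) * room s F t u) ≤ β s t * (c u * room s F t u)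
          room-bound s t u = 𝟙*-mono (barred? (t , s)) inner
            where
            inner : Barred (t , s) → (1ℤ - β (opposite s) u) * room s F t u ≤ c u * room s F t u
            inner b with critical? u | barred? (u , opposite s)
            ... | yes cu | yes (¬g , _) = ⊥-elim (¬g (cu (opposite s)))
            ... | yes cu | no _ = ℤ.≤-refl
            ... | no _ | yes _  = ℤ.≤-refl
            ... | no ¬c | no ¬b rewrite no-room b ¬c ¬b = ℤ.≤-refl

          -- The sum of `room-bound` for both signs, solved for the edges of `G`. The two products
          -- that link `S` with `T` are kept apart because they cancel in the sum over all pairs.
          pointwise : ∀ v u → β Sign.+ v * ((1ℤ - β Sign.- u) * + mult G v u) ≤
            ((β Sign.+ v - β Sign.- v) * F v u + (β Sign.- v * β Sign.+ u * F v u - β Sign.+ v * β Sign.- u * F v u))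
              + c u * marks F u v
          pointwise v u = fromGap (0≤+ (gap (room-bound Sign.+ v u)) (gap (room-bound Sign.- v u)))
            (solve 7 (λ τ σ τ′ σ′ c g f →
               (τ :* (c :* (g :- f)) :- τ :* ((con 1ℤ :- σ′) :* (g :- f))) :+ (σ :* (c :* f) :- σ :* ((con 1ℤ :- τ′) :* f))
               := (((τ :- σ) :* f :+ (σ :* τ′ :* f :- τ :* σ′ :* f)) :+ c :* (τ :* (g :- f) :+ σ :* f)) :- τ :* ((con 1ℤ :- σ′) :* g))
              refl (β Sign.+ v) (β Sign.- v) (β Sign.+ u) (β Sign.- u) (c u) (+ mult G v u) (F v u))

          swap-T-S : ∑ (λ v → ∑ λ u → β Sign.- v * β Sign.+ u * F v u) ≡ ∑ (λ v → ∑ λ u → β Sign.+ v * β Sign.- u * F v u)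
          swap-T-S = trans (∑-swap (λ v u → β Sign.- v * β Sign.+ u * F v u)) (∑-cong λ u → ∑-cong λ v →
            cong₂ _*_ (ℤ.*-comm (β Sign.- v) (β Sign.+ u)) (symm (valid rF) v u))

          row-sum : ∑ (λ v → ∑ λ u → ((β Sign.+ v - β Sign.- v) * F v u + (β Sign.- v * β Sign.+ u * F v u - β Sign.+ v * β Sign.- u * F v u))
              + c u * marks F u v)
            ≡ ∑ (λ v → (β Sign.+ v - β Sign.- v) * degree F v) + ∑ (λ u → c u * ∑ (marks F u))
          row-sum = begin
            ∑ (λ v → ∑ λ u → (A v u + (X v u - Y v u)) + M v u)
              ≡⟨ ∑-cong (λ v → trans (∑-+ (λ u → A v u + (X v u - Y v u)) (M v)) (cong (_+ ∑ (M v))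
                   (trans (∑-+ (A v) (λ u → X v u - Y v u)) (cong₂ _+_ (∑-* (β Sign.+ v - β Sign.- v) (F v)) (∑-- (X v) (Y v)))))) ⟩
            ∑ (λ v → (A′ v + (∑ (X v) - ∑ (Y v))) + ∑ (M v))
              ≡⟨ trans (∑-+ (λ v → A′ v + (∑ (X v) - ∑ (Y v))) (λ v → ∑ (M v))) (cong₂ _+_
                   (trans (∑-+ A′ (λ v → ∑ (X v) - ∑ (Y v))) (cong (_+_ (∑ A′)) (trans (∑-- (λ v → ∑ (X v)) (λ v → ∑ (Y v)))
                     (trans (cong (_- ∑ (λ v → ∑ (Y v))) swap-T-S) (ℤ.+-inverseʳ (∑ (λ v → ∑ (Y v))))))))
                   (trans (∑-swap M) (∑-cong λ u → ∑-* (c u) (marks F u)))) ⟩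
            (∑ A′ + 0ℤ) + ∑ (λ u → c u * ∑ (marks F u))
              ≡⟨ cong (_+ ∑ (λ u → c u * ∑ (marks F u))) (ℤ.+-identityʳ (∑ A′)) ⟩
            ∑ A′ + ∑ (λ u → c u * ∑ (marks F u)) ∎
            where
            open ≡-Reasoning
            A X Y M : Fin n → Fin n → ℤ
            A v u = (β Sign.+ v - β Sign.- v) * F v u
            X v u = β Sign.- v * β Sign.+ u * F v u
            Y v u = β Sign.+ v * β Sign.- u * F v u
            M v u = c u * marks F u v
            A′ : Fin n → ℤ
            A′ v = (β Sign.+ v - β Sign.- v) * degree F v

          degree-sum : ∑ (λ v → (β Sign.+ v - β Sign.- v) * degree F v) ≡
            (∑ (λ v → β Sign.+ v * p v) - ∑ (λ v → β Sign.- v * p v)) + sgn s₀ * (β Sign.+ r - β Sign.- r)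
          degree-sum = begin
            ∑ (λ v → (β Sign.+ v - β Sign.- v) * degree F v)
              ≡⟨ ∑-cong (λ v → trans (cong ((β Sign.+ v - β Sign.- v) *_) (degrees rF v))
                   (solve 5 (λ t s p z d → (t :- s) :* (p :+ (z :* d :+ con 0ℤ)) := (t :* p :- s :* p) :+ z :* (d :* (t :- s)))
                     refl (β Sign.+ v) (β Sign.- v) (p v) (sgn s₀) (δ r v))) ⟩
            ∑ (λ v → (β Sign.+ v * p v - β Sign.- v * p v) + sgn s₀ * (δ r v * (β Sign.+ v - β Sign.- v)))
              ≡⟨ trans (∑-+ (λ v → β Sign.+ v * p v - β Sign.- v * p v) _) (cong₂ _+_
                   (∑-- (λ v → β Sign.+ v * p v) (λ v → β Sign.- v * p v))
                   (trans (∑-* (sgn s₀) _) (cong (sgn s₀ *_) (∑-δ r (λ v → β Sign.+ v - β Sign.- v))))) ⟩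
            (∑ (λ v → β Sign.+ v * p v) - ∑ (λ v → β Sign.- v * p v)) + sgn s₀ * (β Sign.+ r - β Sign.- r) ∎
            where open ≡-Reasoning

          -- The source of the 1 in `barrier`. A root that is not critical lies in `S` with positive
          -- sign or in `T` with negative sign, and either way shifts the sum by -1; a critical root
          -- is counted as a defect instead.
          root-bound : sgn s₀ * (β Sign.+ r - β Sign.- r) ≤ c r - 1ℤ
          root-bound = by-sign s₀ root-good
            where
            by-sign : ∀ s → Good (r , s) → sgn s * (β Sign.+ r - β Sign.- r) ≤ c r - 1ℤ
            by-sign s g with critical? r | barred? (r , Sign.+) | barred? (r , Sign.-)
            by-sign s g | yes cr | yes (¬g , _) | _ = ⊥-elim (¬g (cr Sign.+))
            by-sign s g | yes cr | no _ | yes (¬g , _) = ⊥-elim (¬g (cr Sign.-))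
            by-sign s g | yes cr | no _ | no _ = ℤ.≤-reflexive (ℤ.*-zeroʳ (sgn s))
            by-sign Sign.+ g | no _ | yes (¬g , _) | _ = ⊥-elim (¬g g)
            by-sign Sign.+ g | no _ | no _ | yes _ = ℤ.≤-refl
            by-sign Sign.- g | no _ | _ | yes (¬g , _) = ⊥-elim (¬g g)
            by-sign Sign.- g | no _ | yes _ | no _ = ℤ.≤-refl
            by-sign s g | no ¬c | no ¬b₊ | no ¬b₋ with trichotomy ¬b₊ ¬b₋
            ... | inj₁ cr = ⊥-elim (¬c cr)
            ... | inj₂ dr = ⊥-elim (dr s g)

          defect-sum : ∑ (λ u → c u * ∑ (marks F u)) + c r ≤ + length W
          defect-sum = begin
            ∑ (λ u → c u * ∑ (marks F u)) + c r
              ≡⟨ cong (_+_ (∑ (λ u → c u * ∑ (marks F u)))) (∑-δ r c) ⟨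
            ∑ (λ u → c u * ∑ (marks F u)) + ∑ (λ u → δ r u * c u)
              ≡⟨ ∑-+ (λ u → c u * ∑ (marks F u)) (λ u → δ r u * c u) ⟨
            ∑ (λ u → c u * ∑ (marks F u) + δ r u * c u)
              ≤⟨ ∑-mono each ⟩
            ∑ (λ u → 𝟙 (defective? u))
              ≡⟨ ∑-filter defective? id ⟨
            + length W ∎
            where
            open ℤ.≤-Reasoning
            each : ∀ u → c u * ∑ (marks F u) + δ r u * c u ≤ 𝟙 (defective? u)
            each u = ℤ.≤-trans (ℤ.≤-reflexive
              (solve 3 (λ c m d → c :* m :+ d :* c := c :* (m :+ d)) refl (c u) (∑ (marks F u)) (δ r u))) bound
              where
              bound : c u * defect u ≤ 𝟙 (defective? u)
              bound with critical? u | 1ℤ ℤ.≤? defect u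
              ... | no _  | _     = ℤ.≤-refl
              ... | yes cu | yes _ = ℤ.≤-trans (ℤ.≤-reflexive (ℤ.*-identityˡ (defect u))) (defect≤1 cu)
              ... | yes cu | no ¬d = ℤ.≤-trans (ℤ.≤-reflexive (ℤ.*-identityˡ (defect u))) (ℤ.≮⇒≥ (¬d ∘ <⇒1+≤))

          barrier : (∑ (λ v → β Sign.- v * p v) + ∑ (λ v → ∑ λ u → β Sign.+ v * ((1ℤ - β Sign.- u) * + mult G v u))) + 1ℤ
            ≤ ∑ (λ v → β Sign.+ v * p v) + + length W
          barrier = fromGap
            (0≤+ (0≤+ (gap (∑-mono λ v → ∑-mono (pointwise v))) (gap root-bound)) (gap defect-sum))
            (trans (cong (λ z → ((z - L) + ((c r - 1ℤ) - R)) + (+ length W - (K + c r))) (trans row-sum (cong (_+ K) degree-sum)))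
              (solve 7 (λ l r w k c t s → ((((t :- s) :+ r :+ k) :- l) :+ ((c :- con 1ℤ) :- r)) :+ (w :- (k :+ c))
                   := (t :+ w) :- ((s :+ l) :+ con 1ℤ))
                refl L R (+ length W) K (c r) (∑ (λ v → β Sign.+ v * p v)) (∑ (λ v → β Sign.- v * p v))))
            where
            L R K : ℤ
            L = ∑ (λ v → ∑ λ u → β Sign.+ v * ((1ℤ - β Sign.- u) * + mult G v u))
            R = sgn s₀ * (β Sign.+ r - β Sign.- r)
            K = ∑ (λ u → c u * ∑ (marks F u))

  -- Moving the degree vector towards f

  -- The predicate has to respect `_≈_` because a search through functions recovers each of them
  -- only up to pointwise equality.
  Exhaustible : (X : Set) → (X → X → Set) → Set₁
  Exhaustible X _≈_ = (P : X → Set) → (∀ {x y} → x ≈ y → P x → P y) → (∀ x → Dec (P x)) → Dec (∃ P)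

  Fin-exhaustible : ∀ {n} → Exhaustible (Fin n) _≡_
  Fin-exhaustible P _ P? = Fin.any? P?

  Π-exhaustible : ∀ {n} (X : Fin n → Set) (R : ∀ i → X i → X i → Set) → (∀ i {x} → R i x x) →
    (∀ i → Exhaustible (X i) (R i)) → Exhaustible (∀ i → X i) (λ g h → ∀ i → R i (g i) (h i))
  Π-exhaustible {zero} X R R-refl ex P resp P? =
    map′ (λ Pg → nil , Pg) (λ (g , Pg) → resp (λ ()) Pg) (P? nil)
    where
    nil : ∀ i → X i
    nil ()
  Π-exhaustible {suc n} X R R-refl ex P resp P? = map′
    (λ (x , g , Pxg) → cons x g , Pxg)
    (λ (g , Pg) → g zero , g ∘ suc , resp (λ { zero → R-refl zero ; (suc i) → R-refl (suc i) }) Pg)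
    (ex zero (λ x → ∃ λ g → P (cons x g))
      (λ x≈y (g , Pg) → g , resp (λ { zero → x≈y ; (suc i) → R-refl (suc i) }) Pg)
      λ x → Π-exhaustible (X ∘ suc) (R ∘ suc) (λ i → R-refl (suc i)) (ex ∘ suc) (λ g → P (cons x g))
        (λ g≈h → resp λ { zero → R-refl zero ; (suc i) → g≈h i }) λ g → P? (cons x g))
    where
    cons : X zero → (∀ i → X (suc i)) → ∀ i → X i
    cons x g zero    = x
    cons x g (suc i) = g i

  module _ {n : ℕ} (G : Graph n) (p : Fin n → ℤ) where

    open Subgraphs G
    open Hole G p

    -- The entries of a subgraph are bounded by the multiplicities, so only finitely many matrices
    -- need to be tried. This makes the barrier sets decidable.
    Reachable? : ∀ β → Dec (Reachable β)
    Reachable? β = map′ to from (Π-exhaustible _ (λ u g h → ∀ v → g v ≡ h v) (λ u v → refl)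
      (λ u → Π-exhaustible _ (λ v → _≡_) (λ v → refl) λ v → Fin-exhaustible) P resp P?)
      where
      Choice : Set
      Choice = ∀ u v → Fin (suc (mult G u v))
      mat : Choice → Mat n
      mat g u v = + toℕ (g u v)
      P : Choice → Set
      P g = (∀ u v → mat g u v ≡ mat g v u) × (∀ w → degree (mat g) w ≡ p w + val β w)
      resp : ∀ {g h} → (∀ u v → g u v ≡ h u v) → P g → P h
      resp g≗h (sym-g , D-g) =
        (λ u v → subst₂ (λ x y → + toℕ x ≡ + toℕ y) (g≗h u v) (g≗h v u) (sym-g u v)) ,
        (λ w → trans (∑-cong λ v → cong (λ x → + toℕ x) (sym (g≗h w v))) (D-g w))
      P? : ∀ g → Dec (P g)
      P? g = (Fin.all? λ u → Fin.all? λ v → mat g u v ℤ.≟ mat g v u) ×-dec (Fin.all? λ w → degree (mat g) w ℤ.≟ p w + val β w)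
      to : ∃ P → Reachable β
      to (g , sym-g , D-g) = mat g ▹ realising
        (record { symm = sym-g ; lower = λ u v → ℤ.+≤+ ℕ.z≤n ; upper = λ u v → ℤ.+≤+ (ℕ.≤-pred (Fin.toℕ<n (g u v))) }) D-g
      from : Reachable β → ∃ P
      from (F ▹ realising subF dF) = g , (λ u v → trans (mat≡ u v) (trans (symm subF u v) (sym (mat≡ v u)))) ,
        (λ w → trans (∑-cong (mat≡ w)) (dF w))
        where
        abs≡ : ∀ u v → + ∣ F u v ∣ ≡ F u v
        abs≡ u v = ℤ.0≤i⇒+∣i∣≡i (lower subF u v)
        g : Choice
        g u v = fromℕ< (ℕ.s≤s (ℤ.drop‿+≤+ (ℤ.≤-trans (ℤ.≤-reflexive (abs≡ u v)) (upper subF u v))))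
        mat≡ : ∀ u v → mat g u v ≡ F u v
        mat≡ u v = trans (cong +_ (Fin.toℕ-fromℕ< _)) (abs≡ u v)

  module _ {n : ℕ} {G : Graph n} where

    open Subgraphs G

    toGraph : ∀ {F} → Sub F → Graph n
    toGraph {F} subF = record
      { mult     = λ u v → ∣ F u v ∣
      ; mult-sym = λ u v → cong ∣_∣ (symm subF u v)
      ; loopless = λ v → cong ∣_∣ (ℤ.≤-antisym (subst (λ m → F v v ≤ + m) (loopless G v) (upper subF v v)) (lower subF v v))
      }

    deg-toGraph : ∀ {F} (subF : Sub F) {m} v → degree F v ≡ + m → deg (toGraph subF) v ≡ m
    deg-toGraph {F} subF v eq = ℤ.+-injective (trans (∑-pos (λ u → ∣ F v u ∣))
      (trans (∑-cong λ u → ℤ.0≤i⇒+∣i∣≡i (lower subF v u)) eq))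

    nearFactor : ∀ (f : Fin n → ℕ) {F} → Sub F →
      ((∀ v → degree F v ≡ + f v) ⊎ ∃ λ w → ∀ v → degree F v ≡ + f v + ⟦ w , Sign.+ ⟧ v) → HasNearFactor f G
    nearFactor f {F} subF exact = toGraph subF ,
      (λ u v → ℤ.drop‿+≤+ (ℤ.≤-trans (ℤ.≤-reflexive (ℤ.0≤i⇒+∣i∣≡i (lower subF u v))) (upper subF u v))) ,
      degs exact
      where
      degs : ((∀ v → degree F v ≡ + f v) ⊎ ∃ λ w → ∀ v → degree F v ≡ + f v + ⟦ w , Sign.+ ⟧ v) →
        (∀ v → deg (toGraph subF) v ≡ f v) ⊎
        ∃ λ u → deg (toGraph subF) u ≡ suc (f u) × (∀ v → v ≢ u → deg (toGraph subF) v ≡ f v)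
      degs (inj₁ eq) = inj₁ λ v → deg-toGraph subF v (eq v)
      degs (inj₂ (w , eq)) = inj₂ (w ,
        deg-toGraph subF w (trans (eq w) (trans (cong (λ z → + f w + 1ℤ * z) (δ-refl w)) (ℤ.+-comm (+ f w) 1ℤ))) ,
        λ v v≢w → deg-toGraph subF v (trans (eq v) (trans (cong (λ z → + f v + 1ℤ * z) (δ-≢ (v≢w ∘ sym))) (ℤ.+-identityʳ (+ f v)))))

  connected-sym : ∀ {n} (G : Graph n) U {x y} → Connected G U x y → Connected G U y x
  connected-sym G U = reverse λ { {x} {y} (x∉U , y∉U , 0<m) → y∉U , x∉U , subst (0 ℕ.<_) (mult-sym G x y) 0<m }

  𝟙-cong : ∀ {a b} {A : Set a} {B : Set b} (d : Dec A) (e : Dec B) → (A → B) → (B → A) → 𝟙 d ≡ 𝟙 e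
  𝟙-cong (yes a) e f g = sym (𝟙-yes e (f a))
  𝟙-cong (no ¬a) e f g = sym (𝟙-no e (¬a ∘ g))

  ∑[_]_ : ∀ {n} → Subset n → (Fin n → ℤ) → ℤ
  ∑[ S ] h = ∑ λ v → 𝟙 (v ∈? S) * h v

  degree-outside : ∀ {n} → Graph n → Subset n → Fin n → ℤ
  degree-outside G S v = ∑ λ u → (1ℤ - 𝟙 (u ∈? S)) * + mult G v u

  -- Components are represented by a list of pairwise disconnected vertices: it bounds their number
  -- from below, and its members can be followed when a different set is deleted.
  record Deficient {n : ℕ} (G : Graph n) (f : Fin n → ℕ) : Set where
    field
      S T : Subset n
      disjoint : ∀ {v} → v Subset.∈ S → v Subset.∉ T
      W : List (Fin n)
      W-outside : All (Subset._∉ S ∪ T) W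
      W-apart : AllPairs (λ u v → ¬ Connected G (S ∪ T) u v) W
      deficit : (∑[ S ] (+_ ∘ f) + ∑[ T ] degree-outside G S) + + 2 ≤ ∑[ T ] (+_ ∘ f) + + length W

  module _ {n : ℕ} (f : Fin n → ℕ) where

    distance : (Fin n → ℤ) → ℤ
    distance d = ∑ λ v → + ∣ + f v - d v ∣

    distance-step : ∀ {d d′ : Fin n → ℤ} x s → 0ℤ < sgn s * (+ f x - d x) → (∀ v → d′ v ≡ d v + ⟦ x , s ⟧ v) →
      distance d′ < distance d
    distance-step {d} {d′} x s 0<e eq = ∑-mono-< closer x strict
      where
      at-x : d′ x ≡ d x + sgn s * 1ℤ
      at-x = trans (eq x) (cong (λ z → d x + sgn s * z) (δ-refl x))
      strict : + ∣ + f x - d′ x ∣ < + ∣ + f x - d x ∣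
      strict rewrite at-x = proj₂ (sgn-step s (d x) (+ f x) 0<e)
      closer : ∀ v → + ∣ + f v - d′ v ∣ ≤ + ∣ + f v - d v ∣
      closer v with x Fin.≟ v
      ... | yes refl = ℤ.<⇒≤ strict
      ... | no x≢v = ℤ.≤-reflexive (cong (λ z → + ∣ + f v - z ∣)
        (trans (eq v) (trans (cong (λ z → d v + sgn s * z) (δ-≢ x≢v)) (trans (cong (_+_ (d v)) (ℤ.*-zeroʳ (sgn s))) (ℤ.+-identityʳ (d v))))))

  -- Descent to a near factor in the absence of deficient pairs

  module Descent {n : ℕ} (G : Graph n) (f : Fin n → ℕ) (f≤deg : ∀ v → f v ℕ.≤ deg G v) (no-deficit : ¬ Deficient G f) where

    open Subgraphs G

    deg-∑ : ∀ v → + deg G v ≡ ∑ (λ u → + mult G v u)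
    deg-∑ v = ∑-pos (mult G v)

    -- p is one unit away from the degree vector of F, and no reachable
    -- vector next to p is closer to f than p.
    module Stuck (p : Fin n → ℤ) {r : Fin n} {s₀ : Sign} {F : Mat n} (rF : Hole.Realises G p ((r , s₀) ∷ []) F)
      (stuck : ∀ w s → Hole.Good G p (w , s) → sgn s * (+ f w - p w) ≤ 0ℤ) where

      open Hole G p
      open Barriers G p
      open Marks (λ u → Reachable? G p (u ∷ []))

      S-below : ∀ {v} → Good (v , Sign.+) → + f v ≤ p v
      S-below {v} g = fromGap (gap (stuck v Sign.+ g))
        (solve 2 (λ f p → con 0ℤ :- con 1ℤ :* (f :- p) := p :- f) refl (+ f v) (p v))

      T-above : ∀ {v} → Good (v , Sign.-) → p v ≤ + f v
      T-above {v} g = fromGap (gap (stuck v Sign.- g))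
        (solve 2 (λ f p → con 0ℤ :- (:- con 1ℤ) :* (f :- p) := f :- p) refl (+ f v) (p v))

      σ τ : Fin n → ℤ
      σ = β Sign.-
      τ = β Sign.+

      σ-gap : ∀ v → 0ℤ ≤ σ v * (p v - + f v)
      σ-gap v = 𝟙*-nonneg (barred? (v , Sign.-)) λ (_ , g) → gap (S-below g)

      τ-gap : ∀ v → 0ℤ ≤ τ v * (+ f v - p v)
      τ-gap v = 𝟙*-nonneg (barred? (v , Sign.+)) λ (_ , g) → gap (T-above g)

      Σσ Στ L : ℤ
      Σσ = ∑ (λ v → σ v * (p v - + f v))
      Στ = ∑ (λ v → τ v * (+ f v - p v))
      L = ∑ (λ v → ∑ λ u → τ v * ((1ℤ - σ u) * + mult G v u))

      in-S : ∀ v → 𝟙 (v ∈? S) ≡ σ v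
      in-S v = 𝟙-cong (v ∈? S) (barred? (v , Sign.-))
        (∈-subset⁻ (λ v → barred? (v , Sign.-))) (∈-subset⁺ (λ v → barred? (v , Sign.-)))

      in-T : ∀ v → 𝟙 (v ∈? T) ≡ τ v
      in-T v = 𝟙-cong (v ∈? T) (barred? (v , Sign.+))
        (∈-subset⁻ (λ v → barred? (v , Sign.+))) (∈-subset⁺ (λ v → barred? (v , Sign.+)))

      L≡ : L ≡ ∑[ T ] degree-outside G S
      L≡ = ∑-cong λ v → trans (∑-* (τ v) (λ u → (1ℤ - σ u) * + mult G v u))
        (cong₂ _*_ (sym (in-T v)) (∑-cong λ u → cong (λ z → (1ℤ - z) * + mult G v u) (sym (in-S u))))

      critical-outside : ∀ {v} → Critical v → v Subset.∉ S ∪ T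
      critical-outside cv v∈ with x∈p∪q⁻ S T v∈
      ... | inj₁ v∈S = proj₁ (∈-subset⁻ (λ v → barred? (v , Sign.-)) v∈S) (cv Sign.-)
      ... | inj₂ v∈T = proj₁ (∈-subset⁻ (λ v → barred? (v , Sign.+)) v∈T) (cv Sign.+)

      dull-outside : ∀ {v} → Dull v → v Subset.∉ S ∪ T
      dull-outside dv v∈ with x∈p∪q⁻ S T v∈
      ... | inj₁ v∈S = dv Sign.+ (proj₂ (∈-subset⁻ (λ v → barred? (v , Sign.-)) v∈S))
      ... | inj₂ v∈T = dv Sign.- (proj₂ (∈-subset⁻ (λ v → barred? (v , Sign.+)) v∈T))

      -- `barrier` supplies 1 where a deficient pair needs 2. Replacing `p` by `f` gains `Σσ` and
      -- `Στ`, so the other unit can come from there or from a longer list of representatives.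
      deficient : ∀ W′ → All (Subset._∉ S ∪ T) W′ → AllPairs (λ u v → ¬ Connected G (S ∪ T) u v) W′ →
        + length (W rF) + 1ℤ ≤ (+ length W′ + Σσ) + Στ → ⊥
      deficient W′ out apart bound = no-deficit record
        { S = S ; T = T
        ; disjoint = λ v∈S v∈T → proj₁ (∈-subset⁻ (λ v → barred? (v , Sign.-)) v∈S)
                                    (proj₂ (∈-subset⁻ (λ v → barred? (v , Sign.+)) v∈T))
        ; W = W′ ; W-outside = out ; W-apart = apart
        ; deficit = fromGap (0≤+ (gap (barrier rF)) (gap bound)) (sym eq)
        }
        where
        σp = ∑ (λ v → σ v * p v)
        τp = ∑ (λ v → τ v * p v)
        σf = ∑ (λ v → σ v * + f v)
        τf = ∑ (λ v → τ v * + f v)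
        σ-split : ∑ (λ v → σ v * (p v - + f v)) ≡ σp - σf
        σ-split = trans (∑-cong λ v → solve 3 (λ s p f → s :* (p :- f) := s :* p :- s :* f) refl (σ v) (p v) (+ f v))
          (∑-- (λ v → σ v * p v) (λ v → σ v * + f v))
        τ-split : ∑ (λ v → τ v * (+ f v - p v)) ≡ τf - τp
        τ-split = trans (∑-cong λ v → solve 3 (λ s p f → s :* (f :- p) := s :* f :- s :* p) refl (τ v) (p v) (+ f v))
          (∑-- (λ v → τ v * + f v) (λ v → τ v * p v))
        eq : (∑[ T ] (+_ ∘ f) + + length W′) - ((∑[ S ] (+_ ∘ f) + ∑[ T ] degree-outside G S) + + 2) ≡
          ((τp + + length (W rF)) - ((σp + L) + 1ℤ)) +
          (((+ length W′ + ∑ (λ v → σ v * (p v - + f v))) + ∑ (λ v → τ v * (+ f v - p v))) - (+ length (W rF) + 1ℤ))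
        eq = begin
          (∑[ T ] (+_ ∘ f) + + length W′) - ((∑[ S ] (+_ ∘ f) + ∑[ T ] degree-outside G S) + + 2)
            ≡⟨ cong₂ (λ x y → (x + + length W′) - (y + + 2)) (∑-cong λ v → cong (_* + f v) (in-T v))
                 (cong₂ _+_ (∑-cong λ v → cong (_* + f v) (in-S v)) (sym L≡)) ⟩
          (τf + + length W′) - ((σf + L) + + 2)
            ≡⟨ solve 7 (λ tf w′ sf l tp w sp → (tf :+ w′) :- ((sf :+ l) :+ con (+ 2)) :=
                 ((tp :+ w) :- ((sp :+ l) :+ con 1ℤ)) :+ (((w′ :+ (sp :- sf)) :+ (tf :- tp)) :- (w :+ con 1ℤ)))
                 refl τf (+ length W′) σf L τp (+ length (W rF)) σp ⟩
          ((τp + + length (W rF)) - ((σp + L) + 1ℤ)) + (((+ length W′ + (σp - σf)) + (τf - τp)) - (+ length (W rF) + 1ℤ))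
            ≡⟨ cong₂ (λ x y → ((τp + + length (W rF)) - ((σp + L) + 1ℤ)) + (((+ length W′ + x) + y) - (+ length (W rF) + 1ℤ)))
                 (sym σ-split) (sym τ-split) ⟩
          ((τp + + length (W rF)) - ((σp + L) + 1ℤ)) +
          (((+ length W′ + ∑ (λ v → σ v * (p v - + f v))) + ∑ (λ v → τ v * (+ f v - p v))) - (+ length (W rF) + 1ℤ)) ∎
          where open ≡-Reasoning

      W-outside : All (Subset._∉ S ∪ T) (W rF)
      W-outside = All.map critical-outside (W-critical rF)

      -- A disagreement at v supplies the missing unit: through a strict gap if v lies in `S` or
      -- `T`, through a new component if v is dull. At a critical v both directions are stuck, which
      -- forces equality.
      agree : ∀ v → p v ≡ + f v
      agree v with p v ℤ.≟ + f v
      ... | yes eq = eq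
      ... | no p≢f with barred? (v , Sign.-) | barred? (v , Sign.+)
      ... | yes b@(_ , g) | _ = ⊥-elim (deficient (W rF) W-outside (W-apart rF) (fromGap
          (0≤+ (gap (ℤ.≤-trans (≤∧≢⇒1≤gap (S-below g) (p≢f ∘ sym)) (ℤ.≤-trans (ℤ.≤-reflexive (sym at-v)) (term≤∑ σ-gap v)))) (∑-nonneg τ-gap))
          (solve 3 (λ w s t → (s :- con 1ℤ) :+ t := ((w :+ s) :+ t) :- (w :+ con 1ℤ)) refl (+ length (W rF)) Σσ Στ)))
        where
        at-v : σ v * (p v - + f v) ≡ p v - + f v
        at-v = trans (cong (_* (p v - + f v)) (𝟙-yes (barred? (v , Sign.-)) b)) (ℤ.*-identityˡ (p v - + f v))
      ... | no _ | yes b@(_ , g) = ⊥-elim (deficient (W rF) W-outside (W-apart rF) (fromGap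
          (0≤+ (∑-nonneg σ-gap) (gap (ℤ.≤-trans (≤∧≢⇒1≤gap (T-above g) p≢f) (ℤ.≤-trans (ℤ.≤-reflexive (sym at-v)) (term≤∑ τ-gap v)))))
          (solve 3 (λ w s t → s :+ (t :- con 1ℤ) := ((w :+ s) :+ t) :- (w :+ con 1ℤ)) refl (+ length (W rF)) Σσ Στ)))
        where
        at-v : τ v * (+ f v - p v) ≡ + f v - p v
        at-v = trans (cong (_* (+ f v - p v)) (𝟙-yes (barred? (v , Sign.+)) b)) (ℤ.*-identityˡ (+ f v - p v))
      ... | no ¬b₋ | no ¬b₊ with trichotomy ¬b₊ ¬b₋
      ... | inj₁ cv = ⊥-elim (p≢f (ℤ.≤-antisym (T-above (cv Sign.-)) (S-below (cv Sign.+))))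
      -- Everything connected to a critical vertex outside `S ∪ T` is critical, so the dull v
      -- represents a component that `W` does not meet.
      ... | inj₂ dv = ⊥-elim (deficient (v ∷ W rF) (dull-outside dv ∷ W-outside)
        (All.map (λ cu conn → dv Sign.+ (connected-critical (S ∪ T) outside cu (connected-sym G (S ∪ T) conn) Sign.+)) (W-critical rF)
          ∷ W-apart rF)
        (fromGap (0≤+ (∑-nonneg σ-gap) (∑-nonneg τ-gap))
          (sym (trans (cong (λ z → ((z + Σσ) + Στ) - (+ length (W rF) + 1ℤ)) (ℤ.pos-+ 1 (length (W rF))))
            (solve 3 (λ w s t → (((con 1ℤ :+ w) :+ s) :+ t) :- (w :+ con 1ℤ) := s :+ t) refl (+ length (W rF)) Σσ Στ)))))
      -- Otherwise no vertex is critical and `S` is empty, so the barrier says that the degrees over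
      -- `T` sum to less than `f` does, against `f≤deg`.
      surplus : ∃ λ w → Good (w , Sign.+)
      surplus with Fin.any? (λ w → Reachable? G p ((w , Sign.+) ∷ []))
      ... | yes good = good
      ... | no ¬good = ⊥-elim (ℤ.<⇒≱ τdeg<τf (ℤ.*-monoˡ-≤-nonNeg (τ v) {{ℤ.nonNegative (0≤𝟙 (barred? (v , Sign.+)))}} (ℤ.+≤+ (f≤deg v))))
        where
        W≡[] : ∀ {W} → All Critical W → length W ≡ 0
        W≡[] []       = refl
        W≡[] (cw ∷ _) = ⊥-elim (¬good (_ , cw Sign.+))
        σ≡0 : ∀ v → σ v ≡ 0ℤ
        σ≡0 v = 𝟙-no (barred? (v , Sign.-)) λ (_ , g) → ¬good (v , g)
        total : ∑ (λ v → τ v * + deg G v) < ∑ (λ v → τ v * + f v)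
        total = 1+≤⇒< (fromGap (gap (barrier rF)) (trans
          (cong₂ (λ x y → x - (y + 1ℤ)) (cong₂ _+_ τp≡ (cong +_ (W≡[] (W-critical rF)))) (cong₂ _+_ σp≡ L≡deg))
          (solve 2 (λ t d → (t :+ con 0ℤ) :- ((con 0ℤ :+ d) :+ con 1ℤ) := t :- (con 1ℤ :+ d)) refl
            (∑ (λ v → τ v * + f v)) (∑ (λ v → τ v * + deg G v)))))
          where
          τp≡ : ∑ (λ v → τ v * p v) ≡ ∑ (λ v → τ v * + f v)
          τp≡ = ∑-cong λ v → cong (τ v *_) (agree v)
          σp≡ : ∑ (λ v → σ v * p v) ≡ 0ℤ
          σp≡ = trans (∑-cong λ v → cong (_* p v) (σ≡0 v)) (∑-0 n)
          L≡deg : L ≡ ∑ (λ v → τ v * + deg G v)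
          L≡deg = ∑-cong λ v → trans (∑-* (τ v) (λ u → (1ℤ - σ u) * + mult G v u)) (cong (τ v *_)
            (trans (∑-cong λ u → trans (cong (λ z → (1ℤ - z) * + mult G v u) (σ≡0 u)) (ℤ.*-identityˡ (+ mult G v u)))
              (sym (deg-∑ v))))
        v = proj₁ (∑-witness (λ v → τ v * + deg G v) (λ v → τ v * + f v) total)
        τdeg<τf : τ v * + deg G v < τ v * + f v
        τdeg<τf = proj₂ (∑-witness (λ v → τ v * + deg G v) (λ v → τ v * + f v) total)

      near : HasNearFactor f G
      near with surplus
      ... | w , (F′ ▹ realising subF′ dF′) = nearFactor f subF′ (inj₂ (w , λ v →
        trans (dF′ v) (cong₂ _+_ (agree v) (ℤ.+-identityʳ (⟦ w , Sign.+ ⟧ v)))))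

    toward? : ∀ (d : Fin n → ℤ) v → d v ≢ + f v → ∃ λ s → 0ℤ < sgn s * (+ f v - d v)
    toward? d v d≢f with ℤ.<-cmp (d v) (+ f v)
    ... | tri< d<f _ _ = Sign.+ , 1+≤⇒< (fromGap (gap (<⇒1+≤ d<f))
      (solve 2 (λ d f → f :- (con 1ℤ :+ d) := con 1ℤ :* (f :- d) :- (con 1ℤ :+ con 0ℤ)) refl (d v) (+ f v)))
    ... | tri≈ _ d≡f _ = ⊥-elim (d≢f d≡f)
    ... | tri> _ _ f<d = Sign.- , 1+≤⇒< (fromGap (gap (<⇒1+≤ f<d))
      (solve 2 (λ d f → d :- (con 1ℤ :+ f) := (:- con 1ℤ) :* (f :- d) :- (con 1ℤ :+ con 0ℤ)) refl (d v) (+ f v)))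

    -- A round takes one unit step from the degrees of `F` to `p` and a second one to another degree
    -- vector, both towards `f`; `k` bounds the remaining distance. If no second step exists, `p` is
    -- stuck.
    descend : ∀ k {F} → Sub F → distance f (degree F) ≤ + k → HasNearFactor f G
    descend k {F} subF d≤k with Fin.any? (λ v → ¬? (degree F v ℤ.≟ + f v))
    ... | no ¬bad = nearFactor f subF (inj₁ λ v → decidable-stable (degree F v ℤ.≟ + f v) λ ≢f → ¬bad (v , ≢f))
    ... | yes (r , r-bad) = step k d≤k
      where
      s = proj₁ (toward? (degree F) r r-bad)
      0<e = proj₂ (toward? (degree F) r r-bad)
      p : Fin n → ℤ
      p w = degree F w + ⟦ r , s ⟧ w
      closer-p : distance f p < distance f (degree F)
      closer-p = distance-step f {d = degree F} r s 0<e (λ v → refl)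
      rF : Hole.Realises G p ((r , opposite s) ∷ []) F
      rF = Hole.realising subF λ w → sym (trans (cong (λ z → (degree F w + ⟦ r , s ⟧ w) + (z + 0ℤ)) (⟦neg⟧ (r , s) w))
        (solve 2 (λ d u → (d :+ u) :+ ((:- u) :+ con 0ℤ) := d) refl (degree F w) (⟦ r , s ⟧ w)))
      Closer : Fin n → Sign → Set
      Closer w t = Hole.Good G p (w , t) × 0ℤ < sgn t * (+ f w - p w)
      closer? : ∀ w t → Dec (Closer w t)
      closer? w t = Reachable? G p ((w , t) ∷ []) ×-dec (0ℤ ℤ.<? sgn t * (+ f w - p w))
      step : ∀ k → distance f (degree F) ≤ + k → HasNearFactor f G
      step k d≤k with Fin.any? (λ w → closer? w Sign.+ ⊎-dec closer? w Sign.-)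
      ... | no ¬closer = Stuck.near p rF λ
        { w Sign.+ g → ℤ.≮⇒≥ λ 0<e → ¬closer (w , inj₁ (g , 0<e))
        ; w Sign.- g → ℤ.≮⇒≥ λ 0<e → ¬closer (w , inj₂ (g , 0<e)) }
      ... | yes (w , c) = [ recurse k d≤k , recurse k d≤k ]′ c
        where
        recurse : ∀ k → distance f (degree F) ≤ + k → ∀ {t} → Closer w t → HasNearFactor f G
        recurse zero    d≤0 _ = ⊥-elim (ℤ.<⇒≱ (ℤ.<-≤-trans closer-p d≤0) (∑-nonneg λ v → ℤ.+≤+ (ℕ.z≤n {∣ + f v - p v ∣})))
        recurse (suc k) d≤k {t} ((F′ Hole.▹ Hole.realising subF′ dF′) , 0<e) = descend k subF′
          (<suc⇒≤ (ℤ.<-≤-trans (ℤ.<-trans (distance-step f {d = p} w t 0<e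
            (λ v → trans (dF′ v) (cong (_+_ (p v)) (ℤ.+-identityʳ (⟦ w , t ⟧ v))))) closer-p) d≤k))

    near-factor : HasNearFactor f G
    near-factor = descend ∣ distance f (degree empty) ∣ {empty}
      (record { symm = λ u v → refl ; lower = λ u v → ℤ.≤-refl ; upper = λ u v → ℤ.+≤+ ℕ.z≤n })
      (ℤ.≤-reflexive (sym (ℤ.0≤i⇒+∣i∣≡i (∑-nonneg λ v → ℤ.+≤+ (ℕ.z≤n {∣ + f v - degree empty v ∣})))))
      where
      empty : Mat n
      empty u v = 0ℤ

  -- Components

  any-remove : ∀ {A : Set} {P Q : Pred A 0ℓ} {ys} (i : Any P ys) → Any Q ys → (∃ λ y → P y × Q y) ⊎ Any Q (ys ─ i)
  any-remove (here py) (here qy) = inj₁ (_ , py , qy)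
  any-remove (here py) (there j) = inj₂ j
  any-remove (there i) (here qy) = inj₂ (here qy)
  any-remove (there i) (there j) with any-remove i j
  ... | inj₁ pq = inj₁ pq
  ... | inj₂ k  = inj₂ (there k)

  pigeonhole : ∀ {A B : Set} {Q : A → B → Set} {xs ys} →
    AllPairs (λ x x′ → ∀ y → Q x y → ¬ Q x′ y) xs → All (λ x → Any (Q x) ys) xs → length xs ℕ.≤ length ys
  pigeonhole [] [] = ℕ.z≤n
  pigeonhole {Q = Q} {x ∷ xs} {ys} (apart ∷ aparts) (i ∷ is) =
    subst (suc (length xs) ℕ.≤_) (sym (length-removeAt′ ys (Any.index i)))
      (ℕ.s≤s (pigeonhole aparts (All.zipWith avoid (apart , is))))
    where
    avoid : ∀ {x′} → (∀ y → Q x y → ¬ Q x′ y) × Any (Q x′) ys → Any (Q x′) (ys ─ i)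
    avoid (sep , j) with any-remove i j
    ... | inj₁ (y , q , q′) = ⊥-elim (sep y q q′)
    ... | inj₂ k = k

  length-split : ∀ {A : Set} {P : Pred A 0ℓ} (P? : Decidable P) xs →
    length xs ≡ length (filter P? xs) ℕ.+ length (filter (¬? ∘ P?) xs)
  length-split P? [] = refl
  length-split P? (x ∷ xs) with P? x
  ... | yes _ = cong suc (length-split P? xs)
  ... | no _  = trans (cong suc (length-split P? xs)) (sym (ℕ.+-suc _ _))

  argmax : ∀ {n} {P : Pred (Fin n) 0ℓ} (P? : Decidable P) (h : Fin n → ℤ) →
    (∀ v → ¬ P v) ⊎ ∃ λ v → P v × ∀ u → P u → h u ≤ h v
  argmax {zero}  P? h = inj₁ λ ()
  argmax {suc n} P? h with P? zero | argmax (P? ∘ suc) (h ∘ suc)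
  ... | no ¬p | inj₁ none = inj₁ λ { zero → ¬p ; (suc v) → none v }
  ... | no ¬p | inj₂ (v , pv , max) = inj₂ (suc v , pv , λ { zero p → ⊥-elim (¬p p) ; (suc u) → max u })
  ... | yes p | inj₁ none = inj₂ (zero , p , λ { zero _ → ℤ.≤-refl ; (suc u) pu → ⊥-elim (none u pu) })
  ... | yes p | inj₂ (v , pv , max) with ℤ.≤-total (h zero) (h (suc v))
  ...   | inj₁ le = inj₂ (suc v , pv , λ { zero _ → le ; (suc u) → max u })
  ...   | inj₂ ge = inj₂ (zero , p , λ { zero _ → ℤ.≤-refl ; (suc u) pu → ℤ.≤-trans (max u pu) ge })

  module _ {n : ℕ} {P : Pred (Fin n) 0ℓ} (P? : Decidable P) where

    𝟙-subset : ∀ v → 𝟙 (v ∈? subset P?) ≡ 𝟙 (P? v)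
    𝟙-subset v = 𝟙-cong (v ∈? subset P?) (P? v) (∈-subset⁻ P?) (∈-subset⁺ P?)

    ∑-subset : ∀ h → ∑[ subset P? ] h ≡ ∑ (λ v → 𝟙 (P? v) * h v)
    ∑-subset h = ∑-cong λ v → cong (_* h v) (𝟙-subset v)

  card : ∀ {n} (S : Subset n) → + Subset.∣ S ∣ ≡ ∑ (λ v → 𝟙 (v ∈? S))
  card {zero} Vec.[] = sym (∑-zero _)
  card {suc n} (b Vec.∷ S) = trans (head b) (trans
    (cong (_+_ (𝟙 (zero ∈? (b Vec.∷ S)))) (∑-cong λ v → 𝟙-cong (v ∈? S) (suc v ∈? (b Vec.∷ S)) Vec.there λ { (Vec.there p) → p }))
    (sym (∑-suc (λ v → 𝟙 (v ∈? (b Vec.∷ S))))))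
    where
    head : ∀ b → + Subset.∣ b Vec.∷ S ∣ ≡ 𝟙 (zero ∈? (b Vec.∷ S)) + ∑ (λ v → 𝟙 (v ∈? S))
    head true  = trans (ℤ.pos-+ 1 Subset.∣ S ∣) (cong (_+_ 1ℤ) (card S))
    head false = trans (card S) (sym (ℤ.+-identityˡ _))

  module _ {n : ℕ} (G : Graph n) where

    connected-outside : ∀ U {x y} → x Subset.∉ U → Connected G U x y → y Subset.∉ U
    connected-outside U x∉ ε = x∉
    connected-outside U x∉ ((_ , z∉ , _) ◅ as) = connected-outside U z∉ as

    apart≤ω : ∀ Z {W} → All (Subset._∉ Z) W → AllPairs (λ u v → ¬ Connected G Z u v) W → length W ℕ.≤ ω G Z
    apart≤ω Z outs apart = pigeonhole {Q = Connected G Z}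
      (AllPairs.map (λ ¬conn _ p q → ¬conn (p ◅◅ connected-sym G Z q)) apart)
      (All.map (λ {w} w∉ → Any.deduplicate⁺ (connected? G Z) (λ c p → p ◅◅ connected-sym G Z c)
        (lose (∈-filter⁺ (outside? G Z) (∈-allFin w) w∉) ε)) outs)

    -- A component that sends no edge to `Y` survives when `Y` is put back. Each of the others
    -- contains an endpoint of an edge to `Y`, so their number is at most the number of these edges.
    components-lost : ∀ S X Y {T} →
      (∀ {v} → v Subset.∈ S ∪ X → v Subset.∈ S ∪ T) → (∀ {v} → v Subset.∉ S ∪ X → v Subset.∉ Y → v Subset.∉ S ∪ T) →
      ∀ {W} → All (Subset._∉ S ∪ T) W → AllPairs (λ u v → ¬ Connected G (S ∪ T) u v) W →
      + length W ≤ + ω G (S ∪ X) + ∑[ Y ] degree-outside G (S ∪ T)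
    components-lost S X Y {T} X⊆T ∉T {W} outs apart = begin
      + length W
        ≡⟨ cong +_ (length-split touching? W) ⟩
      + (length W₁ ℕ.+ length W₂)
        ≡⟨ ℤ.pos-+ (length W₁) (length W₂) ⟩
      + length W₁ + + length W₂
        ≤⟨ ℤ.+-mono-≤ (ℤ.+≤+ W₁≤) (ℤ.+≤+ W₂≤) ⟩
      + length (filter (λ z → 1ℤ ℤ.≤? g z) (allFin n)) + + ω G (S ∪ X)
        ≡⟨ cong (_+ + ω G (S ∪ X)) (∑-filter (λ z → 1ℤ ℤ.≤? g z) id) ⟩
      ∑ (λ z → 𝟙 (1ℤ ℤ.≤? g z)) + + ω G (S ∪ X)
        ≤⟨ ℤ.+-monoˡ-≤ (+ ω G (S ∪ X)) (∑-mono 𝟙≤g) ⟩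
      ∑ g + + ω G (S ∪ X)
        ≡⟨ trans (ℤ.+-comm (∑ g) (+ ω G (S ∪ X))) (cong (_+_ (+ ω G (S ∪ X))) ∑g) ⟩
      + ω G (S ∪ X) + ∑[ Y ] degree-outside G U ∎
      where
      open ℤ.≤-Reasoning
      U = S ∪ T
      term : Fin n → Fin n → ℤ
      term z y = 𝟙 (y ∈? Y) * ((1ℤ - 𝟙 (z ∈? U)) * + mult G y z)
      g : Fin n → ℤ
      g z = ∑ (term z)
      0≤term : ∀ z y → 0ℤ ≤ term z y
      0≤term z y = 𝟙*-nonneg (y ∈? Y) λ _ → 0≤* (0≤1-𝟙 (z ∈? U)) (ℤ.+≤+ ℕ.z≤n)
      𝟙≤g : ∀ z → 𝟙 (1ℤ ℤ.≤? g z) ≤ g z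
      𝟙≤g z with 1ℤ ℤ.≤? g z
      ... | yes 1≤g = 1≤g
      ... | no _    = ∑-nonneg (0≤term z)
      ∑g : ∑ g ≡ ∑[ Y ] degree-outside G U
      ∑g = trans (∑-swap term) (∑-cong λ y → ∑-* (𝟙 (y ∈? Y)) (λ z → (1ℤ - 𝟙 (z ∈? U)) * + mult G y z))
      Touching : Fin n → Set
      Touching w = ∃ λ z → Connected G U w z × ∃ λ y → y Subset.∈ Y × 0 ℕ.< mult G y z
      touching? : ∀ w → Dec (Touching w)
      touching? w = Fin.any? λ z → connected? G U w z ×-dec Fin.any? λ y → (y ∈? Y) ×-dec (0 ℕ.<? mult G y z)
      W₁ = filter touching? W
      W₂ = filter (¬? ∘ touching?) W
      1≤g : ∀ {z y} → z Subset.∉ U → y Subset.∈ Y → 0 ℕ.< mult G y z → 1ℤ ≤ g z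
      1≤g {z} {y} z∉U y∈Y 0<m = ℤ.≤-trans (subst (1ℤ ≤_) (sym eq) (ℤ.+≤+ 0<m)) (term≤∑ (0≤term z) y)
        where
        eq : term z y ≡ + mult G y z
        eq rewrite 𝟙-yes (y ∈? Y) y∈Y | 𝟙-no (z ∈? U) z∉U = trans (ℤ.*-identityˡ _) (ℤ.*-identityˡ (+ mult G y z))
      W₁≤ : length W₁ ℕ.≤ length (filter (λ z → 1ℤ ℤ.≤? g z) (allFin n))
      W₁≤ = pigeonhole {Q = Connected G U}
        (AllPairs.map (λ ¬conn _ p q → ¬conn (p ◅◅ connected-sym G U q)) (AllPairs.filter⁺ touching? apart))
        (All.zipWith (λ { (w∉ , z , conn , y , y∈Y , 0<m) →
            lose (∈-filter⁺ (λ z → 1ℤ ℤ.≤? g z) (∈-allFin z) (1≤g (connected-outside U w∉ conn) y∈Y 0<m)) conn })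
          (filter⁺ touching? outs , all-filter touching? W))
      -- A walk leaving an untouched component would have to enter `Y`, through an edge that makes
      -- the component touching.
      stays : ∀ {x w} → w Subset.∉ U → ¬ Touching w → Connected G U w x → ∀ {y} → Connected G (S ∪ X) x y → Connected G U w y
      stays w∉ ¬touch conn ε = conn
      stays {x} w∉ ¬touch conn (_◅_ {j = z} (_ , z∉ , 0<m) as) = stays w∉ ¬touch
        (conn ◅◅ ((connected-outside U w∉ conn , ∉T z∉ z∉Y , 0<m) ◅ ε)) as
        where
        z∉Y : z Subset.∉ Y
        z∉Y z∈Y = ¬touch (x , conn , z , z∈Y , subst (0 ℕ.<_) (mult-sym G x z) 0<m)
      W₂≤ : length W₂ ℕ.≤ ω G (S ∪ X)
      W₂≤ = apart≤ω (S ∪ X) (All.map (λ ∉ → ∉ ∘ X⊆T) (filter⁺ (¬? ∘ touching?) outs))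
        (allPairs-map (λ (w∉ , ¬touch) _ ¬conn conn → ¬conn (stays w∉ ¬touch ε conn))
          (All.zip (filter⁺ (¬? ∘ touching?) outs , all-filter (¬? ∘ touching?) W))
          (AllPairs.filter⁺ (¬? ∘ touching?) apart))

  -- Weights and independent sets

  0≤² : ∀ x → 0ℤ ≤ x * x
  0≤² (+ zero)      = ℤ.≤-refl
  0≤² (+ suc n)     = ℤ.+≤+ ℕ.z≤n
  0≤² (ℤ.-[1+ n ])  = ℤ.+≤+ ℕ.z≤n

  module _ {n : ℕ} (G : Graph n) (f : Fin n → ℕ) where

    private
      m : Fin n → Fin n → ℤ
      m u v = + mult G u v

      square : Fin n → ℤ
      square v = (+ f v + 1ℤ) * (+ f v + 1ℤ)

    Remaining : Subset n → Fin n → Fin n → Set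
    Remaining Y v u = u Subset.∈ Y × u ≢ v × mult G v u ≡ 0

    opaque

      remaining? : ∀ Y v u → Dec (Remaining Y v u)
      remaining? Y v u = (u ∈? Y) ×-dec ¬? (u Fin.≟ v) ×-dec (mult G v u ℕ.≟ 0)

      -- (1 + k) (f - k) is the total weight f - k that a chosen vertex v of
      -- largest weight can remove together with its at most k neighbours.
      weight-removed : ∀ v k → ∃ λ w → 0ℤ ≤ w × + f v - k ≤ w × + 4 * ((1ℤ + k) * w) ≤ square v
      weight-removed v k with ℤ.≤-total 0ℤ (+ f v - k)
      ... | inj₁ 0≤h = + f v - k , 0≤h , ℤ.≤-refl , fromGap (0≤² ((1ℤ + k) - (+ f v - k)))
        (solve 2 (λ f k → ((con 1ℤ :+ k) :- (f :- k)) :* ((con 1ℤ :+ k) :- (f :- k)) :=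
          (f :+ con 1ℤ) :* (f :+ con 1ℤ) :- con (+ 4) :* ((con 1ℤ :+ k) :* (f :- k))) refl (+ f v) k)
      ... | inj₂ h≤0 = 0ℤ , ℤ.≤-refl , h≤0 ,
        subst (_≤ square v) (solve 1 (λ k → con 0ℤ := con (+ 4) :* ((con 1ℤ :+ k) :* con 0ℤ)) refl k) (0≤² (+ f v + 1ℤ))

    -- Choose v of largest weight f - k, discard it with its neighbours in `Y`, and recurse on the
    -- rest. The discarded weight is paid by (f v + 1)² according to `weight-removed`; `b` bounds
    -- the size of `Y`.
    greedy : ∀ b (k : Fin n → ℤ) Y → ∑ (λ v → 𝟙 (v ∈? Y)) ≤ + b → (∀ {v} → v Subset.∈ Y → ∑[ Y ] m v ≤ k v) →
      ∃ λ I → (∀ {v} → v Subset.∈ I → v Subset.∈ Y) × (∀ {u v} → u Subset.∈ I → v Subset.∈ I → mult G u v ≡ 0) ×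
        + 4 * ∑[ Y ] (λ v → + f v - k v) ≤ ∑[ I ] square
    greedy b k Y size deg≤k with argmax (_∈? Y) (λ v → + f v - k v)
    ... | inj₁ none = Y , id , (λ u∈ _ → ⊥-elim (none _ u∈)) , ℤ.≤-reflexive (trans (cong (+ 4 *_) (zero-sum _)) (sym (zero-sum square)))
      where
      zero-sum : ∀ h → ∑[ Y ] h ≡ 0ℤ
      zero-sum h = trans (∑-cong λ v → cong (_* h v) (𝟙-no (v ∈? Y) (none v))) (∑-0 n)
    ... | inj₂ (v , v∈Y , max) = choose b size
      where
      Left = Remaining Y v
      left? = remaining? Y v
      Y′ = subset left?
      h : Fin n → ℤ
      h u = + f u - k u
      w = proj₁ (weight-removed v (k v))
      0≤w = proj₁ (proj₂ (weight-removed v (k v)))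
      hv≤w = proj₁ (proj₂ (proj₂ (weight-removed v (k v))))
      w≤ = proj₂ (proj₂ (proj₂ (weight-removed v (k v))))
      smaller : ∑ (λ u → 𝟙 (u ∈? Y′)) < ∑ (λ u → 𝟙 (u ∈? Y))
      smaller = ∑-mono-< 𝟙≤ v (subst₂ _<_ (sym (𝟙-no (v ∈? Y′) λ v∈ → proj₁ (proj₂ (∈-subset⁻ left? v∈)) refl))
        (sym (𝟙-yes (v ∈? Y) v∈Y)) (ℤ.+<+ (ℕ.s≤s ℕ.z≤n)))
        where
        𝟙≤ : ∀ u → 𝟙 (u ∈? Y′) ≤ 𝟙 (u ∈? Y)
        𝟙≤ u with u ∈? Y′
        ... | yes u∈ = ℤ.≤-reflexive (sym (𝟙-yes (u ∈? Y) (proj₁ (∈-subset⁻ left? u∈))))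
        ... | no _   = 0≤𝟙 (u ∈? Y)
      -- A discarded u is v or a neighbour of v, so the bracket is at least 1 and `w` covers its
      -- weight. Taking `w` nonnegative makes parallel edges and the remaining vertices harmless.
      pointwise : ∀ u → 𝟙 (u ∈? Y) * h u ≤ 𝟙 (left? u) * h u + w * (δ v u + 𝟙 (u ∈? Y) * m v u)
      pointwise u with left? u
      ... | yes (u∈Y , _) rewrite 𝟙-yes (u ∈? Y) u∈Y = fromGap
        (0≤* 0≤w (0≤+ (0≤𝟙 (v Fin.≟ u)) (𝟙*-nonneg (yes u∈Y) λ _ → ℤ.+≤+ ℕ.z≤n)))
        (solve 2 (λ a b → b := (con 1ℤ :* a :+ b) :- con 1ℤ :* a) refl (h u) (w * (δ v u + 1ℤ * m v u)))
      ... | no ¬left with u ∈? Y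
      ...   | no _ = ℤ.≤-trans (0≤* 0≤w (0≤+ (0≤𝟙 (v Fin.≟ u)) ℤ.≤-refl)) (ℤ.≤-reflexive (sym (ℤ.+-identityˡ _)))
      ...   | yes u∈Y = fromGap (0≤+ (gap (ℤ.≤-trans (max u u∈Y) hv≤w)) (0≤* 0≤w (gap near)))
        (solve 3 (λ h w x → (w :- h) :+ w :* (x :- con 1ℤ) := (con 0ℤ :* h :+ w :* x) :- con 1ℤ :* h) refl (h u) w (δ v u + 1ℤ * m v u))
        where
        near : 1ℤ ≤ δ v u + 1ℤ * m v u
        near with v Fin.≟ u
        ... | yes _ = ℤ.+-monoʳ-≤ 1ℤ (𝟙*-nonneg (yes u∈Y) {m v u} λ _ → ℤ.+≤+ ℕ.z≤n)
        ... | no v≢u = ℤ.≤-trans (ℤ.+≤+ (ℕ.n≢0⇒n>0 λ m≡0 → ¬left (u∈Y , v≢u ∘ sym , m≡0)))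
          (ℤ.≤-reflexive (sym (trans (ℤ.+-identityˡ _) (ℤ.*-identityˡ (m v u)))))
      bound : ∑[ Y ] h ≤ ∑[ Y′ ] h + (1ℤ + k v) * w
      bound = begin
        ∑[ Y ] h
          ≤⟨ ∑-mono pointwise ⟩
        ∑ (λ u → 𝟙 (left? u) * h u + w * (δ v u + 𝟙 (u ∈? Y) * m v u))
          ≡⟨ trans (∑-+ (λ u → 𝟙 (left? u) * h u) (λ u → w * (δ v u + 𝟙 (u ∈? Y) * m v u))) (cong₂ _+_ (sym (∑-subset left? h))
               (trans (∑-* w (λ u → δ v u + 𝟙 (u ∈? Y) * m v u)) (cong (w *_) (trans (∑-+ (δ v) (λ u → 𝟙 (u ∈? Y) * m v u)) (cong (_+ ∑[ Y ] m v) (∑-δ₁ v)))))) ⟩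
        ∑[ Y′ ] h + w * (1ℤ + ∑[ Y ] m v)
          ≤⟨ ℤ.+-monoʳ-≤ (∑[ Y′ ] h) (ℤ.*-monoˡ-≤-nonNeg w {{ℤ.nonNegative 0≤w}} (ℤ.+-monoʳ-≤ 1ℤ (deg≤k v∈Y))) ⟩
        ∑[ Y′ ] h + w * (1ℤ + k v)
          ≡⟨ cong (_+_ (∑[ Y′ ] h)) (ℤ.*-comm w (1ℤ + k v)) ⟩
        ∑[ Y′ ] h + (1ℤ + k v) * w ∎
        where open ℤ.≤-Reasoning
      choose : ∀ b → ∑ (λ v → 𝟙 (v ∈? Y)) ≤ + b →
        ∃ λ I → (∀ {v} → v Subset.∈ I → v Subset.∈ Y) × (∀ {u v} → u Subset.∈ I → v Subset.∈ I → mult G u v ≡ 0) ×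
          + 4 * ∑[ Y ] (λ v → + f v - k v) ≤ ∑[ I ] square
      choose zero    size = ⊥-elim (ℤ.<⇒≱ (ℤ.<-≤-trans smaller size) (∑-nonneg λ u → 0≤𝟙 (u ∈? Y′)))
      choose (suc b) size
        with greedy b k Y′ (<suc⇒≤ (ℤ.<-≤-trans smaller size))
          (λ {u} u∈Y′ → ℤ.≤-trans (ℤ.≤-trans (ℤ.≤-reflexive (∑-subset left? (m u))) (∑-mono λ z → drop u z)) (deg≤k (proj₁ (∈-subset⁻ left? u∈Y′))))
        where
        drop : ∀ u z → 𝟙 (left? z) * m u z ≤ 𝟙 (z ∈? Y) * m u z
        drop u z with left? z
        ... | no _ = 𝟙*-nonneg (z ∈? Y) λ _ → ℤ.+≤+ ℕ.z≤n
        ... | yes (z∈Y , _) = ℤ.≤-reflexive (cong (_* m u z) (sym (𝟙-yes (z ∈? Y) z∈Y)))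
      ... | I′ , I′⊆Y′ , independent , quadratic = subset in-I? , I⊆Y , indep , total
        where
        in-I? : ∀ u → Dec (u Subset.∈ I′ ⊎ v ≡ u)
        in-I? u = (u ∈? I′) ⊎-dec (v Fin.≟ u)
        left : ∀ {u} → u Subset.∈ I′ → Left u
        left u∈ = ∈-subset⁻ left? (I′⊆Y′ u∈)
        I⊆Y : ∀ {u} → u Subset.∈ subset in-I? → u Subset.∈ Y
        I⊆Y u∈ with ∈-subset⁻ in-I? u∈
        ... | inj₁ u∈I′ = proj₁ (left u∈I′)
        ... | inj₂ refl = v∈Y
        indep : ∀ {x y} → x Subset.∈ subset in-I? → y Subset.∈ subset in-I? → mult G x y ≡ 0
        indep x∈ y∈ with ∈-subset⁻ in-I? x∈ | ∈-subset⁻ in-I? y∈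
        ... | inj₁ x∈I′ | inj₁ y∈I′ = independent x∈I′ y∈I′
        ... | inj₁ x∈I′ | inj₂ refl = trans (mult-sym G _ v) (proj₂ (proj₂ (left x∈I′)))
        ... | inj₂ refl | inj₁ y∈I′ = proj₂ (proj₂ (left y∈I′))
        ... | inj₂ refl | inj₂ refl = loopless G v
        𝟙-I : ∀ u → 𝟙 (in-I? u) ≡ 𝟙 (u ∈? I′) + δ v u
        𝟙-I u with u ∈? I′ | v Fin.≟ u
        ... | yes u∈ | yes refl = ⊥-elim (proj₁ (proj₂ (left u∈)) refl)
        ... | yes _  | no _     = refl
        ... | no _   | yes _    = refl
        ... | no _   | no _     = refl
        sum-I : ∑[ subset in-I? ] square ≡ ∑[ I′ ] square + square v
        sum-I = trans (∑-subset in-I? square) (trans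
          (∑-cong λ u → trans (cong (_* square u) (𝟙-I u)) (ℤ.*-distribʳ-+ (square u) (𝟙 (u ∈? I′)) (δ v u)))
          (trans (∑-+ (λ u → 𝟙 (u ∈? I′) * square u) (λ u → δ v u * square u)) (cong (_+_ (∑[ I′ ] square)) (∑-δ v square))))
        total : + 4 * ∑[ Y ] h ≤ ∑[ subset in-I? ] square
        total = subst (+ 4 * ∑[ Y ] h ≤_) (sym sum-I) (fromGap
          (0≤+ (0≤+ (0≤* {+ 4} (ℤ.+≤+ ℕ.z≤n) (gap bound)) (gap quadratic)) (gap w≤))
          (solve 5 (λ y y′ kw i s → ((con (+ 4) :* ((y′ :+ kw) :- y)) :+ (i :- con (+ 4) :* y′)) :+ (s :- con (+ 4) :* kw)
              := (i :+ s) :- con (+ 4) :* y)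
            refl (∑[ Y ] h) (∑[ Y′ ] h) ((1ℤ + k v) * w) (∑[ I′ ] square) (square v)))

    -- Delete the neighbours of `I` as well. Independence keeps `I` itself undeleted, and each new
    -- deletion is paid by an edge from `I` to a vertex outside `S`.
    isolating-set : ∀ S I → (∀ {v} → v Subset.∈ I → v Subset.∉ S) →
      (∀ {u v} → u Subset.∈ I → v Subset.∈ I → mult G u v ≡ 0) →
      ∃ λ S′ → (∀ {v} → v Subset.∈ I → Isolated G S′ v) ×
        + Subset.∣ S′ ∣ ≤ + Subset.∣ S ∣ + ∑[ I ] degree-outside G S
    isolating-set S I I∉S indep = S′ , isolated , size
      where
      In : Fin n → Set
      In u = u Subset.∈ S ⊎ ∃ λ v → v Subset.∈ I × 0 ℕ.< mult G v u
      in? : ∀ u → Dec (In u)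
      in? u = (u ∈? S) ⊎-dec (Fin.any? λ v → (v ∈? I) ×-dec (0 ℕ.<? mult G v u))
      S′ = subset in?
      isolated : ∀ {v} → v Subset.∈ I → Isolated G S′ v
      isolated {v} v∈I = (λ v∈S′ → [ I∉S v∈I , (λ (u , u∈I , 0<m) → ℕ.<⇒≢ 0<m (sym (indep u∈I v∈I))) ]′ (∈-subset⁻ in? v∈S′)) ,
        λ u u∉S′ → ℕ.n≤0⇒n≡0 (ℕ.≮⇒≥ λ 0<m → u∉S′ (∈-subset⁺ in? (inj₂ (v , v∈I , 0<m))))
      term : Fin n → Fin n → ℤ
      term u v = 𝟙 (v ∈? I) * ((1ℤ - 𝟙 (u ∈? S)) * m v u)
      0≤term : ∀ u v → 0ℤ ≤ term u v
      0≤term u v = 𝟙*-nonneg (v ∈? I) λ _ → 0≤* (0≤1-𝟙 (u ∈? S)) (ℤ.+≤+ ℕ.z≤n)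
      pointwise : ∀ u (d : Dec (In u)) → 𝟙 d ≤ 𝟙 (u ∈? S) + ∑ (term u)
      pointwise u (no _) = 0≤+ (0≤𝟙 (u ∈? S)) (∑-nonneg (0≤term u))
      pointwise u (yes (inj₁ u∈S)) = ℤ.≤-trans (ℤ.≤-reflexive (sym (trans (ℤ.+-identityʳ _) (𝟙-yes (u ∈? S) u∈S))))
        (ℤ.+-monoʳ-≤ (𝟙 (u ∈? S)) (∑-nonneg (0≤term u)))
      pointwise u (yes (inj₂ (v , v∈I , 0<m))) = ℤ.≤-trans (at-v (u ∈? S))
        (ℤ.+-monoʳ-≤ (𝟙 (u ∈? S)) (term≤∑ (0≤term u) v))
        where
        at-v : (d : Dec (u Subset.∈ S)) → 1ℤ ≤ 𝟙 d + 𝟙 (v ∈? I) * ((1ℤ - 𝟙 d) * m v u)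
        at-v (yes _) = ℤ.+-monoʳ-≤ 1ℤ (ℤ.≤-reflexive (sym (ℤ.*-zeroʳ (𝟙 (v ∈? I)))))
        at-v (no _)  = ℤ.≤-trans (ℤ.+≤+ 0<m) (ℤ.≤-reflexive (sym (trans (ℤ.+-identityˡ _)
          (trans (cong (_* (1ℤ * m v u)) (𝟙-yes (v ∈? I) v∈I)) (trans (ℤ.*-identityˡ _) (ℤ.*-identityˡ (m v u)))))))
      size : + Subset.∣ S′ ∣ ≤ + Subset.∣ S ∣ + ∑[ I ] degree-outside G S
      size = begin
        + Subset.∣ S′ ∣
          ≡⟨ trans (card S′) (∑-cong (𝟙-subset in?)) ⟩
        ∑ (λ u → 𝟙 (in? u))
          ≤⟨ ∑-mono (λ u → pointwise u (in? u)) ⟩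
        ∑ (λ u → 𝟙 (u ∈? S) + ∑ (term u))
          ≡⟨ trans (∑-+ (λ u → 𝟙 (u ∈? S)) (λ u → ∑ (term u))) (cong₂ _+_ (sym (card S))
               (trans (∑-swap term) (∑-cong λ v → ∑-* (𝟙 (v ∈? I)) (λ u → (1ℤ - 𝟙 (u ∈? S)) * m v u)))) ⟩
        + Subset.∣ S ∣ + ∑[ I ] degree-outside G S ∎
        where open ℤ.≤-Reasoning

    -- The integral data for the final estimate. `Q` is the weight that links the component count at
    -- `Z` with the independent set `I`.
    record Obstruction : Set where
      field
        Z S′ I     : Subset n
        Q          : ℤ
        isolated   : ∀ {v} → v Subset.∈ I → Isolated G S′ v
        small      : + Subset.∣ S′ ∣ ≤ + Subset.∣ Z ∣ + ∑[ I ] (λ v → + 2 * + f v - 1ℤ)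
        components : ∑[ Z ] (+_ ∘ f) + + 2 ≤ + ω G Z + Q
        quadratic  : + 4 * Q ≤ ∑[ I ] square

    obstruction : Deficient G f → Obstruction
    obstruction deficient = record
      { Z = S ∪ X ; S′ = proj₁ isolating ; I = I ; Q = Q
      ; isolated = proj₁ (proj₂ isolating)
      ; small = ℤ.≤-trans (proj₂ (proj₂ isolating)) (ℤ.+-mono-≤ ∣S∣≤∣Z∣ (∑-mono λ v → 𝟙*-mono (v ∈? I) (light ∘ I⊆Y)))
      ; components = fromGap (0≤+ (0≤+ (gap deficit) (gap lost)) (gap split))
          (trans (solve 8 (λ fT w fS dT o h q fX → ((((fT :+ w) :- ((fS :+ dT) :+ con (+ 2))) :+ ((o :+ h) :- w)) :+ ((q :- fX) :- ((fT :- dT) :+ h)))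
              := (o :+ q) :- ((fS :+ fX) :+ con (+ 2))) refl
              (∑[ T ] (+_ ∘ f)) (+ length W) (∑[ S ] (+_ ∘ f)) (∑[ T ] degree-outside G S) (+ ω G (S ∪ X))
              (∑[ Y ] degree-outside G (S ∪ T)) Q (∑[ X ] (+_ ∘ f)))
            (cong (λ z → (+ ω G (S ∪ X) + Q) - (z + + 2)) (sym f-Z)))
      ; quadratic = proj₂ (proj₂ (proj₂ chosen))
      }
      where
      open Deficient deficient
      d h k : Fin n → ℤ
      d = degree-outside G S
      h = degree-outside G (S ∪ T)
      -- For a heavy v, f v - d v is at most - f v, exactly what a new member of the deleted set
      -- contributes to the component condition.
      heavy? : ∀ v → Dec (v Subset.∈ T × + 2 * + f v ≤ d v)
      heavy? v = (v ∈? T) ×-dec (+ 2 * + f v ℤ.≤? d v)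
      light? : ∀ v → Dec (v Subset.∈ T × ¬ (+ 2 * + f v ≤ d v))
      light? v = (v ∈? T) ×-dec ¬? (+ 2 * + f v ℤ.≤? d v)
      X Y : Subset n
      X = subset heavy?
      Y = subset light?
      k v = ∑[ Y ] m v
      Q = ∑[ Y ] (λ v → + f v - k v)
      chosen = greedy ℤ.∣ ∑ (λ v → 𝟙 (v ∈? Y)) ∣ k Y
        (ℤ.≤-reflexive (sym (ℤ.0≤i⇒+∣i∣≡i (∑-nonneg λ v → 0≤𝟙 (v ∈? Y))))) (λ _ → ℤ.≤-refl)
      I = proj₁ chosen
      I⊆Y : ∀ {v} → v Subset.∈ I → v Subset.∈ Y
      I⊆Y = proj₁ (proj₂ chosen)
      Y⊆T : ∀ {v} → v Subset.∈ Y → v Subset.∈ T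
      Y⊆T v∈ = proj₁ (∈-subset⁻ light? v∈)
      X⊆T : ∀ {v} → v Subset.∈ X → v Subset.∈ T
      X⊆T v∈ = proj₁ (∈-subset⁻ heavy? v∈)
      light : ∀ {v} → v Subset.∈ Y → d v ≤ + 2 * + f v - 1ℤ
      light {v} v∈ = fromGap (gap (≰⇒1+≤ (proj₂ (∈-subset⁻ light? v∈))))
        (solve 2 (λ f d → f :- (con 1ℤ :+ d) := (f :- con 1ℤ) :- d) refl (+ 2 * + f v) (d v))
      isolating = isolating-set S I (λ v∈I v∈S → disjoint v∈S (Y⊆T (I⊆Y v∈I))) (proj₁ (proj₂ (proj₂ chosen)))
      𝟙-Z : ∀ v → 𝟙 (v ∈? S ∪ X) ≡ 𝟙 (v ∈? S) + 𝟙 (v ∈? X)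
      𝟙-Z v = cases (v ∈? S ∪ X) (v ∈? S) (v ∈? X)
        where
        cases : ∀ (z : Dec (v Subset.∈ S ∪ X)) (s : Dec (v Subset.∈ S)) (x : Dec (v Subset.∈ X)) → 𝟙 z ≡ 𝟙 s + 𝟙 x
        cases z (yes v∈S) (yes v∈X) = ⊥-elim (disjoint v∈S (X⊆T v∈X))
        cases z (yes v∈S) (no _) = 𝟙-yes z (x∈p∪q⁺ (inj₁ v∈S))
        cases z (no _) (yes v∈X) = 𝟙-yes z (x∈p∪q⁺ (inj₂ v∈X))
        cases z (no v∉S) (no v∉X) = 𝟙-no z ([ v∉S , v∉X ]′ ∘ x∈p∪q⁻ S X)
      f-Z : ∑[ S ∪ X ] (+_ ∘ f) ≡ ∑[ S ] (+_ ∘ f) + ∑[ X ] (+_ ∘ f)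
      f-Z = trans (∑-cong λ v → trans (cong (_* + f v) (𝟙-Z v)) (ℤ.*-distribʳ-+ (+ f v) (𝟙 (v ∈? S)) (𝟙 (v ∈? X))))
        (∑-+ (λ v → 𝟙 (v ∈? S) * + f v) (λ v → 𝟙 (v ∈? X) * + f v))
      ∣S∣≤∣Z∣ : + Subset.∣ S ∣ ≤ + Subset.∣ S ∪ X ∣
      ∣S∣≤∣Z∣ = begin
        + Subset.∣ S ∣              ≡⟨ card S ⟩
        ∑ (λ v → 𝟙 (v ∈? S))        ≤⟨ ∑-mono (λ v → ℤ.≤-trans (ℤ.≤-reflexive (sym (ℤ.+-identityʳ _)))
                                        (ℤ.≤-trans (ℤ.+-monoʳ-≤ (𝟙 (v ∈? S)) (0≤𝟙 (v ∈? X))) (ℤ.≤-reflexive (sym (𝟙-Z v))))) ⟩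
        ∑ (λ v → 𝟙 (v ∈? S ∪ X))    ≡⟨ card (S ∪ X) ⟨
        + Subset.∣ S ∪ X ∣          ∎
        where open ℤ.≤-Reasoning
      lost : + length W ≤ + ω G (S ∪ X) + ∑[ Y ] h
      lost = components-lost G S X Y
        ([ x∈p∪q⁺ ∘ inj₁ , x∈p∪q⁺ ∘ inj₂ ∘ X⊆T ]′ ∘ x∈p∪q⁻ S X)
        (λ {v} v∉SX v∉Y v∈ → [ v∉SX ∘ x∈p∪q⁺ ∘ inj₁ , (λ v∈T → v∉Y (∈-subset⁺ light?
          (v∈T , λ 2f≤d → v∉SX (x∈p∪q⁺ (inj₂ (∈-subset⁺ heavy? (v∈T , 2f≤d))))))) ]′ (x∈p∪q⁻ S T v∈))
        W-outside W-apart
      -- Edges to `X` are dropped; those to `Y` and those leaving `S ∪ T` are disjoint parts of the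
      -- rest.
      h+k≤d : ∀ v → h v + k v ≤ d v
      h+k≤d v = ℤ.≤-trans (ℤ.≤-reflexive (sym (∑-+ (λ u → (1ℤ - 𝟙 (u ∈? S ∪ T)) * m v u) (λ u → 𝟙 (u ∈? Y) * m v u))))
        (∑-mono λ u → cases u (u ∈? S ∪ T) (u ∈? Y) (u ∈? S))
        where
        cases : ∀ u (z : Dec (u Subset.∈ S ∪ T)) (y : Dec (u Subset.∈ Y)) (s : Dec (u Subset.∈ S)) →
          (1ℤ - 𝟙 z) * m v u + 𝟙 y * m v u ≤ (1ℤ - 𝟙 s) * m v u
        cases u _ (yes u∈Y) (yes u∈S) = ⊥-elim (disjoint u∈S (Y⊆T u∈Y))
        cases u (no u∉) _ (yes u∈S) = ⊥-elim (u∉ (x∈p∪q⁺ (inj₁ u∈S)))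
        cases u (no u∉) (yes u∈Y) _ = ⊥-elim (u∉ (x∈p∪q⁺ (inj₂ (Y⊆T u∈Y))))
        cases u (yes _) (no _) (yes _) = ℤ.≤-refl
        cases u (yes _) (yes _) (no _) = ℤ.≤-reflexive (ℤ.+-identityˡ _)
        cases u (yes _) (no _) (no _) = 𝟙*-nonneg {A = v ≡ v} (yes refl) {m v u} λ _ → ℤ.+≤+ ℕ.z≤n
        cases u (no _) (no _) (no _) = ℤ.≤-reflexive (ℤ.+-identityʳ _)
      split : (∑[ T ] (+_ ∘ f) - ∑[ T ] d) + ∑[ Y ] h ≤ Q - ∑[ X ] (+_ ∘ f)
      split = begin
        (∑[ T ] (+_ ∘ f) - ∑[ T ] d) + ∑[ Y ] h
          ≡⟨ trans (∑-+ (λ v → 𝟙 (v ∈? T) * + f v - 𝟙 (v ∈? T) * d v) (λ v → 𝟙 (v ∈? Y) * h v))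
               (cong (_+ ∑[ Y ] h) (∑-- (λ v → 𝟙 (v ∈? T) * + f v) (λ v → 𝟙 (v ∈? T) * d v))) ⟨
        ∑ (λ v → (𝟙 (v ∈? T) * + f v - 𝟙 (v ∈? T) * d v) + 𝟙 (v ∈? Y) * h v)
          ≤⟨ ∑-mono (λ v → cases v (v ∈? T) (v ∈? X) (v ∈? Y)) ⟩
        ∑ (λ v → 𝟙 (v ∈? Y) * (+ f v - k v) - 𝟙 (v ∈? X) * + f v)
          ≡⟨ ∑-- (λ v → 𝟙 (v ∈? Y) * (+ f v - k v)) (λ v → 𝟙 (v ∈? X) * + f v) ⟩
        Q - ∑[ X ] (+_ ∘ f) ∎
        where
        open ℤ.≤-Reasoning
        cases : ∀ v (t : Dec (v Subset.∈ T)) (x : Dec (v Subset.∈ X)) (y : Dec (v Subset.∈ Y)) →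
          (𝟙 t * + f v - 𝟙 t * d v) + 𝟙 y * h v ≤ 𝟙 y * (+ f v - k v) - 𝟙 x * + f v
        cases v (no v∉T) (yes v∈X) _ = ⊥-elim (v∉T (X⊆T v∈X))
        cases v (no v∉T) _ (yes v∈Y) = ⊥-elim (v∉T (Y⊆T v∈Y))
        cases v (no _) (no _) (no _) = ℤ.≤-refl
        cases v (yes _) (yes v∈X) (yes v∈Y) = ⊥-elim (proj₂ (∈-subset⁻ light? v∈Y) (proj₂ (∈-subset⁻ heavy? v∈X)))
        cases v (yes v∈T) (no v∉X) (no v∉Y) = ⊥-elim (v∉Y (∈-subset⁺ light? (v∈T , λ 2f≤d → v∉X (∈-subset⁺ heavy? (v∈T , 2f≤d)))))
        cases v (yes _) (yes v∈X) (no _) = fromGap (gap (proj₂ (∈-subset⁻ heavy? v∈X)))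
          (solve 2 (λ f d → d :- con (+ 2) :* f := (con 0ℤ :- con 1ℤ :* f) :- ((con 1ℤ :* f :- con 1ℤ :* d) :+ con 0ℤ)) refl (+ f v) (d v))
        cases v (yes _) (no _) (yes _) = fromGap (gap (h+k≤d v))
          (solve 4 (λ f d h k → d :- (h :+ k) := (con 1ℤ :* (f :- k) :- con 0ℤ) :- ((con 1ℤ :* f :- con 1ℤ :* d) :+ con 1ℤ :* h)) refl (+ f v) (d v) (h v) (k v))


module Reals where

  open Combinatorics using
    ( ∑; ∑-zero; ∑-suc; ∑-+; ∑-*; ∑--; ∑-0; ∑-cong; ∑-δ; ∑-δ₁; ∑-pos; 𝟙; 𝟙-yes; 𝟙-no
    ; subset; ∈-subset⁻; ∑[_]_; degree-outside; module Descent; card; 𝟙-subset; ∑-subset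
    ; Obstruction; obstruction; isolating-set)
  open import Defs using
    ( ℝ; seq; fromℕ; fromℚ; inv; 1/_[_]; 1≤⇒0<; _²; Graph; mult; loopless; deg; Isolated
    ; isolated?; IsoTough; ω; HasNearFactor)
  import Defs as ℝ
  open import Data.Bool.Base using (true; false; if_then_else_)
  open import Data.Empty using (⊥; ⊥-elim)
  open import Data.Fin.Base using (Fin; zero; suc)
  import Data.Fin.Properties as Fin
  open import Data.Fin.Subset as Subset using (Subset)
  open import Data.Fin.Subset.Properties using (_∈?_; ∉⊥; ∣⊥∣≡0)
  open import Data.Integer.Base as ℤ using (ℤ; 0ℤ; 1ℤ) renaming (+_ to pos)
  import Data.Integer.Properties as ℤ
  import Data.Integer.Solver as ℤSolver
  open import Data.Nat.Base as ℕ using (ℕ; zero; suc; _⊔_)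
  import Data.Nat.Properties as ℕ
  open import Data.Product.Base using (∃; _×_; _,_; proj₁; proj₂)
  open import Data.Rational.Base as ℚ using (ℚ; 0ℚ; 1ℚ; ½; _+_; _-_; _*_; -_; _≤_; _<_; _/_)
  import Data.Rational.Properties as ℚ
  open import Data.Rational.Solver using (module +-*-Solver)
  open import Data.Rational.Unnormalised.Base as ℚᵘ using (mkℚᵘ; *≡*; *≤*)
  import Data.Rational.Unnormalised.Properties as ℚᵘ
  open import Data.Sum.Base using (inj₁; inj₂)
  open import Data.Vec.Functional using (foldr)
  open import Function.Base using (_∘_)
  open import Level using (0ℓ)
  open import Relation.Binary.PropositionalEquality
    using (_≡_; refl; sym; trans; cong; cong₂; subst; subst₂; module ≡-Reasoning)
  open import Relation.Nullary using (¬_; Dec; yes; no; does)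
  open import Relation.Nullary.Decidable using (from-no)
  open import Relation.Unary using (Pred; Decidable)
  open import Algebra.Bundles using (CommutativeRing)
  import Algebra.Properties.CommutativeMonoid.Sum as MonoidSum
  import Algebra.Properties.Semiring.Sum as SemiringSum

  open +-*-Solver using (solve; _:=_; _:+_; _:*_; _:-_; :-_; con)

  -- A rational sample of the real hypotheses

  module ℚ-Sum = MonoidSum ℚ.+-0-commutativeMonoid

  opaque

    ∑ℚ : ∀ {n} → (Fin n → ℚ) → ℚ
    ∑ℚ = ℚ-Sum.sum

    ∑ℚ-cong : ∀ {n} {f g : Fin n → ℚ} → (∀ i → f i ≡ g i) → ∑ℚ f ≡ ∑ℚ g
    ∑ℚ-cong = ℚ-Sum.sum-cong-≗

    ∑ℚ-+ : ∀ {n} (f g : Fin n → ℚ) → ∑ℚ (λ i → f i + g i) ≡ ∑ℚ f + ∑ℚ g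
    ∑ℚ-+ = ℚ-Sum.∑-distrib-+

    ∑ℚ-* : ∀ {n} c (f : Fin n → ℚ) → ∑ℚ (λ i → c * f i) ≡ c * ∑ℚ f
    ∑ℚ-* c f = sym (SemiringSum.*-distribˡ-sum (CommutativeRing.semiring ℚ.+-*-commutativeRing) c f)

    ∑ℚ-mono : ∀ {n} {f g : Fin n → ℚ} → (∀ i → f i ≤ g i) → ∑ℚ f ≤ ∑ℚ g
    ∑ℚ-mono {zero}  f≤g = ℚ.≤-refl
    ∑ℚ-mono {suc n} f≤g = ℚ.+-mono-≤ (f≤g zero) (∑ℚ-mono (f≤g ∘ suc))

    ∑ℚ-nonneg : ∀ {n} {f : Fin n → ℚ} → (∀ i → 0ℚ ≤ f i) → 0ℚ ≤ ∑ℚ f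
    ∑ℚ-nonneg {zero}  0≤f = ℚ.≤-refl
    ∑ℚ-nonneg {suc n} 0≤f = ℚ.+-mono-≤ (0≤f zero) (∑ℚ-nonneg (0≤f ∘ suc))

    term≤∑ℚ : ∀ {n} {f : Fin n → ℚ} → (∀ i → 0ℚ ≤ f i) → ∀ j → f j ≤ ∑ℚ f
    term≤∑ℚ {suc n} {f} 0≤f zero = ℚ.≤-trans (ℚ.≤-reflexive (sym (ℚ.+-identityʳ (f zero))))
      (ℚ.+-monoʳ-≤ (f zero) (∑ℚ-nonneg {f = f ∘ suc} (0≤f ∘ suc)))
    term≤∑ℚ {suc n} {f} 0≤f (suc j) = ℚ.≤-trans (term≤∑ℚ {f = f ∘ suc} (0≤f ∘ suc) j)
      (ℚ.≤-trans (ℚ.≤-reflexive (sym (ℚ.+-identityˡ (∑ℚ (f ∘ suc))))) (ℚ.+-monoˡ-≤ (∑ℚ (f ∘ suc)) (0≤f zero)))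

    seq-foldr : ∀ {n} (g : Fin n → ℝ) M → seq (foldr ℝ._+_ (fromℕ 0) g) M ≡ ∑ℚ (λ v → seq (g v) M)
    seq-foldr {zero}  g M = refl
    seq-foldr {suc n} g M = cong (_+_ (seq (g zero) M)) (seq-foldr (g ∘ suc) M)

  ι : ℤ → ℚ
  ι i = i / 1

  ι-+ : ∀ i j → ι (i ℤ.+ j) ≡ ι i + ι j
  ι-+ i j = ℚ.toℚᵘ-injective (begin
    ℚ.toℚᵘ (ι (i ℤ.+ j))             ≈⟨ ℚ.toℚᵘ-fromℚᵘ (mkℚᵘ (i ℤ.+ j) 0) ⟩
    mkℚᵘ (i ℤ.+ j) 0                 ≈⟨ *≡* (cong (ℤ._* 1ℤ) (sym (cong₂ ℤ._+_ (ℤ.*-identityʳ i) (ℤ.*-identityʳ j)))) ⟩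
    mkℚᵘ i 0 ℚᵘ.+ mkℚᵘ j 0           ≈⟨ ℚᵘ.+-cong (ℚ.toℚᵘ-fromℚᵘ (mkℚᵘ i 0)) (ℚ.toℚᵘ-fromℚᵘ (mkℚᵘ j 0)) ⟨
    ℚ.toℚᵘ (ι i) ℚᵘ.+ ℚ.toℚᵘ (ι j)   ≈⟨ ℚ.toℚᵘ-homo-+ (ι i) (ι j) ⟨
    ℚ.toℚᵘ (ι i + ι j)               ∎)
    where open import Relation.Binary.Reasoning.Setoid ℚᵘ.≃-setoid

  ι-* : ∀ i j → ι (i ℤ.* j) ≡ ι i * ι j
  ι-* i j = ℚ.toℚᵘ-injective (begin
    ℚ.toℚᵘ (ι (i ℤ.* j))             ≈⟨ ℚ.toℚᵘ-fromℚᵘ (mkℚᵘ (i ℤ.* j) 0) ⟩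
    mkℚᵘ i 0 ℚᵘ.* mkℚᵘ j 0           ≈⟨ ℚᵘ.*-cong (ℚ.toℚᵘ-fromℚᵘ (mkℚᵘ i 0)) (ℚ.toℚᵘ-fromℚᵘ (mkℚᵘ j 0)) ⟨
    ℚ.toℚᵘ (ι i) ℚᵘ.* ℚ.toℚᵘ (ι j)   ≈⟨ ℚ.toℚᵘ-homo-* (ι i) (ι j) ⟨
    ℚ.toℚᵘ (ι i * ι j)               ∎)
    where open import Relation.Binary.Reasoning.Setoid ℚᵘ.≃-setoid

  ι-mono : ∀ {i j} → i ℤ.≤ j → ι i ≤ ι j
  ι-mono {i} {j} i≤j = ℚ.toℚᵘ-cancel-≤ (ℚᵘ.≤-respʳ-≃ (ℚᵘ.≃-sym (ℚ.toℚᵘ-fromℚᵘ (mkℚᵘ j 0)))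
    (ℚᵘ.≤-respˡ-≃ (ℚᵘ.≃-sym (ℚ.toℚᵘ-fromℚᵘ (mkℚᵘ i 0))) (*≤* (ℤ.*-monoʳ-≤-nonNeg 1ℤ i≤j))))

  ∑ℚ-ι : ∀ {n} (f : Fin n → ℤ) → ∑ℚ (λ v → ι (f v)) ≡ ι (∑ f)
  ∑ℚ-ι {n} f = by-induction n f
    where
    opaque
      unfolding ∑ℚ
      by-induction : ∀ n (f : Fin n → ℤ) → ∑ℚ (λ v → ι (f v)) ≡ ι (∑ f)
      by-induction zero    f = cong ι (sym (∑-zero f))
      by-induction (suc n) f = trans (cong (_+_ (ι (f zero))) (by-induction n (f ∘ suc)))
        (trans (sym (ι-+ (f zero) (∑ (f ∘ suc)))) (cong ι (sym (∑-suc f))))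

  seq-∑ : ∀ {n} {P : Pred (Fin n) 0ℓ} (P? : Decidable P) (t : Fin n → ℝ) M →
    seq (ℝ.∑[ P? ] t) M ≡ ∑ℚ (λ v → if does (P? v) then seq (t v) M else 0ℚ)
  seq-∑ P? t M = trans (seq-foldr _ M) (∑ℚ-cong λ v → seq-if (does (P? v)))
    where
    seq-if : ∀ b {x} → seq (if b then x else fromℕ 0) M ≡ (if b then seq x M else 0ℚ)
    seq-if true  = refl
    seq-if false = refl

  0≤+ : ∀ {x y} → 0ℚ ≤ x → 0ℚ ≤ y → 0ℚ ≤ x + y
  0≤+ = ℚ.+-mono-≤

  0≤* : ∀ {x y} → 0ℚ ≤ x → 0ℚ ≤ y → 0ℚ ≤ x * y
  0≤* {x} {y} 0≤x 0≤y = subst (_≤ x * y) (ℚ.*-zeroʳ x) (ℚ.*-monoˡ-≤-nonNeg x {{ℚ.nonNegative 0≤x}} 0≤y)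

  0≤² : ∀ x → 0ℚ ≤ x * x
  0≤² x with ℚ.≤-total 0ℚ x
  ... | inj₁ 0≤x = 0≤* 0≤x 0≤x
  ... | inj₂ x≤0 = subst (0ℚ ≤_) (solve 1 (λ x → (:- x) :* (:- x) := x :* x) refl x)
    (0≤* (ℚ.neg-antimono-≤ x≤0) (ℚ.neg-antimono-≤ x≤0))

  gap : ∀ {a b} → a ≤ b → 0ℚ ≤ b - a
  gap {a} {b} a≤b = subst (_≤ b - a) (ℚ.+-inverseʳ a) (ℚ.+-monoˡ-≤ (- a) a≤b)

  fromGap : ∀ {a b c} → 0ℚ ≤ c → c ≡ b - a → a ≤ b
  fromGap {a} {b} 0≤c refl = subst₂ _≤_ (ℚ.+-identityˡ a)
    (solve 2 (λ a b → (b :- a) :+ a := b) refl a b) (ℚ.+-monoˡ-≤ a 0≤c)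

  -- The tolerance of the sample, small enough for `ψ-bound`: since 4 ε = 1/2, the case φ = 1 reads
  -- α / 2 ≤ α² for α ≥ 7/8.
  ε : ℚ
  ε = pos 1 / 8

  *-inv : ∀ {p} → 0ℚ < p → p * inv p ≡ 1ℚ × 0ℚ ≤ inv p
  *-inv {p} 0<p with p ℚ.≟ 0ℚ
  ... | yes refl = ⊥-elim (ℚ.<-irrefl refl 0<p)
  ... | no  p≢0  = ℚ.*-inverseʳ p {{ℚ.≢-nonZero p≢0}} ,
    ℚ.<⇒≤ (ℚ.positive⁻¹ _ {{ℚ.1/pos⇒pos p {{ℚ.positive 0<p}}}})

  ∀-eventually : ∀ {n} {P : Fin n → ℕ → Set} → (∀ v → ∃ λ N → ∀ k → N ℕ.≤ k → P v k) →
    ∃ λ N → ∀ k → N ℕ.≤ k → ∀ v → P v k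
  ∀-eventually {zero}  ev = 0 , λ _ _ ()
  ∀-eventually {suc n} ev =
    let N , P₀ = ev zero
        N′ , Pₛ = ∀-eventually (ev ∘ suc)
    in N ⊔ N′ , λ { k N≤k zero → P₀ k (ℕ.m⊔n≤o⇒m≤o N N′ N≤k)
                  ; k N≤k (suc v) → Pₛ k (ℕ.m⊔n≤o⇒n≤o N N′ N≤k) v }

  module _ {n : ℕ} (f : Fin n → ℕ) (I : Subset n) where

    moment₀ moment₁ moment₂ : ℤ
    moment₀ = ∑ (λ v → 𝟙 (v ∈? I))
    moment₁ = ∑[ I ] (λ v → pos (f v))
    moment₂ = ∑[ I ] (λ v → pos (f v) ℤ.* pos (f v))

    quadratic-sum : ∀ A B C →
      ∑ℚ (λ v → ι (𝟙 (v ∈? I)) * ((A * (ι (pos (f v)) * ι (pos (f v))) + B * ι (pos (f v))) + C)) ≡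
      (A * ι moment₂ + B * ι moment₁) + C * ι moment₀
    quadratic-sum A B C = begin
      ∑ℚ (λ v → ι (𝟙 (v ∈? I)) * ((A * (ι (pos (f v)) * ι (pos (f v))) + B * ι (pos (f v))) + C))
        ≡⟨ ∑ℚ-cong (λ v → trans
             (solve 5 (λ i φ A B C → i :* ((A :* (φ :* φ) :+ B :* φ) :+ C) := (A :* (i :* (φ :* φ)) :+ B :* (i :* φ)) :+ C :* i)
               refl (ι (𝟙 (v ∈? I))) (ι (pos (f v))) A B C)
             (cong₂ (λ x y → (A * x + B * y) + C * ι (𝟙 (v ∈? I)))
               (trans (cong (ι (𝟙 (v ∈? I)) *_) (sym (ι-* (pos (f v)) (pos (f v))))) (sym (ι-* (𝟙 (v ∈? I)) (pos (f v) ℤ.* pos (f v)))))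
               (sym (ι-* (𝟙 (v ∈? I)) (pos (f v)))))) ⟩
      ∑ℚ (λ v → (A * ι (𝟙 (v ∈? I) ℤ.* (pos (f v) ℤ.* pos (f v))) + B * ι (𝟙 (v ∈? I) ℤ.* pos (f v))) + C * ι (𝟙 (v ∈? I)))
        ≡⟨ trans (∑ℚ-+ _ _) (cong₂ _+_ (trans (∑ℚ-+ _ _) (cong₂ _+_ (scaled A _) (scaled B _))) (scaled C _)) ⟩
      (A * ι moment₂ + B * ι moment₁) + C * ι moment₀ ∎
      where
      open ≡-Reasoning
      scaled : ∀ c (g : Fin n → ℤ) → ∑ℚ (λ v → c * ι (g v)) ≡ c * ι (∑ g)
      scaled c g = trans (∑ℚ-* c (ι ∘ g)) (cong (c *_) (∑ℚ-ι g))

  module Sampling {n : ℕ} (G : Graph n) (f : Fin n → ℕ) (a : ℝ)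
    (1≤a : fromℕ 1 ℝ.≤ a) (a≤f : ∀ v → a ℝ.≤ fromℕ (f v))
    (tough : IsoTough (λ v → 1/ a [ 1≤⇒0< a 1≤a ] ℝ.* (fromℕ (f v) ℝ.+ a ℝ.* fromℚ ½) ²) G)
    (comps : ∀ (S : Subset n) → fromℕ (ω G S) ℝ.< ℝ.∑[ (_∈? S) ] (λ v → fromℕ (f v) ℝ.- a) ℝ.+ fromℕ 2)
    where

    φ : Fin n → ℚ
    φ v = ι (pos (f v))

    -- α is a term of the sequence a so late that the hypotheses needed for
    -- S′ and Z hold for it up to ε.
    record Sample (S′ Z : Subset n) : Set where
      field
        α η  : ℚ
        0<η  : 0ℚ < η
        1≤α  : 1ℚ ≤ α + ε
        α≤φ  : ∀ v → α ≤ φ v + ε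
        -- Iso-toughness multiplied by `α`, with the squares (φ + α/2)² over I expanded into
        -- moments.
        iso  : ∀ I → (∀ {v} → v Subset.∈ I → Isolated G S′ v) →
               (1ℚ * ι (moment₂ f I) + α * ι (moment₁ f I)) + ((α * ½) * (α * ½)) * ι (moment₀ f I)
                 ≤ α * (ι (pos Subset.∣ S′ ∣) + ε)
        comp : ι (pos (ω G Z)) + η ≤ (ι (∑[ Z ] (λ v → pos (f v))) - α * ι (pos Subset.∣ Z ∣)) + ι (pos 2)

      0≤α : 0ℚ ≤ α
      0≤α = fromGap (0≤+ (gap 1≤α) (ℚ.nonNegative⁻¹ (1ℚ - ε)))
        (solve 1 (λ α → ((α :+ con ε) :- con 1ℚ) :+ con (1ℚ - ε) := α :- con 0ℚ) refl α)

    0<ε : 0ℚ < ε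
    0<ε = ℚ.positive⁻¹ ε

    opaque

      sample : ∀ S′ Z → Sample S′ Z
      sample S′ Z = record
        { α = α ; η = η ; 0<η = proj₁ (proj₂ (comps Z))
        ; 1≤α = 1≤α
        ; α≤φ = λ v → proj₂ below M (ℕ.≤-trans (ℕ.m≤n⊔m N₁ N₂) (ℕ.m≤m⊔n (N₁ ⊔ N₂) (N₃ ⊔ N₄))) v
        ; iso = iso
        ; comp = subst (λ z → ι (pos (ω G Z)) + η ≤ z + ι (pos 2)) linear
            (proj₂ (proj₂ (proj₂ (comps Z))) M (ℕ.≤-trans (ℕ.m≤n⊔m N₃ N₄) (ℕ.m≤n⊔m (N₁ ⊔ N₂) (N₃ ⊔ N₄))))
        }
        where
        below : ∃ λ N → ∀ k → N ℕ.≤ k → ∀ v → seq a k ≤ φ v + ε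
        below = ∀-eventually (λ v → a≤f v ε 0<ε)
        N₁ N₂ N₃ N₄ M : ℕ
        N₁ = proj₁ (1≤a ε 0<ε)
        N₂ = proj₁ below
        N₃ = proj₁ (tough S′ ε 0<ε)
        N₄ = proj₁ (proj₂ (proj₂ (comps Z)))
        M = (N₁ ⊔ N₂) ⊔ (N₃ ⊔ N₄)
        α η : ℚ
        α = seq a M
        η = proj₁ (comps Z)
        1≤α : 1ℚ ≤ α + ε
        1≤α = proj₂ (1≤a ε 0<ε) M (ℕ.≤-trans (ℕ.m≤m⊔n N₁ N₂) (ℕ.m≤m⊔n (N₁ ⊔ N₂) (N₃ ⊔ N₄)))
        0<α : 0ℚ < α
        0<α = ℚ.<-≤-trans (ℚ.positive⁻¹ (1ℚ - ε)) (fromGap (gap 1≤α)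
          (solve 1 (λ α → (α :+ con ε) :- con 1ℚ := α :- con (1ℚ - ε)) refl α))
        linear : seq (ℝ.∑[ (_∈? Z) ] (λ v → fromℕ (f v) ℝ.- a)) M ≡ ι (∑[ Z ] (λ v → pos (f v))) - α * ι (pos Subset.∣ Z ∣)
        linear = begin
          seq (ℝ.∑[ (_∈? Z) ] (λ v → fromℕ (f v) ℝ.- a)) M
            ≡⟨ seq-∑ (_∈? Z) (λ v → fromℕ (f v) ℝ.- a) M ⟩
          ∑ℚ (λ v → if does (v ∈? Z) then φ v - α else 0ℚ)
            ≡⟨ ∑ℚ-cong (λ v → trans (pointwise v (v ∈? Z)) (cong (_+ (- α) * ι (𝟙 (v ∈? Z))) (sym (ι-* (𝟙 (v ∈? Z)) (pos (f v)))))) ⟩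
          ∑ℚ (λ v → ι (𝟙 (v ∈? Z) ℤ.* pos (f v)) + (- α) * ι (𝟙 (v ∈? Z)))
            ≡⟨ trans (∑ℚ-+ _ _) (cong₂ _+_ (∑ℚ-ι _) (trans (∑ℚ-* (- α) _) (cong ((- α) *_) (trans (∑ℚ-ι _) (cong ι (sym (card Z))))))) ⟩
          ι (∑[ Z ] (λ v → pos (f v))) + (- α) * ι (pos Subset.∣ Z ∣)
            ≡⟨ cong (_+_ (ι (∑[ Z ] (λ v → pos (f v))))) (solve 2 (λ a z → (:- a) :* z := :- (a :* z)) refl α (ι (pos Subset.∣ Z ∣))) ⟩
          ι (∑[ Z ] (λ v → pos (f v))) - α * ι (pos Subset.∣ Z ∣) ∎
          where
          open ≡-Reasoning
          pointwise : ∀ v (d : Dec (v Subset.∈ Z)) → (if does d then φ v - α else 0ℚ) ≡ ι (𝟙 d) * φ v + (- α) * ι (𝟙 d)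
          pointwise v (yes _) = solve 2 (λ φ α → φ :- α := con 1ℚ :* φ :+ (:- α) :* con 1ℚ) refl (φ v) α
          pointwise v (no _)  = solve 2 (λ φ α → con 0ℚ := con 0ℚ :* φ :+ (:- α) :* con 0ℚ) refl (φ v) α
        iso : ∀ I → (∀ {v} → v Subset.∈ I → Isolated G S′ v) →
          (1ℚ * ι (moment₂ f I) + α * ι (moment₁ f I)) + ((α * ½) * (α * ½)) * ι (moment₀ f I)
            ≤ α * (ι (pos Subset.∣ S′ ∣) + ε)
        iso I isolated = begin
          (1ℚ * ι (moment₂ f I) + α * ι (moment₁ f I)) + ((α * ½) * (α * ½)) * ι (moment₀ f I)
            ≡⟨ quadratic-sum f I 1ℚ α ((α * ½) * (α * ½)) ⟨
          ∑ℚ (λ v → ι (𝟙 (v ∈? I)) * ((1ℚ * (φ v * φ v) + α * φ v) + (α * ½) * (α * ½)))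
            ≤⟨ ∑ℚ-mono (λ v → pointwise v (v ∈? I) (isolated? G S′ v)) ⟩
          ∑ℚ (λ v → α * (if does (isolated? G S′ v) then weight v else 0ℚ))
            ≡⟨ ∑ℚ-* α _ ⟩
          α * ∑ℚ (λ v → if does (isolated? G S′ v) then weight v else 0ℚ)
            ≤⟨ ℚ.*-monoˡ-≤-nonNeg α {{ℚ.nonNegative (ℚ.<⇒≤ 0<α)}} bound ⟩
          α * (ι (pos Subset.∣ S′ ∣) + ε) ∎
          where
          open ℚ.≤-Reasoning
          weight : Fin n → ℚ
          weight v = inv α * ((φ v + α * ½) * (φ v + α * ½))
          bound : ∑ℚ (λ v → if does (isolated? G S′ v) then weight v else 0ℚ) ≤ ι (pos Subset.∣ S′ ∣) + ε
          bound = subst (_≤ ι (pos Subset.∣ S′ ∣) + ε) (seq-∑ (isolated? G S′) _ M)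
            (proj₂ (tough S′ ε 0<ε) M (ℕ.≤-trans (ℕ.m≤m⊔n N₃ N₄) (ℕ.m≤n⊔m (N₁ ⊔ N₂) (N₃ ⊔ N₄))))
          pointwise : ∀ v (i : Dec (v Subset.∈ I)) (j : Dec (Isolated G S′ v)) →
            ι (𝟙 i) * ((1ℚ * (φ v * φ v) + α * φ v) + (α * ½) * (α * ½)) ≤ α * (if does j then weight v else 0ℚ)
          pointwise v (yes v∈I) (no ¬iso) = ⊥-elim (¬iso (isolated v∈I))
          -- The reciprocal is taken termwise, so at this index it cancels against `α` exactly.
          pointwise v (yes _) (yes _) = ℚ.≤-reflexive (sym (begin-equality
            α * (inv α * ((φ v + α * ½) * (φ v + α * ½)))
              ≡⟨ ℚ.*-assoc α (inv α) _ ⟨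
            (α * inv α) * ((φ v + α * ½) * (φ v + α * ½))
              ≡⟨ cong (_* ((φ v + α * ½) * (φ v + α * ½))) (proj₁ (*-inv 0<α)) ⟩
            1ℚ * ((φ v + α * ½) * (φ v + α * ½))
              ≡⟨ solve 2 (λ φ α → con 1ℚ :* ((φ :+ α :* con ½) :* (φ :+ α :* con ½)) :=
                   con 1ℚ :* ((con 1ℚ :* (φ :* φ) :+ α :* φ) :+ (α :* con ½) :* (α :* con ½))) refl (φ v) α ⟩
            1ℚ * ((1ℚ * (φ v * φ v) + α * φ v) + (α * ½) * (α * ½)) ∎))
          -- Vertices outside `I` may be isolated too; their weights are nonnegative and only help.
          pointwise v (no _) (yes _) = ℚ.≤-trans (ℚ.≤-reflexive (ℚ.*-zeroˡ ((1ℚ * (φ v * φ v) + α * φ v) + (α * ½) * (α * ½))))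
            (0≤* (ℚ.<⇒≤ 0<α) (0≤* (proj₂ (*-inv 0<α)) (0≤² (φ v + α * ½))))
          pointwise v (no _) (no _) = ℚ.≤-reflexive (trans (ℚ.*-zeroˡ ((1ℚ * (φ v * φ v) + α * φ v) + (α * ½) * (α * ½))) (sym (ℚ.*-zeroʳ α)))

  -- The obstruction contradicts iso-toughness

  module Moments {n : ℕ} (f : Fin n → ℕ) (I : Subset n) where

    private
      module Z = ℤSolver.+-*-Solver
      open Z using () renaming (_:=_ to _⊜_; _:+_ to _⊕_; _:*_ to _⊗_; _:-_ to _⊖_)

    size-sum : ∑[ I ] (λ v → pos 2 ℤ.* pos (f v) ℤ.- 1ℤ) ≡ pos 2 ℤ.* moment₁ f I ℤ.- moment₀ f I
    size-sum = trans (∑-cong λ v → Z.solve 2 (λ i x → i ⊗ (Z.con (pos 2) ⊗ x ⊖ Z.con 1ℤ) ⊜ Z.con (pos 2) ⊗ (i ⊗ x) ⊖ i)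
        refl (𝟙 (v ∈? I)) (pos (f v)))
      (trans (∑-- (λ v → pos 2 ℤ.* (𝟙 (v ∈? I) ℤ.* pos (f v))) (λ v → 𝟙 (v ∈? I)))
        (cong (ℤ._- moment₀ f I) (∑-* (pos 2) (λ v → 𝟙 (v ∈? I) ℤ.* pos (f v)))))

    square-sum : ∑[ I ] (λ v → (pos (f v) ℤ.+ 1ℤ) ℤ.* (pos (f v) ℤ.+ 1ℤ)) ≡
      (moment₂ f I ℤ.+ pos 2 ℤ.* moment₁ f I) ℤ.+ moment₀ f I
    square-sum = trans (∑-cong λ v → Z.solve 2 (λ i x → i ⊗ ((x ⊕ Z.con 1ℤ) ⊗ (x ⊕ Z.con 1ℤ)) ⊜ (i ⊗ (x ⊗ x) ⊕ Z.con (pos 2) ⊗ (i ⊗ x)) ⊕ i)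
        refl (𝟙 (v ∈? I)) (pos (f v)))
      (trans (∑-+ (λ v → 𝟙 (v ∈? I) ℤ.* (pos (f v) ℤ.* pos (f v)) ℤ.+ pos 2 ℤ.* (𝟙 (v ∈? I) ℤ.* pos (f v))) (λ v → 𝟙 (v ∈? I)))
        (cong (ℤ._+ moment₀ f I) (trans (∑-+ (λ v → 𝟙 (v ∈? I) ℤ.* (pos (f v) ℤ.* pos (f v))) (λ v → pos 2 ℤ.* (𝟙 (v ∈? I) ℤ.* pos (f v))))
          (cong (ℤ._+_ (moment₂ f I)) (∑-* (pos 2) (λ v → 𝟙 (v ∈? I) ℤ.* pos (f v)))))))

  ι-- : ∀ i j → ι (i ℤ.- j) ≡ ι i - ι j
  ι-- i j = begin
    ι (i ℤ.- j)                        ≡⟨ solve 2 (λ x y → x := (x :+ y) :- y) refl (ι (i ℤ.- j)) (ι j) ⟩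
    (ι (i ℤ.- j) + ι j) - ι j          ≡⟨ cong (_- ι j) (sym (ι-+ (i ℤ.- j) j)) ⟩
    ι ((i ℤ.- j) ℤ.+ j) - ι j          ≡⟨ cong (λ z → ι z - ι j) (trans (ℤ.+-assoc i (ℤ.- j) j) (trans (cong (ℤ._+_ i) (ℤ.+-inverseˡ j)) (ℤ.+-identityʳ i))) ⟩
    ι i - ι j                          ∎
    where open ≡-Reasoning

  two four : ℚ
  two = ι (pos 2)
  four = ι (pos 4)

  -- 4 (φ + α/2)² - 4 α (2 φ - 1) - (φ + 1)² = (α - φ + 1)² + 2 (φ - 1) (1 + φ - α)
  ψ : ℚ → ℚ → ℚ
  ψ α φ = (ι (pos 3) * (φ * φ) + (- (four * α) - two) * φ) + ((α * α + four * α) - 1ℚ)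

  -- The left side is the total error that the tolerance causes in the final estimate, so one
  -- element of I is enough to absorb it.
  ψ-bound : ∀ α k → 0 ℕ.< k → 1ℚ ≤ α + ε → α ≤ ι (pos k) + ε → four * (α * ε) ≤ ψ α (ι (pos k))
  -- For φ = 1 the form is α², and the difference factors as α (α - 1/2).
  ψ-bound α (suc zero) _ 1≤α _ = fromGap (0≤* (0≤+ (gap 1≤α) (ℚ.nonNegative⁻¹ (pos 7 / 8))) (0≤+ (gap 1≤α) (ℚ.nonNegative⁻¹ (pos 3 / 8))))
    (solve 1 (λ α → (((α :+ con ε) :- con 1ℚ) :+ con (pos 7 / 8)) :* (((α :+ con ε) :- con 1ℚ) :+ con (pos 3 / 8)) :=
      ((con (ι (pos 3)) :* (con 1ℚ :* con 1ℚ) :+ (:- (con four :* α) :- con two) :* con 1ℚ) :+ ((α :* α :+ con four :* α) :- con 1ℚ))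
        :- con four :* (α :* con ε)) refl α)
  -- With x = φ - α the difference is (x - 3/4)² + (φ - 2) (2 x + 3/2) + 2 x + 23/16. The constants
  -- 5/4 and 19/16 arise from writing 2 x as 2 (x + ε) - 1/4, because only x + ε is known to be
  -- nonnegative.
  ψ-bound α k@(suc (suc _)) _ _ α≤φ = fromGap
    (0≤+ (0≤+ (0≤² ((α - φ) + (pos 3 / 4))) (0≤* (gap (ι-mono {pos 2} {pos k} (ℤ.+≤+ (ℕ.s≤s (ℕ.s≤s ℕ.z≤n))))) 0≤x))
      (0≤+ (0≤+ (gap α≤φ) (gap α≤φ)) (ℚ.nonNegative⁻¹ (pos 19 / 16))))
    (solve 2 (λ α φ → ((((α :- φ) :+ con (pos 3 / 4)) :* ((α :- φ) :+ con (pos 3 / 4))) :+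
         (φ :- con two) :* ((((φ :+ con ε) :- α) :+ ((φ :+ con ε) :- α)) :+ con (pos 5 / 4))) :+
         ((((φ :+ con ε) :- α) :+ ((φ :+ con ε) :- α)) :+ con (pos 19 / 16)) :=
      ((con (ι (pos 3)) :* (φ :* φ) :+ (:- (con four :* α) :- con two) :* φ) :+ ((α :* α :+ con four :* α) :- con 1ℚ))
        :- con four :* (α :* con ε)) refl α φ)
    where
    φ = ι (pos k)
    0≤x : 0ℚ ≤ (((φ + ε) - α) + ((φ + ε) - α)) + (pos 5 / 4)
    0≤x = 0≤+ (0≤+ (gap α≤φ) (gap α≤φ)) (ℚ.nonNegative⁻¹ (pos 5 / 4))

  -- The final estimate, and the lower bound on degrees

  module Contradiction {n : ℕ} (G : Graph n) (f : Fin n → ℕ) (a : ℝ)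
    (0<f : ∀ v → 0 ℕ.< f v)
    (1≤a : fromℕ 1 ℝ.≤ a) (a≤f : ∀ v → a ℝ.≤ fromℕ (f v))
    (tough : IsoTough (λ v → 1/ a [ 1≤⇒0< a 1≤a ] ℝ.* (fromℕ (f v) ℝ.+ a ℝ.* fromℚ ½) ²) G)
    (comps : ∀ (S : Subset n) → fromℕ (ω G S) ℝ.< ℝ.∑[ (_∈? S) ] (λ v → fromℕ (f v) ℝ.- a) ℝ.+ fromℕ 2)
    where

    open Sampling G f a 1≤a a≤f tough comps

    not-positive : ∀ {η x} → 0ℚ < η → 0ℚ ≤ x → ¬ x ≡ - (four * η)
    not-positive {η} {x} 0<η 0≤x eq = ℚ.<-irrefl refl (ℚ.<-≤-trans 0<η (fromGap (0≤* {pos 1 / 4} (ℚ.nonNegative⁻¹ (pos 1 / 4)) 0≤x)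
      (trans (cong ((pos 1 / 4) *_) eq) (solve 1 (λ d → con (pos 1 / 4) :* (:- (con four :* d)) := con 0ℚ :- d) refl η))))

    impossible : ¬ Obstruction G f
    impossible O = by-cases (Fin.any? (_∈? I))
      where
      open Obstruction O
      open Sample (sample S′ Z)
      F₀ F₁ F₂ z s q w c : ℚ
      F₀ = ι (moment₀ f I)
      F₁ = ι (moment₁ f I)
      F₂ = ι (moment₂ f I)
      z = ι (pos Subset.∣ Z ∣)
      s = ι (pos Subset.∣ S′ ∣)
      q = ι Q
      w = ι (pos (ω G Z))
      c = ι (∑[ Z ] (λ v → pos (f v)))
      small′ : s ≤ z + (two * F₁ - F₀)
      small′ = subst (s ≤_) (trans (cong (λ x → ι (pos Subset.∣ Z ∣ ℤ.+ x)) (Moments.size-sum f I))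
        (trans (ι-+ (pos Subset.∣ Z ∣) (pos 2 ℤ.* moment₁ f I ℤ.- moment₀ f I)) (cong (_+_ z) (trans (ι-- (pos 2 ℤ.* moment₁ f I) (moment₀ f I))
          (cong (_- F₀) (ι-* (pos 2) (moment₁ f I))))))) (ι-mono small)
      components′ : c + two ≤ w + q
      components′ = subst₂ _≤_ (ι-+ (∑[ Z ] (λ v → pos (f v))) (pos 2)) (ι-+ (pos (ω G Z)) Q) (ι-mono components)
      quadratic′ : four * q ≤ (F₂ + two * F₁) + F₀
      quadratic′ = subst₂ _≤_ (ι-* (pos 4) Q) (trans (cong ι (Moments.square-sum f I))
        (trans (ι-+ (moment₂ f I ℤ.+ pos 2 ℤ.* moment₁ f I) (moment₀ f I)) (cong (_+ F₀)
          (trans (ι-+ (moment₂ f I) (pos 2 ℤ.* moment₁ f I)) (cong (_+_ F₂) (ι-* (pos 2) (moment₁ f I)))))))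
        (ι-mono quadratic)
      0≤q-αz-δ : 0ℚ ≤ q - (α * z + η)
      0≤q-αz-δ = subst (0ℚ ≤_)
        (solve 6 (λ c w q η α z → ((w :+ q) :- (c :+ con two)) :+ (((c :- α :* z) :+ con two) :- (w :+ η)) := q :- (α :* z :+ η))
          refl c w q η α z)
        (0≤+ (gap components′) (gap comp))
      0≤four : 0ℚ ≤ four
      0≤four = ℚ.nonNegative⁻¹ four
      Ψ : ℚ
      Ψ = ∑ℚ (λ v → ι (𝟙 (v ∈? I)) * ψ α (φ v))
      -- Four times iso-toughness, 4 α times the size bound, four times the component bound and once
      -- the quadratic bound: the terms in |Z|, |S′| and Q cancel, and the moments combine into `Ψ`.
      total : Ψ + four * η ≤ four * (α * ε)
      total = fromGap
        (0≤+ (0≤+ (0≤+ (0≤* 0≤four (gap (iso I isolated))) (0≤* 0≤four (0≤* 0≤α (gap small′)))) (0≤* 0≤four 0≤q-αz-δ)) (gap quadratic′))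
        (trans (solve 8 (λ α η F₂ F₁ F₀ s z q →
            ((con four :* ((α :* (s :+ con ε)) :- ((con 1ℚ :* F₂ :+ α :* F₁) :+ ((α :* con ½) :* (α :* con ½)) :* F₀)) :+
              con four :* (α :* ((z :+ (con two :* F₁ :- F₀)) :- s))) :+
              con four :* (q :- (α :* z :+ η))) :+
              (((F₂ :+ con two :* F₁) :+ F₀) :- con four :* q)
            := con four :* (α :* con ε) :-
               (((con (ι (pos 3)) :* F₂ :+ (:- (con four :* α) :- con two) :* F₁) :+ ((α :* α :+ con four :* α) :- con 1ℚ) :* F₀) :+ con four :* η))
          refl α η F₂ F₁ F₀ s z q)
          (cong (λ x → four * (α * ε) - (x + four * η)) (sym (quadratic-sum f I (ι (pos 3)) (- (four * α) - two) ((α * α + four * α) - 1ℚ)))))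
      -- If I has an element, its term alone outweighs the error in `total`. If I is empty, the
      -- quadratic bound gives Q ≤ 0, while the component bound gives Q ≥ α |Z| + η > 0.
      by-cases : Dec (∃ λ v → v Subset.∈ I) → ⊥
      by-cases (no none) = not-positive 0<η
        (0≤+ (0≤+ (0≤* 0≤four 0≤q-αz-δ) (0≤* 0≤four (0≤* 0≤α (ι-mono {0ℤ} {pos Subset.∣ Z ∣} (ℤ.+≤+ ℕ.z≤n)))))
          (gap (subst (four * q ≤_) (cong ι zero-sum) (subst (_≤ ι (∑[ I ] (λ v → (pos (f v) ℤ.+ 1ℤ) ℤ.* (pos (f v) ℤ.+ 1ℤ)))) (ι-* (pos 4) Q) (ι-mono quadratic)))))
        (solve 4 (λ q α z η → (con four :* (q :- (α :* z :+ η)) :+ con four :* (α :* z)) :+ (con 0ℚ :- con four :* q) := :- (con four :* η)) refl q α z η)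
        where
        zero-sum : ∑[ I ] (λ v → (pos (f v) ℤ.+ 1ℤ) ℤ.* (pos (f v) ℤ.+ 1ℤ)) ≡ 0ℤ
        zero-sum = trans (∑-cong λ v → cong (ℤ._* ((pos (f v) ℤ.+ 1ℤ) ℤ.* (pos (f v) ℤ.+ 1ℤ))) (𝟙-no (v ∈? I) λ v∈I → none (v , v∈I))) (∑-0 n)
      by-cases (yes (v , v∈I)) = not-positive 0<η
        (0≤+ (gap total) (gap (ℚ.≤-trans (ℚ.≤-trans (bound v) (ℚ.≤-reflexive (sym at-v))) (term≤∑ℚ (λ u → nonneg u (u ∈? I)) v))))
        (solve 3 (λ x Ψ η → (x :- (Ψ :+ con four :* η)) :+ (Ψ :- x) := :- (con four :* η)) refl (four * (α * ε)) Ψ η)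
        where
        bound : ∀ v → four * (α * ε) ≤ ψ α (φ v)
        bound v = ψ-bound α (f v) (0<f v) 1≤α (α≤φ v)
        at-v : ι (𝟙 (v ∈? I)) * ψ α (φ v) ≡ ψ α (φ v)
        at-v = trans (cong (λ x → ι x * ψ α (φ v)) (𝟙-yes (v ∈? I) v∈I)) (ℚ.*-identityˡ (ψ α (φ v)))
        nonneg : ∀ u (d : Dec (u Subset.∈ I)) → 0ℚ ≤ ι (𝟙 d) * ψ α (φ u)
        nonneg u (yes _) = ℚ.≤-trans (ℚ.≤-trans (0≤* 0≤four (0≤* 0≤α (ℚ.<⇒≤ 0<ε))) (bound u)) (ℚ.≤-reflexive (sym (ℚ.*-identityˡ (ψ α (φ u)))))
        nonneg u (no _)  = ℚ.≤-reflexive (sym (ℚ.*-zeroˡ (ψ α (φ u))))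

    -- Deleting the neighbours of v, at most deg v many, isolates it. Toughness then gives (φ +
    -- α/2)² ≤ α (deg v + ε), and the mixed term α φ on the left rules out deg v ≤ φ - 1.
    f≤deg : ∀ v → f v ℕ.≤ deg G v
    -- If deg v + 1 ≤ φ, dropping the squares leaves 0 ≤ α (ε - 1) = - (7/8) α; adding 7/8 times the
    -- gap of 7/8 ≤ α turns the right side into - 49/64.
    f≤deg v = ℕ.≮⇒≥ λ deg<f → from-no (0ℚ ℚ.≤? ℚ.- (pos 49 / 64)) (subst (0ℚ ≤_)
        (trans (cong (λ x → ((((α * (s + ε) - x) + α * (d - s)) + α * (φ v - (1ℚ + d))) + (φ v * φ v + (α * ½) * (α * ½))) + (pos 7 / 8) * ((α + ε) - 1ℚ)) moments)
          (solve 4 (λ α s d φ → ((((α :* (s :+ con ε) :- ((con 1ℚ :* (φ :* φ) :+ α :* φ) :+ ((α :* con ½) :* (α :* con ½)) :* con 1ℚ)) :+ α :* (d :- s))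
              :+ α :* (φ :- (con 1ℚ :+ d))) :+ (φ :* φ :+ (α :* con ½) :* (α :* con ½))) :+ con (pos 7 / 8) :* ((α :+ con ε) :- con 1ℚ)
              := con (ℚ.- (pos 49 / 64))) refl α s d (φ v)))
        (0≤+ (0≤+ (0≤+ (0≤+ (gap (iso I isolated)) (0≤* 0≤α (gap size′))) (0≤* 0≤α (gap (d<φ deg<f))))
          (0≤+ (0≤² (φ v)) (0≤² (α * ½)))) (0≤* (ℚ.nonNegative⁻¹ (pos 7 / 8)) (gap 1≤α))))
      where
      I = subset (v Fin.≟_)
      isolating = isolating-set G f Subset.⊥ I (λ _ → ∉⊥)
        (λ {x} {y} x∈ y∈ → subst₂ (λ x y → mult G x y ≡ 0) (∈-subset⁻ (v Fin.≟_) x∈) (∈-subset⁻ (v Fin.≟_) y∈) (loopless G v))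
      S′ = proj₁ isolating
      isolated = proj₁ (proj₂ isolating)
      open Sample (sample S′ Subset.⊥)
      s d : ℚ
      s = ι (pos Subset.∣ S′ ∣)
      d = ι (pos (deg G v))
      ∑-I : ∀ h → ∑[ I ] h ≡ h v
      ∑-I h = trans (∑-subset (v Fin.≟_) h) (∑-δ v h)
      size′ : s ≤ d
      size′ = ι-mono (ℤ.≤-trans (proj₂ (proj₂ isolating)) (ℤ.≤-reflexive (begin
        pos Subset.∣ Subset.⊥ {n} ∣ ℤ.+ ∑[ I ] degree-outside G Subset.⊥
          ≡⟨ cong₂ ℤ._+_ (cong pos (∣⊥∣≡0 n)) (∑-I (degree-outside G Subset.⊥)) ⟩
        0ℤ ℤ.+ degree-outside G Subset.⊥ v
          ≡⟨ ℤ.+-identityˡ _ ⟩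
        degree-outside G Subset.⊥ v
          ≡⟨ ∑-cong (λ u → trans (cong (λ x → (1ℤ ℤ.- x) ℤ.* pos (mult G v u)) (𝟙-no (u ∈? Subset.⊥) ∉⊥)) (ℤ.*-identityˡ (pos (mult G v u)))) ⟩
        ∑ (λ u → pos (mult G v u))
          ≡⟨ ∑-pos (mult G v) ⟨
        pos (deg G v) ∎)))
        where open ≡-Reasoning
      d<φ : deg G v ℕ.< f v → 1ℚ + d ≤ φ v
      d<φ deg<f = subst (_≤ φ v) (trans (cong ι (ℤ.pos-+ 1 (deg G v))) (ι-+ 1ℤ (pos (deg G v)))) (ι-mono (ℤ.+≤+ deg<f))
      moments : (1ℚ * ι (moment₂ f I) + α * ι (moment₁ f I)) + ((α * ½) * (α * ½)) * ι (moment₀ f I) ≡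
        (1ℚ * (φ v * φ v) + α * φ v) + ((α * ½) * (α * ½)) * 1ℚ
      moments = cong₂ (λ x y → (1ℚ * proj₁ x + α * proj₂ x) + ((α * ½) * (α * ½)) * y)
        (cong₂ _,_ (trans (cong ι (∑-I (λ u → pos (f u) ℤ.* pos (f u)))) (ι-* (pos (f v)) (pos (f v)))) (cong ι (∑-I (λ u → pos (f u)))))
        (cong ι (trans (∑-cong (𝟙-subset (v Fin.≟_))) (∑-δ₁ v)))

    near-factor : HasNearFactor f G
    near-factor = Descent.near-factor G f f≤deg (impossible ∘ obstruction G f)


open import Defs
open import Data.Nat.Base as ℕ using (ℕ)
open import Data.Fin.Base using (Fin)
open import Data.Fin.Subset using (Subset)
open import Data.Fin.Subset.Properties using (_∈?_)
open import Data.Rational.Base using (½)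

mainTheorem5 : ∀ (n : ℕ) (G : Graph n) (f : Fin n → ℕ) (a : ℝ) →
    (∀ v → 0 ℕ.< f v) →
    (1≤a : fromℕ 1 ≤ a) →
    (∀ v → a ≤ fromℕ (f v)) →
    IsoTough (λ v → 1/ a [ 1≤⇒0< a 1≤a ] * (fromℕ (f v) + a * fromℚ ½) ²) G →
    (∀ (S : Subset n) →
    fromℕ (ω G S) < ∑[ (_∈? S) ] (λ v → fromℕ (f v) - a) + fromℕ 2) →
    HasNearFactor f G
mainTheorem5 n G f a 0<f 1≤a a≤f tough components =
  Reals.Contradiction.near-factor G f a 0<f 1≤a a≤f tough components
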